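{- The problem $r$-Simple $k$-Path on graphs with $n$ vertices can be solved by a deterministic algorithm in time $$O\left(r^{8k/r+o(k/r)}\cdot 2^{O(k/r)}\cdot k^{O(1)}\cdot n^3\cdot\log n\right).$$
   Context: $r$-Simple $k$-Path: given a graph on $n$ vertices and positive integers $r,k$, decide whether the graph contains a (not necessarily simple) path, i.e. a walk, of length $k$ in which no vertex is visited more than $r$ times. Here $o(k/r)$ denotes $(k/r)\cdot o(1)$, where the $o(1)$ term is independent of $n$ and tends to $0$ as $k\to\infty$; the constants hidden in the $O(\cdot)$'s are absolute. -}

module Defs where

open import Data.Bool.Base using (Bool; true; false; if_then_else_)
open import Data.Fin.Base using (Fin; suc; inject₁; fromℕ<; remQuot)
open import Data.Fin.Properties using (_≟_)
open import Data.List.Base using (List; head; drop)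
open import Data.Maybe.Base using (Maybe; just; nothing)
open import Data.Nat.Base
  using (ℕ; zero; suc; _+_; _*_; _∸_; _/_; _^_; _≤_; _<_; _≡ᵇ_)
open import Data.Nat.Properties using (_<?_)
open import Data.Product.Base using (∃-syntax; _×_; _,_; uncurry)
open import Data.Vec.Base using (Vec; count; lookup)
open import Function.Bundles using (_⇔_)
open import Relation.Binary.PropositionalEquality using (_≡_; _≢_)
open import Relation.Nullary.Decidable using (yes; no)

-- Finite simple undirected graphs on the vertex set Fin n.
record Graph (n : ℕ) : Set where
  field
    adj     : Fin n → Fin n → Bool
    adj-sym : ∀ u v → adj u v ≡ adj v u
    no-loop : ∀ v → adj v v ≡ false

open Graph public

-- The length of a walk is its number of edges.
IsWalk : ∀ {n} → Graph n → (k : ℕ) → Vec (Fin n) (suc k) → Set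
IsWalk G k p = ∀ (i : Fin k) →
  adj G (lookup p (inject₁ i)) (lookup p (suc i)) ≡ true

visits : ∀ {n m} → Fin n → Vec (Fin n) m → ℕ
visits v p = count (v ≟_) p

RSimpleKPath : ∀ {n} → Graph n → (r k : ℕ) → Set
RSimpleKPath {n} G r k =
  ∃[ p ] (IsWalk G k p × (∀ (v : Fin n) → visits v p ≤ r))

-- A unit-cost word RAM.  The only storage is a memory of words indexed by
-- addresses.  Cells hold arbitrary naturals here; the restriction to words of
-- bounded length is the predicate FitsIn below.

data ArithOp : Set where
  add sub mul div : ArithOp

data Instr : Set where
  const : (dst c : ℕ) → Instr                    -- M[dst] ← c
  arith : ArithOp → (dst a b : ℕ) → Instr        -- M[dst] ← M[a] op M[b]
  load  : (dst a : ℕ) → Instr                    -- M[dst] ← M[M[a]]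
  store : (a b : ℕ) → Instr                      -- M[M[a]] ← M[b]
  jz    : (a l : ℕ) → Instr                      -- if M[a] = 0, go to line l

Program : Set
Program = List Instr

Memory : Set
Memory = ℕ → ℕ

record State : Set where
  constructor ⟨_,_⟩
  field
    pc  : ℕ
    mem : Memory

open State public

_[_≔_] : Memory → ℕ → ℕ → Memory
(M [ a ≔ x ]) b = if a ≡ᵇ b then x else M b

-- Subtraction is truncated at 0, and x / 0 = 0.
apply : ArithOp → ℕ → ℕ → ℕ
apply add x y       = x + y
apply sub x y       = x ∸ y
apply mul x y       = x * y
apply div x zero    = 0
apply div x (suc y) = x / suc y

exec : Instr → State → State
exec (const d c)    ⟨ i , M ⟩ = ⟨ suc i , M [ d ≔ c ] ⟩
exec (arith o d a b) ⟨ i , M ⟩ = ⟨ suc i , M [ d ≔ apply o (M a) (M b) ] ⟩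
exec (load d a)     ⟨ i , M ⟩ = ⟨ suc i , M [ d ≔ M (M a) ] ⟩
exec (store a b)    ⟨ i , M ⟩ = ⟨ suc i , M [ M a ≔ M b ] ⟩
exec (jz a l)       ⟨ i , M ⟩ = ⟨ (if M a ≡ᵇ 0 then l else suc i) , M ⟩

fetch : Program → ℕ → Maybe Instr
fetch P i = head (drop i P)

-- The machine halts when the program counter leaves the program.
Halted : Program → State → Set
Halted P s = fetch P (pc s) ≡ nothing

step : Program → State → State
step P s with fetch P (pc s)
... | just I  = exec I s
... | nothing = s

run : Program → ℕ → State → State
run P zero    s = s
run P (suc t) s = run P t (step P s)

FitsIn : (w : ℕ) → Memory → Set
FitsIn w M = ∀ a → M a < 2 ^ w

-- Input: n, k, r in cells 0, 1, 2, then the adjacency matrix row by row;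
-- every other cell is 0.
matrixCell : ∀ {n} → Graph n → ℕ → ℕ
matrixCell {n} G a with a <? n * n
... | yes a<n² = if uncurry (adj G) (remQuot n (fromℕ< a<n²)) then 1 else 0
... | no  _    = 0

input : ∀ {n} → Graph n → (r k : ℕ) → Memory
input {n} G r k 0 = n
input     G r k 1 = k
input     G r k 2 = r
input     G r k (suc (suc (suc a))) = matrixCell G a

start : ∀ {n} → Graph n → (r k : ℕ) → State
start G r k = ⟨ 0 , input G r k ⟩

-- Within t steps, P halts with cell 0 nonzero exactly on yes-instances, and
-- no word longer than w bits ever occurs.
record DecidesWithin (t w : ℕ) (P : Program) {n : ℕ} (G : Graph n) (r k : ℕ)
  : Set where
  field
    halts   : Halted P (run P t (start G r k))
    correct : mem (run P t (start G r k)) 0 ≢ 0 ⇔ RSimpleKPath G r k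
    fits    : ∀ s → s ≤ t → FitsIn w (mem (run P s (start G r k)))

-- t ≤ A · B^(1/r) for r ≥ 1, with the r-th root cleared.
_≤_·_^[1/_] : (t A B r : ℕ) → Set
t ≤ A · B ^[1/ r ] = t ^ r ≤ A ^ r * B

infix 4 _≤_·_^[1/_]

-- f(k) / k → 0 as k → ∞.
LittleO : (ℕ → ℕ) → Set
LittleO f = ∀ m → ∃[ K ] (∀ k → K ≤ k → m * f k ≤ k)

{-# OPTIONS --safe #-}

-- Put q = ⌊k / r⌋, R = min r (k + 1) and Q = q + 1.  Colour the vertices with 2 Q + 1 colours and
-- look for a walk of k edges that meets every colour class at most R times, by dynamic programming
-- over the end vertex and the vector of class counts, written in base R + 1.  A walk found in this
-- way is r-simple for every colouring.  Conversely an r-simple walk is found as soon as each class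
-- carries at most R of its k + 1 visits, so a small family of colourings is needed that contains
-- such a balanced one for every r-simple walk.
--
-- The colouring of x depends on z = a x mod P, with P = Q F n and F = 128 (k + 1)³, and on an
-- interval partition of [0, P).  The partition is the one obtained greedily from the leaves of the
-- binary tree of dyadic cells in which exactly the cells of weight more than R are split.  Each level
-- of the tree has at most Q split cells, and the log₂ R + O(1) top levels pay for these.  Below
-- them, a split cell of weight > R contains for each of its visits another vertex that is close
-- under x ↦ a x mod P.  Averaged over a there are only O(k) such pairs, hence O(Q) split cells, and
-- the cells of width n at the bottom are never split.  Thus the tree is traversed by a string of
-- 3 Q log₂ R + O(Q) + O(log k) moves of four kinds, and trying all strings costs
-- (2 R)^(6 Q) 2^(O(Q)) k^(O(1)).  With (R + 1)^(2 Q + 1) count vectors, n k^(O(1)) multipliers a and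
-- n² steps per count vector the total is r^(8 k / r) 2^(O(k / r)) k^(O(1)) n³.
module Submission where

open import Defs
open import Data.Bool.Base using (true; false; T; not; if_then_else_)
open import Data.Empty using (⊥; ⊥-elim)
open import Data.Fin.Base as Fin using (Fin; toℕ; fromℕ<; remQuot; combine)
import Data.Fin.Properties as Fin
open import Data.Fin.Properties using (toℕ<n; toℕ-fromℕ<; toℕ-combine; remQuot-combine; toℕ-injective)
open import Data.List.Base using (List; []; _∷_; _++_; length; replicate; head; drop)
open import Data.List.Membership.Propositional using (_∈_)
open import Data.List.Properties using (length-++; length-replicate; ++-assoc; ++-identityʳ)
open import Data.List.Relation.Unary.Any using (here; there)
open import Data.Maybe.Base using (just; nothing)
open import Data.Nat.Base
open import Data.Nat.Divisibility using (divides-refl)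
open import Data.Nat.DivMod hiding (_div_; _mod_)
open import Data.Nat.Logarithm using (⌊log₂_⌋; ⌊log₂[2^n]⌋≡n; ⌊log₂⌋-mono-≤)
open import Data.Nat.Properties
open import Data.Nat.Tactic.RingSolver using (solve-∀)
open import Data.Product.Base using (Σ; ∃-syntax; _×_; _,_; proj₁; proj₂; uncurry)
open import Data.Sum.Base using (_⊎_; inj₁; inj₂; [_,_]′)
open import Data.Unit.Base using (⊤; tt)
open import Data.Vec.Base using (Vec; []; _∷_; lookup)
open import Data.Vec.Properties using (count≤n)
open import Function.Bundles using (mk⇔)
open import Relation.Binary.Definitions using (tri<; tri≈; tri>)
open import Relation.Binary.PropositionalEquality hiding (J)
open import Relation.Nullary.Decidable using (Dec; yes; no; does; ¬?; _×-dec_)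
open import Relation.Nullary.Negation using (¬_; contradiction)

-- Counting and hashing

-- The string of moves solves a counting problem. Separating k + 1 hash values needs a scale
-- polynomial in k, and choosing 2 Q cut points freely on it costs about log k bits each, too much
-- for small r. Describing the cuts by the tree charges only for crowding: `halve` and `double`
-- bracket the halves of a split cell and each leaf costs one `advance`, so a split costs three
-- moves of two bits each. This is the 6 in the exponent. The modulus P is composite. Only
-- differences d below n occur, and for a < P the products a d run exactly d times around the
-- residues, which gives the estimate for pairs without inverses. A string is interpreted separately
-- for each vertex and yields (R + 1)^c instead of the colour c. This is what the vertex adds to a
-- count vector, so neither tree nor cuts are stored. Many strings describe no tree, but they still
-- assign a power of R + 1 to every vertex. That is enough for soundness, and guards in the moves
-- keep the values within a word. The cap k + 1 on R keeps R polynomial in k when r exceeds k.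

#_ : ∀ {P : Set} → Dec P → ℕ
# d = if does d then 1 else 0

infix 9 #_

#-yes : ∀ {P : Set} (d : Dec P) → P → # d ≡ 1
#-yes (yes _) p = refl
#-yes (no ¬p) p = contradiction p ¬p

#-no : ∀ {P : Set} (d : Dec P) → ¬ P → # d ≡ 0
#-no (yes p) ¬p = contradiction p ¬p
#-no (no _)  ¬p = refl

#≤1 : ∀ {P : Set} (d : Dec P) → # d ≤ 1
#≤1 (yes _) = ≤-refl
#≤1 (no _)  = z≤n

#-mono : ∀ {P Q : Set} (d : Dec P) (e : Dec Q) → (P → Q) → # d ≤ # e
#-mono (yes p) e f = ≤-reflexive (sym (#-yes e (f p)))
#-mono (no _)  e f = z≤n

#≤ : ∀ {P : Set} (d : Dec P) {m} → (P → 1 ≤ m) → # d ≤ m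
#≤ (yes p) f = f p
#≤ (no _)  f = z≤n

#-cases : ∀ {P : Set} (d : Dec P) → (P × # d ≡ 1) ⊎ (¬ P × # d ≡ 0)
#-cases (yes p) = inj₁ (p , refl)
#-cases (no ¬p) = inj₂ (¬p , refl)

sum< : ℕ → (ℕ → ℕ) → ℕ
sum< zero    f = 0
sum< (suc N) f = f N + sum< N f

sum<-+ : ∀ N f g → sum< N (λ a → f a + g a) ≡ sum< N f + sum< N g
sum<-+ zero    f g = refl
sum<-+ (suc N) f g rewrite sum<-+ N f g = swap (f N) (g N) (sum< N f) (sum< N g)
  where
  swap : ∀ a b c d → (a + b) + (c + d) ≡ (a + c) + (b + d)
  swap = solve-∀

sum<-*ˡ : ∀ N c f → sum< N (λ a → c * f a) ≡ c * sum< N f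
sum<-*ˡ zero    c f = sym (*-zeroʳ c)
sum<-*ˡ (suc N) c f rewrite sum<-*ˡ N c f = sym (*-distribˡ-+ c (f N) (sum< N f))

sum<-mono : ∀ N {f g} → (∀ a → f a ≤ g a) → sum< N f ≤ sum< N g
sum<-mono zero    le = z≤n
sum<-mono (suc N) le = +-mono-≤ (le N) (sum<-mono N le)

sum<-zero : ∀ N → sum< N (λ _ → 0) ≡ 0
sum<-zero zero    = refl
sum<-zero (suc N) = sum<-zero N

below-average : ∀ N f c → sum< N f < N * c → ∃[ a ] (a < N × f a < c)
below-average (suc N) f c lt with f N <? c
... | yes p = N , ≤-refl , p
... | no ¬p with below-average N f c (+-cancelˡ-< c _ _ (≤-<-trans (+-monoˡ-≤ _ (≮⇒≥ ¬p)) lt))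
... | a , a<N , fa = a , m<n⇒m<1+n a<N , fa

sumL : List ℕ → (ℕ → ℕ) → ℕ
sumL []       f = 0
sumL (x ∷ xs) f = f x + sumL xs f

sumL-mono : ∀ xs {f g} → (∀ {x} → x ∈ xs → f x ≤ g x) → sumL xs f ≤ sumL xs g
sumL-mono []       le = z≤n
sumL-mono (x ∷ xs) le = +-mono-≤ (le (here refl)) (sumL-mono xs (λ p → le (there p)))

sumL-cong : ∀ xs {f g} → (∀ x → f x ≡ g x) → sumL xs f ≡ sumL xs g
sumL-cong []       e = refl
sumL-cong (x ∷ xs) e = cong₂ _+_ (e x) (sumL-cong xs e)

sumL-+ : ∀ xs f g → sumL xs (λ x → f x + g x) ≡ sumL xs f + sumL xs g
sumL-+ []       f g = refl
sumL-+ (x ∷ xs) f g rewrite sumL-+ xs f g = swap (f x) (g x) (sumL xs f) (sumL xs g)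
  where
  swap : ∀ a b c d → (a + b) + (c + d) ≡ (a + c) + (b + d)
  swap = solve-∀

sumL-const : ∀ xs c → sumL xs (λ _ → c) ≡ length xs * c
sumL-const []       c = refl
sumL-const (x ∷ xs) c = cong (c +_) (sumL-const xs c)

sumL-∈ : ∀ {xs x} f → x ∈ xs → f x ≤ sumL xs f
sumL-∈ {y ∷ ys} f (here refl) = m≤m+n (f y) _
sumL-∈ {y ∷ ys} f (there p)   = ≤-trans (sumL-∈ f p) (m≤n+m _ (f y))

sum<-sumL : ∀ N xs (f : ℕ → ℕ → ℕ) C → (∀ {x} → x ∈ xs → sum< N (λ a → f a x) ≤ C) →
            sum< N (λ a → sumL xs (f a)) ≤ length xs * C
sum<-sumL N []       f C le = ≤-reflexive (sum<-zero N)
sum<-sumL N (x ∷ xs) f C le =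
  subst (_≤ C + length xs * C) (sym (sum<-+ N (λ a → f a x) (λ a → sumL xs (f a))))
    (+-mono-≤ (le (here refl)) (sum<-sumL N xs f C (λ p → le (there p))))

-- Multiples of a number as residues modulo P

division-unique : ∀ {P} .{{_ : NonZero P}} {ρ ρ′ q q′} → ρ < P → ρ′ < P →
                  ρ + q * P ≡ ρ′ + q′ * P → ρ ≡ ρ′ × q ≡ q′
division-unique {P} {ρ} {ρ′} {q} {q′} ρ< ρ′< e =
  ρ≡ , *-cancelʳ-≡ q q′ P (+-cancelˡ-≡ ρ _ _ (trans e (cong (_+ q′ * P) (sym ρ≡))))
  where
  ρ≡ : ρ ≡ ρ′
  ρ≡ = begin
    ρ                  ≡⟨ sym (m<n⇒m%n≡m ρ<) ⟩
    ρ % P              ≡⟨ sym ([m+kn]%n≡m%n ρ q P) ⟩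
    (ρ + q * P) % P    ≡⟨ cong (_% P) e ⟩
    (ρ′ + q′ * P) % P  ≡⟨ [m+kn]%n≡m%n ρ′ q′ P ⟩
    ρ′ % P             ≡⟨ m<n⇒m%n≡m ρ′< ⟩
    ρ′                 ∎ where open ≡-Reasoning

-- The multiples of d advance along the residues mod P in steps of d, so the potential
-- q W + φ ρ of N d = q P + ρ pays d for every hit.
module Hits {P d W : ℕ} .{{_ : NonZero P}} (d≤P : d ≤ P) (hit φ : ℕ → ℕ)
  (wrap : ∀ {ρ} → ρ < P → d * hit ρ + φ ρ ≤ W)
  (move : ∀ {ρ} → ρ < P → d * hit ρ + φ ρ ≤ φ (d + ρ)) where

  potential : ∀ N {q ρ} → ρ < P → ρ + q * P ≡ N * d →
              d * sum< N (λ a → hit ((a * d) % P)) ≤ q * W + φ ρ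
  potential zero ρ< e = ≤-trans (≤-reflexive (*-zeroʳ d)) z≤n
  potential (suc N) {q′} {ρ′} ρ′< e = begin
    d * (hit ρ + sum< N h)          ≡⟨ *-distribˡ-+ d (hit ρ) _ ⟩
    d * hit ρ + d * sum< N h        ≤⟨ +-monoʳ-≤ (d * hit ρ) (potential N {q} {ρ} (m%n<n (N * d) P) (sym (m≡m%n+[m/n]*n (N * d) P))) ⟩
    d * hit ρ + (q * W + φ ρ)       ≡⟨ shift (d * hit ρ) (q * W) (φ ρ) ⟩
    q * W + (d * hit ρ + φ ρ)       ≤⟨ advance ⟩
    q′ * W + φ ρ′                   ∎
    where
    open ≤-Reasoning
    h = λ a → hit ((a * d) % P)
    q = N * d / P
    ρ = (N * d) % P
    ρ< = m%n<n (N * d) P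
    shift : ∀ a b c → a + (b + c) ≡ b + (a + c)
    shift = solve-∀
    assoc : ∀ a b c → a + b + c ≡ c + (a + b)
    assoc = solve-∀
    total : d + ρ + q * P ≡ ρ′ + q′ * P
    total = trans (+-assoc d ρ (q * P))
              (trans (cong (d +_) (sym (m≡m%n+[m/n]*n (N * d) P))) (sym e))
    advance : q * W + (d * hit ρ + φ ρ) ≤ q′ * W + φ ρ′
    -- Without a wrap the quotient stays and `move` pays for the step. A wrap raises the quotient by
    -- one, and the gained `W` pays by `wrap`, whatever the new residue is.
    advance with d + ρ <? P
    ... | yes small =
      let ρ≡ , q≡ = division-unique {q = q} {q′ = q′} small ρ′< total
      in subst₂ (λ ρ′ q′ → q * W + (d * hit ρ + φ ρ) ≤ q′ * W + φ ρ′) ρ≡ q≡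
           (+-monoʳ-≤ (q * W) (move ρ<))
    ... | no big =
      let ρ≡ , q≡ = division-unique {q = suc q} {q′ = q′} excess ρ′< total′
      in subst₂ (λ ρ′ q′ → q * W + (d * hit ρ + φ ρ) ≤ q′ * W + φ ρ′) ρ≡ q≡
           (≤-trans (+-monoʳ-≤ (q * W) (wrap ρ<))
             (≤-trans (≤-reflexive (+-comm (q * W) W)) (m≤m+n _ _)))
      where
      excess : d + ρ ∸ P < P
      excess = +-cancelˡ-< P _ _ (subst (_< P + P) (sym (m+[n∸m]≡n (≮⇒≥ big))) (+-mono-≤-< d≤P ρ<))
      total′ : d + ρ ∸ P + suc q * P ≡ ρ′ + q′ * P
      total′ = trans (sym (+-assoc (d + ρ ∸ P) P (q * P)))
                 (trans (cong (_+ q * P) (m∸n+n≡m (≮⇒≥ big))) total)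

  -- After `P` steps the multiple of `d` has made exactly `d` full turns, so the potential is
  -- `d * W` and the factor `d` cancels. This replaces the invertibility of `d` modulo a prime.
  hits-bound : 0 < d → φ 0 ≡ 0 → sum< P (λ a → hit ((a * d) % P)) ≤ W
  hits-bound (s≤s _) φ0 = *-cancelˡ-≤ d (≤-trans (potential P {d} {0} (>-nonZero⁻¹ P) (*-comm d P))
                      (≤-reflexive (trans (cong (d * W +_) φ0) (+-identityʳ _))))

-- Closeness of hash values, averaged over the multiplier

dyadic : ℕ → ℕ → ℕ
dyadic n zero    = n
dyadic n (suc h) = dyadic n h + dyadic n h

module Hashing (P n : ℕ) .{{_ : NonZero P}} where

  z : ℕ → ℕ → ℕ
  z a x = (a * x) % P

  near : ℕ → ℕ → ℕ → ℕ → ℕ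
  near V a x y = # ((z a x <? z a y + V) ×-dec (z a y <? z a x + V))

  near-sym : ∀ V a x y → near V a x y ≤ near V a y x
  near-sym V a x y = #-mono ((z a x <? z a y + V) ×-dec (z a y <? z a x + V))
                            ((z a y <? z a x + V) ×-dec (z a x <? z a y + V)) (λ (p , q) → q , p)

  window : ℕ → ℕ → ℕ
  window V ρ = # (ρ <? V) + # (P <? ρ + V)

  -- Hashing is additive modulo `P`: the two hash values differ by `ρ` if the addition does not wrap
  -- and by `ρ - P` if it does. Closeness forces `ρ` to the lower end of the residues in the first
  -- case and to the upper end in the second.
  near-window : ∀ V a x d → near V a x (d + x) ≤ window V ((a * d) % P)
  near-window V a x d = #≤ ((z a x <? z a (d + x) + V) ×-dec (z a (d + x) <? z a x + V)) hits
    where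
    ρ = (a * d) % P
    swap : ∀ a b c → a + b + c ≡ a + c + b
    swap = solve-∀
    shifted : z a (d + x) ≡ (ρ + z a x) % P
    shifted = trans (cong (_% P) (*-distribˡ-+ a d x)) (%-distribˡ-+ (a * d) (a * x) P)
    hits : z a x < z a (d + x) + V × z a (d + x) < z a x + V → 1 ≤ window V ρ
    hits (p , q) with ρ + z a x <? P
    ... | yes small =
      ≤-trans (≤-reflexive (sym (#-yes (ρ <? V)
        (+-cancelʳ-< (z a x) _ _ (subst₂ _<_ (trans shifted (m<n⇒m%n≡m small)) (+-comm (z a x) V) q)))))
        (m≤m+n _ _)
    ... | no big =
      ≤-trans (≤-reflexive (sym (#-yes (P <? ρ + V) (+-cancelʳ-< (z a x) _ _ goal))))
        (m≤n+m _ (# (ρ <? V)))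
      where
      big′ = ≮⇒≥ big
      sum≡ : z a (d + x) ≡ ρ + z a x ∸ P
      sum≡ = trans shifted
                (trans (sym (cong (_% P) (m∸n+n≡m big′)))
                  (trans ([m+n]%n≡m%n (ρ + z a x ∸ P) P)
                    (m<n⇒m%n≡m (+-cancelʳ-< P _ _
                      (subst (_< P + P) (sym (m∸n+n≡m big′)) (+-mono-< (m%n<n (a * d) P) (m%n<n (a * x) P)))))))
      goal : P + z a x < ρ + V + z a x
      goal = subst₂ _<_ (+-comm (z a x) P)
        (trans (swap (ρ + z a x ∸ P) V P)
          (trans (cong (_+ V) (m∸n+n≡m big′)) (swap ρ (z a x) V)))
        (+-monoˡ-< P (subst (λ y → z a x < y + V) sum≡ p))

  -- One turn in steps of `d` meets either end of the residues at most about V / d + 1 times. The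
  -- truncated potentials `φ₁` and `φ₂` pay for the lower and the upper end, at most `V + d` each
  -- per turn, and `d ≤ V` gives the total.
  window-bound : ∀ V d → 0 < d → d ≤ P → d ≤ V → sum< P (λ a → window V ((a * d) % P)) ≤ 4 * V
  window-bound V d 0<d d≤P d≤V =
    ≤-trans (Hits.hits-bound {P} {d} {V + d + (V + d)} d≤P (window V) φ wrap move 0<d φ0)
      (≤-trans (+-mono-≤ (+-monoʳ-≤ V d≤V) (+-monoʳ-≤ V d≤V)) (≤-reflexive (four V)))
    where
    four : ∀ V → V + V + (V + V) ≡ 4 * V
    four = solve-∀
    φ₁ φ₂ φ : ℕ → ℕ
    φ₁ ρ = ρ ⊓ (V + d)
    φ₂ ρ = ρ ∸ (P ∸ V)
    φ ρ  = φ₁ ρ + φ₂ ρ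
    φ0 : φ 0 ≡ 0
    φ0 = 0∸n≡0 (P ∸ V)
    split : ∀ d a b x y → d * (a + b) + (x + y) ≡ (d * a + x) + (d * b + y)
    split = solve-∀
    φ₂≤V : ∀ {ρ} → ρ < P → φ₂ ρ ≤ V
    φ₂≤V ρ< = ≤-trans (∸-monoˡ-≤ (P ∸ V) (<⇒≤ ρ<)) (m≤n+o⇒m∸n≤o P (P ∸ V) (m≤n+m∸n′))
      where
      m≤n+m∸n′ : P ≤ P ∸ V + V
      m≤n+m∸n′ = subst (P ≤_) (+-comm V (P ∸ V)) (m≤n+m∸n P V)
    wrap₁ : ∀ {ρ} → d * # (ρ <? V) + φ₁ ρ ≤ V + d
    wrap₁ {ρ} with #-cases (ρ <? V)
    ... | inj₁ (p , e) rewrite e = ≤-trans (≤-reflexive (cong₂ _+_ (*-identityʳ d) refl))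
                    (≤-trans (+-monoʳ-≤ d (≤-trans (m⊓n≤m ρ (V + d)) (<⇒≤ p))) (≤-reflexive (+-comm d V)))
    ... | inj₂ (_ , e) rewrite e = ≤-trans (≤-reflexive (cong (_+ φ₁ ρ) (*-zeroʳ d))) (m⊓n≤n ρ (V + d))
    wrap₂ : ∀ {ρ} → ρ < P → d * # (P <? ρ + V) + φ₂ ρ ≤ V + d
    wrap₂ {ρ} ρ< = ≤-trans (+-mono-≤ (≤-trans (*-monoʳ-≤ d (#≤1 (P <? ρ + V))) (≤-reflexive (*-identityʳ d))) (φ₂≤V ρ<))
                     (≤-reflexive (+-comm d V))
    wrap : ∀ {ρ} → ρ < P → d * window V ρ + φ ρ ≤ V + d + (V + d)
    wrap {ρ} ρ< = ≤-trans (≤-reflexive (split d (# (ρ <? V)) (# (P <? ρ + V)) (φ₁ ρ) (φ₂ ρ)))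
                    (+-mono-≤ wrap₁ (wrap₂ ρ<))
    move₁ : ∀ {ρ} → d * # (ρ <? V) + φ₁ ρ ≤ φ₁ (d + ρ)
    move₁ {ρ} with #-cases (ρ <? V)
    ... | inj₁ (p , e) rewrite e = ≤-trans (+-mono-≤ (≤-reflexive (*-identityʳ d)) (m⊓n≤m ρ (V + d)))
                    (≤-reflexive (sym (m≤n⇒m⊓n≡m (subst (d + ρ ≤_) (+-comm d V) (+-monoʳ-≤ d (<⇒≤ p))))))
    ... | inj₂ (_ , e) rewrite e = ≤-trans (≤-reflexive (cong (_+ φ₁ ρ) (*-zeroʳ d))) (⊓-monoˡ-≤ (V + d) (m≤n+m ρ d))
    move₂ : ∀ {ρ} → d * # (P <? ρ + V) + φ₂ ρ ≤ φ₂ (d + ρ)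
    move₂ {ρ} with #-cases (P <? ρ + V)
    ... | inj₁ (p , e) rewrite e = ≤-reflexive (trans (cong (_+ φ₂ ρ) (*-identityʳ d))
                    (sym (+-∸-assoc d (m≤n+o⇒m∸n≤o P V (subst (P ≤_) (+-comm ρ V) (<⇒≤ p))))))
    ... | inj₂ (_ , e) rewrite e = ≤-trans (≤-reflexive (cong (_+ φ₂ ρ) (*-zeroʳ d))) (∸-monoˡ-≤ (P ∸ V) (m≤n+m ρ d))
    move : ∀ {ρ} → ρ < P → d * window V ρ + φ ρ ≤ φ (d + ρ)
    move {ρ} _ = ≤-trans (≤-reflexive (split d (# (ρ <? V)) (# (P <? ρ + V)) (φ₁ ρ) (φ₂ ρ)))
                   (+-mono-≤ move₁ move₂)

  near-ordered : ∀ V {x y} → x < y → y < n → n ≤ P → n ≤ V → sum< P (λ a → near V a x y) ≤ 4 * V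
  near-ordered V {x} {y} x<y y<n n≤P n≤V =
    ≤-trans (sum<-mono P (λ a → subst (λ w → near V a x w ≤ window V ((a * (y ∸ x)) % P)) (m∸n+n≡m (<⇒≤ x<y)) (near-window V a x (y ∸ x))))
      (window-bound V (y ∸ x) (m<n⇒0<n∸m x<y) (≤-trans y-x n≤P) (≤-trans y-x n≤V))
    where
    y-x : y ∸ x ≤ n
    y-x = ≤-trans (m∸n≤m y x) (<⇒≤ y<n)

  near-bound : ∀ V {x y} → x < n → y < n → x ≢ y → n ≤ P → n ≤ V → sum< P (λ a → near V a x y) ≤ 4 * V
  near-bound V {x} {y} x< y< x≢y n≤P n≤V with <-cmp x y
  ... | tri≈ _ e _ = contradiction e x≢y
  ... | tri< lt _ _ = near-ordered V lt y< n≤P n≤V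
  ... | tri> _ _ gt =
    ≤-trans (sum<-mono P (λ a → near-sym V a x y)) (near-ordered V gt x< n≤P n≤V)

  V : ℕ → ℕ
  V = dyadic n

  n≤V : ∀ h → n ≤ V h
  n≤V zero    = ≤-refl
  n≤V (suc h) = ≤-trans (n≤V h) (m≤m+n (V h) (V h))

  nears : ℕ → ℕ → ℕ → ℕ → ℕ
  nears zero    a x y = near (V 0) a x y
  nears (suc h) a x y = near (V (suc h)) a x y + nears h a x y

  -- The widths double with the height, so the bounds 4 V of all levels form a geometric sum that is
  -- at most twice the last one.
  nears-bound : ∀ h {x y} → x < n → y < n → x ≢ y → n ≤ P → sum< P (λ a → nears h a x y) ≤ 8 * V h
  nears-bound zero x< y< x≢y n≤P =
    ≤-trans (near-bound n x< y< x≢y n≤P ≤-refl) (*-monoˡ-≤ n (m≤m+n 4 4))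
  nears-bound (suc h) {x} {y} x< y< x≢y n≤P = begin
    sum< P (λ a → near (V (suc h)) a x y + nears h a x y)
      ≡⟨ sum<-+ P (λ a → near (V (suc h)) a x y) (λ a → nears h a x y) ⟩
    sum< P (λ a → near (V (suc h)) a x y) + sum< P (λ a → nears h a x y)
      ≤⟨ +-mono-≤ (near-bound (V (suc h)) x< y< x≢y n≤P (n≤V (suc h))) (nears-bound h x< y< x≢y n≤P) ⟩
    4 * (V h + V h) + 8 * V h
      ≡⟨ double (V h) ⟩
    8 * (V h + V h) ∎
    where
    open ≤-Reasoning
    double : ∀ v → 4 * (v + v) + 8 * v ≡ 8 * (v + v)
    double = solve-∀

  -- One number to average for two demands. The first summand counts the levels up to `h` at which
  -- the pair stays close; the second makes a single close pair at the bottom width `n` cost `K`,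
  -- the whole budget. The diagonal is excluded because repeated visits to one vertex cannot be
  -- separated.
  penalty : (ps : List ℕ) (K h a x y : ℕ) → ℕ
  penalty ps K h a x y = # (¬? (x ≟ y)) * (nears h a x y + K * near n a x y)

  penalties : (ps : List ℕ) (K h a : ℕ) → ℕ
  penalties ps K h a = sumL ps (λ x → sumL ps (λ y → penalty ps K h a x y))

  good-multiplier : ∀ ps K h → (∀ {x} → x ∈ ps → x < n) → n ≤ P →
    length ps * (length ps * (8 * V h + K * (4 * n))) < P * K →
    ∃[ a ] (a < P × penalties ps K h a < K)
  good-multiplier ps K h ps<n n≤P small =
    below-average P (penalties ps K h) K
      (≤-<-trans (sum<-sumL P ps _ _ (λ x∈ → sum<-sumL P ps _ _ (λ y∈ → pair (ps<n x∈) (ps<n y∈)))) small)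
    where
    pair : ∀ {x y} → x < n → y < n → sum< P (λ a → penalty ps K h a x y) ≤ 8 * V h + K * (4 * n)
    pair {x} {y} x< y< with #-cases (¬? (x ≟ y))
    ... | inj₂ (_ , e) rewrite e   = ≤-trans (≤-reflexive (sum<-zero P)) z≤n
    ... | inj₁ (x≢y , e) rewrite e = begin
      sum< P (λ a → 1 * (nears h a x y + K * near n a x y))
        ≡⟨ sum<-*ˡ P 1 _ ⟩
      1 * sum< P (λ a → nears h a x y + K * near n a x y)
        ≡⟨ *-identityˡ _ ⟩
      sum< P (λ a → nears h a x y + K * near n a x y)
        ≡⟨ sum<-+ P (λ a → nears h a x y) (λ a → K * near n a x y) ⟩
      sum< P (λ a → nears h a x y) + sum< P (λ a → K * near n a x y)
        ≡⟨ cong (sum< P (λ a → nears h a x y) +_) (sum<-*ˡ P K (λ a → near n a x y)) ⟩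
      sum< P (λ a → nears h a x y) + K * sum< P (λ a → near n a x y)
        ≤⟨ +-mono-≤ (nears-bound h x< y< x≢y n≤P) (*-monoʳ-≤ K (near-bound n x< y< x≢y n≤P ≤-refl)) ⟩
      8 * V h + K * (4 * n) ∎
      where open ≤-Reasoning

-- Dyadic cells and balanced interval colourings

data Op : Set where
  halve double advance emit : Op

record Cursor : Set where
  constructor cursor
  field
    pos width offset : ℕ

open Cursor public

module Ops (P S R : ℕ) where

  -- The conditions on `P` and `S` bound what an arbitrary string can produce; along the strings
  -- built from trees they always hold. Only `emit` looks at `z`: it places a cut at the current
  -- position, and the offset gains one factor for each cut at or below `z`.
  opStep : ℕ → Op → Cursor → Cursor
  opStep z halve   (cursor p w o) = cursor p (w / 2) o
  opStep z double  (cursor p w o) = cursor p (if w <ᵇ P then w + w else w) o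
  opStep z advance (cursor p w o) = cursor (if p <ᵇ P + P then p + w else p) w o
  opStep z emit    (cursor p w o) =
    cursor p w (if p ≤ᵇ z then (if o <ᵇ S then o * suc R else o) else o)

  runOps : ℕ → List Op → Cursor → Cursor
  runOps z []       s = s
  runOps z (o ∷ os) s = runOps z os (opStep z o s)

  runOps-++ : ∀ z os {os′} s → runOps z (os ++ os′) s ≡ runOps z os′ (runOps z os s)
  runOps-++ z []       s = refl
  runOps-++ z (o ∷ os) s = runOps-++ z os (opStep z o s)

if-true : ∀ {A : Set} {b} {x y : A} → T b → (if b then x else y) ≡ x
if-true {b = true} _ = refl

if-false : ∀ {A : Set} {b} {x y : A} → ¬ T b → (if b then x else y) ≡ y
if-false {b = true}  f = ⊥-elim (f _)
if-false {b = false} f = refl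

#*≤ : ∀ {P Q : Set} (d : Dec P) (e : Dec Q) {m} → (P → Q → 1 ≤ m) → # d * # e ≤ m
#*≤ (yes p) e f = ≤-trans (≤-reflexive (*-identityˡ (# e))) (#≤ e (f p))
#*≤ (no _)  e f = z≤n

-- Weights of intervals and balanced sequences of cuts

module Cells (ps : List ℕ) (z : ℕ → ℕ) where

  inside? : ∀ lo hi x → Dec (lo ≤ z x × z x < hi)
  inside? lo hi x = (lo ≤? z x) ×-dec (z x <? hi)

  inside : ℕ → ℕ → ℕ → ℕ
  inside lo hi x = # inside? lo hi x

  weight : ℕ → ℕ → ℕ
  weight lo hi = sumL ps (inside lo hi)

  inside-split : ∀ {lo mid hi} x → lo ≤ mid → mid ≤ hi → inside lo hi x ≡ inside lo mid x + inside mid hi x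
  inside-split {lo} {mid} {hi} x l m with lo ≤? z x | z x <? mid
  ... | no lo≰ | _ = trans (#-no (inside? lo hi x) (λ p → lo≰ (proj₁ p)))
         (sym (cong₂ _+_ (#-no (inside? lo mid x) (λ p → lo≰ (proj₁ p)))
                         (#-no (inside? mid hi x) (λ p → lo≰ (≤-trans l (proj₁ p))))))
  ... | yes lo≤ | yes <mid = trans (#-yes (inside? lo hi x) (lo≤ , <-≤-trans <mid m))
         (sym (cong₂ _+_ (#-yes (inside? lo mid x) (lo≤ , <mid))
                         (#-no (inside? mid hi x) (λ p → <⇒≱ <mid (proj₁ p)))))
  ... | yes lo≤ | no ≮mid with z x <? hi
  ...   | yes <hi = trans (#-yes (inside? lo hi x) (lo≤ , <hi))
         (sym (cong₂ _+_ (#-no (inside? lo mid x) (λ p → ≮mid (proj₂ p)))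
                         (#-yes (inside? mid hi x) (≮⇒≥ ≮mid , <hi))))
  ...   | no ≮hi = trans (#-no (inside? lo hi x) (λ p → ≮hi (proj₂ p)))
         (sym (cong₂ _+_ (#-no (inside? lo mid x) (λ p → ≮mid (proj₂ p)))
                         (#-no (inside? mid hi x) (λ p → ≮hi (proj₂ p)))))

  weight-split : ∀ {lo mid hi} → lo ≤ mid → mid ≤ hi → weight lo hi ≡ weight lo mid + weight mid hi
  weight-split {lo} {mid} {hi} l m =
    trans (sumL-cong ps (λ x → inside-split x l m)) (sumL-+ ps (inside lo mid) (inside mid hi))

  weight-empty : ∀ lo → weight lo lo ≡ 0
  weight-empty lo = trans (sumL-cong ps (λ x → #-no (inside? lo lo x) (λ (p , q) → <⇒≱ q p)))
                          (trans (sumL-const ps 0) (*-zeroʳ (length ps)))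

  weight≤length : ∀ lo hi → weight lo hi ≤ length ps
  weight≤length lo hi = ≤-trans (sumL-mono ps (λ {x} _ → #≤1 (inside? lo hi x)))
                          (≤-reflexive (trans (sumL-const ps 1) (*-identityʳ _)))

  below : ℕ → List ℕ → ℕ
  below y []       = 0
  below y (c ∷ cs) = # (c ≤? y) + below y cs

  below-++ : ∀ y cs ds → below y (cs ++ ds) ≡ below y cs + below y ds
  below-++ y []       ds = refl
  below-++ y (c ∷ cs) ds = trans (cong (# (c ≤? y) +_) (below-++ y cs ds))
                             (sym (+-assoc (# (c ≤? y)) (below y cs) (below y ds)))

  below≤length : ∀ y cs → below y cs ≤ length cs
  below≤length y []       = z≤n
  below≤length y (c ∷ cs) = +-mono-≤ (#≤1 (c ≤? y)) (below≤length y cs)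

  module Cuts (R : ℕ) where

    -- The cuts split [lo, hi) into intervals of weight at most R, the first one counted
    -- together with an already collected weight cw.
    Balanced : ℕ → ℕ → List ℕ → ℕ → Set
    Balanced cw lo []       hi = lo ≤ hi × cw + weight lo hi ≤ R
    Balanced cw lo (c ∷ cs) hi = lo ≤ c × cw + weight lo c ≤ R × Balanced 0 c cs hi

    balanced-below : ∀ {cw lo} cs {hi y} → Balanced cw lo cs hi → y < lo → below y cs ≡ 0
    balanced-below []       b y< = refl
    balanced-below (c ∷ cs) {y = y} (l , _ , b) y< =
      cong₂ _+_ (#-no (c ≤? y) (<⇒≱ (<-≤-trans y< l))) (balanced-below cs b (<-≤-trans y< l))

    balanced-merge : ∀ {cw lo mid} cs {hi} → lo ≤ mid → Balanced (cw + weight lo mid) mid cs hi → Balanced cw lo cs hi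
    balanced-merge {cw} {lo} {mid} [] l (m , w) = ≤-trans l m ,
      subst (_≤ R) (trans (+-assoc cw _ _) (cong (cw +_) (sym (weight-split l m)))) w
    balanced-merge {cw} {lo} {mid} (c ∷ cs) l (m , w , b) = ≤-trans l m ,
      subst (_≤ R) (trans (+-assoc cw _ _) (cong (cw +_) (sym (weight-split l m)))) w , b

    class : List ℕ → ℕ → ℕ → ℕ → ℕ
    class cs c lo hi = sumL ps (λ x → inside lo hi x * # (below (z x) cs ≟ c))

    -- Colour 0 is the interval before the first cut. Dropping that cut lowers every other colour by
    -- one, which gives the induction over the cuts.
    class-bound : ∀ {cw lo} cs {hi} c → Balanced cw lo cs hi → class cs c lo hi ≤ R
    class-bound {cw} {lo} [] {hi} c (l , w) =
      ≤-trans (sumL-mono ps (λ {x} _ → ≤-trans (*-monoʳ-≤ (inside lo hi x) (#≤1 (0 ≟ c))) (≤-reflexive (*-identityʳ _))))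
        (≤-trans (m≤n+m _ cw) w)
    class-bound {cw} {lo} (k ∷ cs) {hi} zero (l , w , b) =
      ≤-trans (sumL-mono ps (λ {x} _ → #*≤ (inside? lo hi x) (below (z x) (k ∷ cs) ≟ 0) (first x)))
        (≤-trans (m≤n+m _ cw) w)
      where
      first : ∀ x → lo ≤ z x × z x < hi → below (z x) (k ∷ cs) ≡ 0 → 1 ≤ inside lo k x
      first x (lo≤ , _) e with k ≤? z x
      ... | yes k≤ = contradiction (trans (sym (cong (_+ below (z x) cs) (#-yes (k ≤? z x) k≤))) e) (λ ())
      ... | no k≰  = ≤-reflexive (sym (#-yes (inside? lo k x) (lo≤ , ≰⇒> k≰)))
    class-bound {cw} {lo} (k ∷ cs) {hi} (suc c) (l , w , b) =
      ≤-trans (sumL-mono ps (λ {x} _ → #*≤ (inside? lo hi x) (below (z x) (k ∷ cs) ≟ suc c) (later x)))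
        (class-bound cs c b)
      where
      later : ∀ x → lo ≤ z x × z x < hi → below (z x) (k ∷ cs) ≡ suc c →
              1 ≤ inside k hi x * # (below (z x) cs ≟ c)
      later x (_ , <hi) e with k ≤? z x
      ... | yes k≤ = ≤-reflexive (sym (cong₂ _*_ (#-yes (inside? k hi x) (k≤ , <hi))
                       (#-yes (below (z x) cs ≟ c) (suc-injective (trans (sym (cong (_+ below (z x) cs) (#-yes (k ≤? z x) k≤))) e)))))
      ... | no k≰  = contradiction (trans (sym (cong₂ _+_ (#-no (k ≤? z x) k≰) (balanced-below cs b (≰⇒> k≰)))) e) (λ ())

  -- Counting split cells by charges to visits

  module Splitting (n R : ℕ) where

    V : ℕ → ℕ
    V = dyadic n

    splits : ℕ → ℕ → ℕ
    splits zero    pos = 0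
    splits (suc h) pos with weight pos (pos + V (suc h)) ≤? R
    ... | yes _ = 0
    ... | no _  = 1 + (splits h pos + splits h (pos + V h))

    rowSplits : ℕ → ℕ → ℕ → ℕ
    rowSplits h zero    pos = 0
    rowSplits h (suc m) pos = splits h pos + rowSplits h m (pos + V h)

    module _ (charge : ℕ → ℕ → ℕ)
             (heavy-charged : ∀ h pos → R < weight pos (pos + V (suc h)) →
                ∀ {x} → x ∈ ps → pos ≤ z x × z x < pos + V (suc h) → 1 ≤ charge (suc h) x) where

      charges : ℕ → ℕ → ℕ
      charges zero    x = 0
      charges (suc h) x = charge (suc h) x + charges h x

      inside-halves : ∀ h pos x → inside pos (pos + V (suc h)) x
                      ≡ inside pos (pos + V h) x + inside (pos + V h) (pos + V h + V h) x
      inside-halves h pos x =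
        trans (cong (λ hi → inside pos hi x) (sym (+-assoc pos (V h) (V h))))
              (inside-split x (m≤m+n pos (V h)) (m≤m+n (pos + V h) (V h)))

      -- A split cell has weight at least `suc R`, and each of its visits pays at least 1 for the
      -- level of that cell. Cells of one level are disjoint, so a visit pays its charge at most
      -- once per level.
      splits-bound : ∀ h pos → suc R * splits h pos ≤ sumL ps (λ x → inside pos (pos + V h) x * charges h x)
      splits-bound zero pos = ≤-trans (≤-reflexive (*-zeroʳ (suc R))) z≤n
      splits-bound (suc h) pos with weight pos (pos + V (suc h)) ≤? R
      ... | yes _ = ≤-trans (≤-reflexive (*-zeroʳ (suc R))) z≤n
      ... | no w≰ = begin
        suc R * (1 + (splits h pos + splits h mid))
          ≡⟨ expand (suc R) (splits h pos) (splits h mid) ⟩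
        suc R + (suc R * splits h pos + suc R * splits h mid)
          ≤⟨ +-mono-≤ heavy (+-mono-≤ (splits-bound h pos) (splits-bound h mid)) ⟩
        sumL ps (λ x → i x * charge (suc h) x) + (sumL ps (λ x → i₁ x * charges h x) + sumL ps (λ x → i₂ x * charges h x))
          ≡⟨ cong (sumL ps (λ x → i x * charge (suc h) x) +_) (sym (sumL-+ ps _ _)) ⟩
        sumL ps (λ x → i x * charge (suc h) x) + sumL ps (λ x → i₁ x * charges h x + i₂ x * charges h x)
          ≡⟨ sym (sumL-+ ps _ _) ⟩
        sumL ps (λ x → i x * charge (suc h) x + (i₁ x * charges h x + i₂ x * charges h x))
          ≡⟨ sumL-cong ps collect ⟩
        sumL ps (λ x → i x * charges (suc h) x) ∎
        where
        open ≤-Reasoning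
        mid = pos + V h
        i i₁ i₂ : ℕ → ℕ
        i  = inside pos (pos + V (suc h))
        i₁ = inside pos mid
        i₂ = inside mid (mid + V h)
        expand : ∀ r a b → r * (1 + (a + b)) ≡ r + (r * a + r * b)
        expand = solve-∀
        heavy : suc R ≤ sumL ps (λ x → i x * charge (suc h) x)
        heavy = ≤-trans (≰⇒> w≰) (sumL-mono ps (λ {x} x∈ → #≤ (inside? pos (pos + V (suc h)) x)
                  (λ q → *-mono-≤ {1} {i x} (≤-reflexive (sym (#-yes (inside? pos (pos + V (suc h)) x) q)))
                           (heavy-charged h pos (≰⇒> w≰) x∈ q))))
        collect : ∀ x → i x * charge (suc h) x + (i₁ x * charges h x + i₂ x * charges h x) ≡ i x * charges (suc h) x
        collect x = trans (cong (i x * charge (suc h) x +_)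
                            (trans (sym (*-distribʳ-+ (charges h x) (i₁ x) (i₂ x))) (cong (_* charges h x) (sym (inside-halves h pos x)))))
                          (sym (*-distribˡ-+ (i x) (charge (suc h) x) (charges h x)))

      rowSplits-bound : ∀ h m pos →
        suc R * rowSplits h m pos ≤ sumL ps (λ x → inside pos (pos + m * V h) x * charges h x)
      rowSplits-bound h zero pos = ≤-trans (≤-reflexive (*-zeroʳ (suc R))) z≤n
      rowSplits-bound h (suc m) pos = begin
        suc R * (splits h pos + rowSplits h m (pos + V h))
          ≡⟨ *-distribˡ-+ (suc R) (splits h pos) _ ⟩
        suc R * splits h pos + suc R * rowSplits h m (pos + V h)
          ≤⟨ +-mono-≤ (splits-bound h pos) (rowSplits-bound h m (pos + V h)) ⟩
        sumL ps (λ x → inside pos (pos + V h) x * charges h x)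
          + sumL ps (λ x → inside (pos + V h) (pos + V h + m * V h) x * charges h x)
          ≡⟨ sym (sumL-+ ps _ _) ⟩
        sumL ps (λ x → inside pos (pos + V h) x * charges h x + inside (pos + V h) (pos + V h + m * V h) x * charges h x)
          ≡⟨ sumL-cong ps (λ x → trans (sym (*-distribʳ-+ (charges h x) (inside pos (pos + V h) x) _))
               (cong (_* charges h x) (trans (sym (inside-split x (m≤m+n pos (V h)) (m≤m+n (pos + V h) (m * V h))))
                 (cong (λ hi → inside pos hi x) (+-assoc pos (V h) (m * V h)))))) ⟩
        sumL ps (λ x → inside pos (pos + suc m * V h) x * charges h x) ∎
        where open ≤-Reasoning

      rowSplits≤charges : ∀ h m pos → suc R * rowSplits h m pos ≤ sumL ps (charges h)
      rowSplits≤charges h m pos = ≤-trans (rowSplits-bound h m pos)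
        (sumL-mono ps (λ {x} _ → ≤-trans (*-monoˡ-≤ (charges h x) (#≤1 (inside? pos (pos + m * V h) x)))
                                   (≤-reflexive (*-identityˡ _))))

  -- Strings of moves for the greedy partition

  module Building (n R P C e : ℕ) (0<n : 0 < n) (1≤R : 1 ≤ R) (top : ∀ h → h < e → dyadic n h < P)
    (light : ∀ pos → weight pos (pos + n) ≤ R) where

    open Splitting n R
    open Cuts R

    S : ℕ
    S = suc R ^ suc C

    open Ops P S R

    -- A string of operations that moves the cursor from lo to hi in steps of the given width,
    -- when the current colour class has already collected the weight cw.
    record Build (width lo hi cw bound : ℕ) : Set where
      field
        ops      : List Op
        cuts     : List ℕ
        cw′      : ℕ
        ops≤     : length ops ≤ bound + length cuts
        cw′≤     : cw′ ≤ R
        greedy   : length cuts * suc R + cw′ ≤ cw + 2 * weight lo hi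
        runs     : ∀ y c → c + length cuts ≤ C →
                   runOps y ops (cursor lo width (suc R ^ c)) ≡ cursor hi width (suc R ^ (c + below y cuts))
        balanced : ∀ rest end → Balanced cw′ hi rest end → Balanced cw lo (cuts ++ rest) end

    open Build

    append : ∀ {w lo mid hi cw b b′} → lo ≤ mid → mid ≤ hi → (p : Build w lo mid cw b) →
             Build w mid hi (cw′ p) b′ → Build w lo hi cw (b + b′)
    ops  (append _ _ p q) = ops p ++ ops q
    cuts (append _ _ p q) = cuts p ++ cuts q
    cw′  (append _ _ p q) = cw′ q
    ops≤ (append {b = b} {b′} _ _ p q) = begin
      length (ops p ++ ops q)                             ≡⟨ length-++ (ops p) ⟩
      length (ops p) + length (ops q)                     ≤⟨ +-mono-≤ (ops≤ p) (ops≤ q) ⟩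
      b + length (cuts p) + (b′ + length (cuts q))        ≡⟨ swap b (length (cuts p)) b′ (length (cuts q)) ⟩
      b + b′ + (length (cuts p) + length (cuts q))        ≡⟨ cong (b + b′ +_) (sym (length-++ (cuts p))) ⟩
      b + b′ + length (cuts p ++ cuts q)                  ∎
      where
      open ≤-Reasoning
      swap : ∀ a b c d → a + b + (c + d) ≡ a + c + (b + d)
      swap = solve-∀
    cw′≤ (append _ _ p q) = cw′≤ q
    greedy (append {lo = lo} {mid} {hi} {cw} l m p q) = begin
      length (cuts p ++ cuts q) * suc R + cw′ q
        ≡⟨ cong (λ l → l * suc R + cw′ q) (length-++ (cuts p)) ⟩
      (length (cuts p) + length (cuts q)) * suc R + cw′ q
        ≡⟨ expand (length (cuts p)) (length (cuts q)) (suc R) (cw′ q) ⟩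
      length (cuts p) * suc R + (length (cuts q) * suc R + cw′ q)
        ≤⟨ +-monoʳ-≤ (length (cuts p) * suc R) (greedy q) ⟩
      length (cuts p) * suc R + (cw′ p + 2 * weight mid hi)
        ≡⟨ sym (+-assoc (length (cuts p) * suc R) (cw′ p) _) ⟩
      length (cuts p) * suc R + cw′ p + 2 * weight mid hi
        ≤⟨ +-monoˡ-≤ (2 * weight mid hi) (greedy p) ⟩
      cw + 2 * weight lo mid + 2 * weight mid hi
        ≡⟨ trans (+-assoc cw _ _) (cong (cw +_) (trans (sym (*-distribˡ-+ 2 (weight lo mid) (weight mid hi)))
             (cong (2 *_) (sym (weight-split l m))))) ⟩
      cw + 2 * weight lo hi ∎
      where
      open ≤-Reasoning
      expand : ∀ a b r x → (a + b) * r + x ≡ a * r + (b * r + x)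
      expand = solve-∀
    runs (append {w} {lo} {mid} {hi} l m p q) y c c≤ = begin
      runOps y (ops p ++ ops q) (cursor lo w (suc R ^ c))
        ≡⟨ runOps-++ y (ops p) _ ⟩
      runOps y (ops q) (runOps y (ops p) (cursor lo w (suc R ^ c)))
        ≡⟨ cong (runOps y (ops q)) (runs p y c (≤-trans (+-monoʳ-≤ c (m≤m+n _ (length (cuts q)))) c≤′)) ⟩
      runOps y (ops q) (cursor mid w (suc R ^ (c + below y (cuts p))))
        ≡⟨ runs q y (c + below y (cuts p))
             (≤-trans (≤-reflexive (+-assoc c _ _))
               (≤-trans (+-monoʳ-≤ c (+-monoˡ-≤ (length (cuts q)) (below≤length y (cuts p)))) c≤′)) ⟩
      cursor hi w (suc R ^ (c + below y (cuts p) + below y (cuts q)))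
        ≡⟨ cong (λ k → cursor hi w (suc R ^ k))
             (trans (+-assoc c _ _) (cong (c +_) (sym (below-++ y (cuts p) (cuts q))))) ⟩
      cursor hi w (suc R ^ (c + below y (cuts p ++ cuts q))) ∎
      where
      open ≡-Reasoning
      c≤′ : c + (length (cuts p) + length (cuts q)) ≤ C
      c≤′ = subst (λ l → c + l ≤ C) (length-++ (cuts p)) c≤
    balanced (append {lo = lo} _ _ p q) rest end b =
      subst (λ cs → Balanced _ lo cs end) (sym (++-assoc (cuts p) (cuts q) rest))
        (balanced p (cuts q ++ rest) end (balanced q rest end b))

    width>0 : ∀ h → 0 < V h
    width>0 zero    = 0<n
    width>0 (suc h) = <-≤-trans (width>0 h) (m≤m+n (V h) (V h))

    advances : ∀ h y lo o → lo + V h ≤ P + P → opStep y advance (cursor lo (V h) o) ≡ cursor (lo + V h) (V h) o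
    advances h y lo o le = cong (λ p → cursor p (V h) o)
      (if-true (<⇒<ᵇ (<-≤-trans (m<m+n lo (width>0 h)) le)))

    emits : ∀ y lo w c → c < suc C → opStep y emit (cursor lo w (suc R ^ c))
            ≡ cursor lo w (suc R ^ (c + below y (lo ∷ [])))
    emits y lo w c c< with lo ≤? y
    ... | yes p = cong (cursor lo w)
      (trans (if-true (≤⇒≤ᵇ p))
        (trans (if-true (<⇒<ᵇ (^-monoʳ-< (suc R) (s≤s 1≤R) c<)))
          (trans (*-comm (suc R ^ c) (suc R))
            (cong (suc R ^_) (trans (+-comm 1 c) (cong (c +_) (sym (trans (+-identityʳ _) (#-yes (lo ≤? y) p)))))))))
    ... | no ¬p = cong (cursor lo w)
      (trans (if-false (λ t → ¬p (≤ᵇ⇒≤ lo y t)))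
        (cong (suc R ^_) (sym (trans (cong (c +_) (trans (+-identityʳ _) (#-no (lo ≤? y) ¬p))) (+-identityʳ c)))))

    -- A cut is made only if the collected weight and the leaf together exceed `R`. The leaf is then
    -- counted twice, once to pay `suc R` for the cut and once as the start of the next class; hence
    -- the factor 2 in `greedy`. The extra move `emit` is accounted for by the cut.
    leaf : ∀ h lo cw → cw ≤ R → lo + V h ≤ P + P → weight lo (lo + V h) ≤ R → Build (V h) lo (lo + V h) cw 1
    leaf h lo cw cw≤ le w≤ with cw + weight lo (lo + V h) ≤? R
    ... | yes fit = record
      { ops = advance ∷ [] ; cuts = [] ; cw′ = cw + weight lo (lo + V h)
      ; ops≤ = ≤-refl ; cw′≤ = fit
      ; greedy = +-monoʳ-≤ cw (m≤n*m (weight lo (lo + V h)) 2)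
      ; runs = λ y c _ → trans (advances h y lo (suc R ^ c) le)
                 (cong (λ k → cursor (lo + V h) (V h) (suc R ^ k)) (sym (+-identityʳ c)))
      ; balanced = λ rest end b → balanced-merge rest (m≤m+n lo (V h)) b }
    ... | no full = record
      { ops = emit ∷ advance ∷ [] ; cuts = lo ∷ [] ; cw′ = weight lo (lo + V h)
      ; ops≤ = ≤-refl ; cw′≤ = w≤
      ; greedy = ≤-trans (+-monoˡ-≤ wt (≤-trans (≤-reflexive (*-identityˡ (suc R))) (≰⇒> full)))
                   (≤-reflexive (twice cw wt))
      ; runs = λ y c c≤ → trans (cong (opStep y advance) (emits y lo (V h) c (subst (_≤ suc C) (+-comm c 1) (m≤n⇒m≤1+n c≤))))
                 (advances h y lo (suc R ^ (c + below y (lo ∷ []))) le)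
      ; balanced = λ rest end b → ≤-refl ,
                 subst (_≤ R) (sym (trans (cong (cw +_) (weight-empty lo)) (+-identityʳ cw))) cw≤ ,
                 balanced-merge rest (m≤m+n lo (V h)) b }
      where
      wt = weight lo (lo + V h)
      twice : ∀ a b → a + b + b ≡ a + 2 * b
      twice = solve-∀

    half-double : ∀ v → (v + v) / 2 ≡ v
    half-double v = trans (cong (_/ 2) (twice v)) (m*n/n≡m v 2)
      where
      twice : ∀ v → v + v ≡ v * 2
      twice = solve-∀

    -- Restoring the width after the two halves makes the strings of neighbouring cells composable.
    -- The bound `h < e` is what opens the guard of `double`.
    wrap : ∀ {h lo hi cw b} → h < e → Build (V h) lo hi cw b → Build (V (suc h)) lo hi cw (2 + b)
    ops (wrap _ p) = halve ∷ ops p ++ double ∷ []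
    cuts (wrap _ p) = cuts p
    cw′ (wrap _ p) = cw′ p
    ops≤ (wrap {b = b} _ p) = s≤s (≤-trans (≤-reflexive (trans (length-++ (ops p)) (+-comm _ 1))) (s≤s (ops≤ p)))
    cw′≤ (wrap _ p) = cw′≤ p
    greedy (wrap _ p) = greedy p
    runs (wrap {h} {lo} {hi} h<e p) y c c≤ = begin
      runOps y (ops p ++ double ∷ []) (cursor lo ((V h + V h) / 2) (suc R ^ c))
        ≡⟨ cong (λ w → runOps y (ops p ++ double ∷ []) (cursor lo w (suc R ^ c))) (half-double (V h)) ⟩
      runOps y (ops p ++ double ∷ []) (cursor lo (V h) (suc R ^ c))
        ≡⟨ runOps-++ y (ops p) _ ⟩
      opStep y double (runOps y (ops p) (cursor lo (V h) (suc R ^ c)))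
        ≡⟨ cong (opStep y double) (runs p y c c≤) ⟩
      opStep y double (cursor hi (V h) (suc R ^ (c + below y (cuts p))))
        ≡⟨ cong (λ w → cursor hi w (suc R ^ (c + below y (cuts p)))) (if-true (<⇒<ᵇ (top h h<e))) ⟩
      cursor hi (V h + V h) (suc R ^ (c + below y (cuts p))) ∎
      where open ≡-Reasoning
    balanced (wrap _ p) = balanced p

    relax : ∀ {w lo hi hi′ cw b b′} → hi ≡ hi′ → b ≡ b′ → Build w lo hi cw b → Build w lo hi′ cw b′
    relax refl refl p = p

    -- A binary tree with s inner nodes has s + 1 leaves. Each inner node costs `halve` and
    -- `double`, each leaf `advance`, together 2 s + (s + 1).
    cell : ∀ h → h ≤ e → ∀ lo cw → cw ≤ R → lo + V h ≤ P + P → Build (V h) lo (lo + V h) cw (3 * splits h lo + 1)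
    cell zero h≤ lo cw cw≤ le = leaf zero lo cw cw≤ le (light lo)
    cell (suc h) h≤ lo cw cw≤ le with weight lo (lo + V (suc h)) ≤? R
    ... | yes w≤ = leaf (suc h) lo cw cw≤ le w≤
    ... | no  _  = relax (+-assoc lo (V h) (V h)) (count (splits h lo) (splits h (lo + V h)))
        (wrap h≤ (append (m≤m+n lo (V h)) (m≤m+n (lo + V h) (V h)) left
          (cell h (<⇒≤ h≤) (lo + V h) (cw′ left) (cw′≤ left) le′)))
      where
      le′ : lo + V h + V h ≤ P + P
      le′ = ≤-trans (≤-reflexive (+-assoc lo (V h) (V h))) le
      left : Build (V h) lo (lo + V h) cw (3 * splits h lo + 1)
      left = cell h (<⇒≤ h≤) lo cw cw≤ (≤-trans (m≤m+n (lo + V h) (V h)) le′)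
      count : ∀ a b → 2 + (3 * a + 1 + (3 * b + 1)) ≡ 3 * (1 + (a + b)) + 1
      count = solve-∀

    row : ∀ m lo cw → cw ≤ R → lo + m * V e ≤ P + P → Build (V e) lo (lo + m * V e) cw (3 * rowSplits e m lo + m)
    row zero lo cw cw≤ le = relax (sym (+-identityʳ lo)) refl record
      { ops = [] ; cuts = [] ; cw′ = cw ; ops≤ = z≤n ; cw′≤ = cw≤ ; greedy = m≤m+n cw _
      ; runs = λ y c _ → cong (λ k → cursor lo (V e) (suc R ^ k)) (sym (+-identityʳ c))
      ; balanced = λ rest end b → b }
    row (suc m) lo cw cw≤ le = relax (+-assoc lo (V e) (m * V e)) (count (splits e lo) (rowSplits e m (lo + V e)) m)
        (append (m≤m+n lo (V e)) (m≤m+n (lo + V e) (m * V e)) first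
          (row m (lo + V e) (cw′ first) (cw′≤ first) le′))
      where
      le′ : lo + V e + m * V e ≤ P + P
      le′ = ≤-trans (≤-reflexive (+-assoc lo (V e) (m * V e))) le
      first : Build (V e) lo (lo + V e) cw (3 * splits e lo + 1)
      first = cell e ≤-refl lo cw cw≤ (≤-trans (m≤m+n (lo + V e) (m * V e)) le′)
      count : ∀ a b m → 3 * a + 1 + (3 * b + m) ≡ 3 * (a + b) + suc m
      count = solve-∀

    -- The cursor starts with the width `n` that the machine knows, and the string itself raises it
    -- to the root width. Thus the program never computes `e`.
    doublings : ∀ j y o → j ≤ e → runOps y (replicate j double) (cursor 0 n o) ≡ cursor 0 (V j) o
    doublings zero    y o j≤ = refl
    doublings (suc j) y o j≤ = begin
      runOps y (double ∷ replicate j double) (cursor 0 n o)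
        ≡⟨ cong (λ os → runOps y os (cursor 0 n o)) (snoc j) ⟩
      runOps y (replicate j double ++ double ∷ []) (cursor 0 n o)
        ≡⟨ runOps-++ y (replicate j double) _ ⟩
      opStep y double (runOps y (replicate j double) (cursor 0 n o))
        ≡⟨ cong (opStep y double) (doublings j y o (<⇒≤ j≤)) ⟩
      opStep y double (cursor 0 (V j) o)
        ≡⟨ cong (λ w → cursor 0 w o) (if-true (<⇒<ᵇ (top j j≤))) ⟩
      cursor 0 (V (suc j)) o ∎
      where
      open ≡-Reasoning
      snoc : ∀ j → double ∷ replicate j double ≡ replicate j double ++ double ∷ []
      snoc zero    = refl
      snoc (suc j) = cong (double ∷_) (snoc j)

    colouring : ∀ m → m * V e ≤ P + P → 2 * length ps < suc C * suc R → (∀ x → z x < m * V e) →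
      ∃[ os ] ∃[ colour ]
        (length os ≤ e + (3 * rowSplits e m 0 + m + C) ×
         (∀ x → offset (runOps (z x) os (cursor 0 n 1)) ≡ suc R ^ colour x) ×
         (∀ x → colour x ≤ C) ×
         (∀ c → sumL ps (λ x → # (colour x ≟ c)) ≤ R))
    colouring m le small z< = replicate e double ++ ops b , colour , length≤ , offsets , colour≤ , classes
      where
      b = row m 0 0 z≤n le
      colour : ℕ → ℕ
      colour x = below (z x) (cuts b)
      -- The greedy estimate over the whole range gives `length (cuts b) * suc R ≤ 2 * length ps`,
      -- which lies below `suc C * suc R`.
      cuts≤C : length (cuts b) ≤ C
      cuts≤C = s≤s⁻¹ (*-cancelʳ-< (suc R) (length (cuts b)) (suc C)
        (≤-<-trans (≤-trans (m≤m+n _ (cw′ b)) (≤-trans (greedy b) (*-monoʳ-≤ 2 (weight≤length 0 (m * V e))))) small))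
      colour≤ : ∀ x → colour x ≤ C
      colour≤ x = ≤-trans (below≤length (z x) (cuts b)) cuts≤C
      length≤ : length (replicate e double ++ ops b) ≤ e + (3 * rowSplits e m 0 + m + C)
      length≤ = ≤-trans (≤-reflexive (trans (length-++ (replicate e double)) (cong (_+ length (ops b)) (length-replicate e))))
                  (+-monoʳ-≤ e (≤-trans (ops≤ b) (+-monoʳ-≤ _ cuts≤C)))
      offsets : ∀ x → offset (runOps (z x) (replicate e double ++ ops b) (cursor 0 n 1)) ≡ suc R ^ colour x
      offsets x = cong offset (trans (runOps-++ (z x) (replicate e double) _)
        (trans (cong (runOps (z x) (ops b)) (doublings e (z x) 1 ≤-refl)) (runs b (z x) 0 cuts≤C)))
      classes : ∀ c → sumL ps (λ x → # (colour x ≟ c)) ≤ R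
      classes c = ≤-trans (≤-reflexive (sumL-cong ps (λ x → sym
          (trans (cong (_* # (colour x ≟ c)) (#-yes (inside? 0 (m * V e) x) (z≤n , z< x))) (*-identityˡ _)))))
        (class-bound (cuts b) c (subst (λ cs → Balanced 0 0 cs (m * V e)) (++-identityʳ (cuts b))
          (balanced b [] (m * V e) (≤-refl , subst (_≤ R) (sym (trans (cong (cw′ b +_) (weight-empty (m * V e))) (+-identityʳ _))) (cw′≤ b)))))

-- Existence of a good multiplier with a short string

dyadic-^ : ∀ n h → dyadic n h ≡ 2 ^ h * n
dyadic-^ n zero    = sym (+-identityʳ n)
dyadic-^ n (suc h) = trans (cong₂ _+_ (dyadic-^ n h) (dyadic-^ n h)) (twice (2 ^ h) n)
  where
  twice : ∀ a n → a * n + a * n ≡ 2 * a * n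
  twice = solve-∀

sumL-positive : ∀ xs f → 0 < sumL xs f → ∃[ x ] (x ∈ xs × 0 < f x)
sumL-positive (x ∷ xs) f pos with f x in eq
... | suc _ = x , here refl , ≤-trans (s≤s z≤n) (≤-reflexive (sym eq))
... | zero with sumL-positive xs f pos
... | y , y∈ , fy = y , there y∈ , fy

-- The close pairs above the bottom contribute at most 2 c W P by `W * v ≤ 2 * P`. The bottom pairs
-- contribute at most `P`, because `F` absorbs their factor `d * (W * W) * K`. So a `K` slightly
-- above 2 c W suffices.
few-collisions : ∀ W v K n F P c d → W * v ≤ 2 * P → d * (W * W) * K ≤ F → F * n ≤ P → 0 < P →
                 K ≡ (c + c) * W + 2 → W * (W * (c * v + K * (d * n))) < P * K
few-collisions W v K n F P c d Wv≤ ≤F Fn≤P 0<P K≡ = begin-strict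
  W * (W * (c * v + K * (d * n)))                ≡⟨ expand W v K n c d ⟩
  c * W * (W * v) + d * (W * W) * K * n          ≤⟨ +-mono-≤ (*-monoʳ-≤ (c * W) Wv≤) (*-monoˡ-≤ n ≤F) ⟩
  c * W * (2 * P) + F * n                        ≤⟨ +-monoʳ-≤ (c * W * (2 * P)) Fn≤P ⟩
  c * W * (2 * P) + P                            <⟨ m<m+n _ 0<P ⟩
  c * W * (2 * P) + P + P                        ≡⟨ collect W P c ⟩
  P * ((c + c) * W + 2)                          ≡⟨ cong (P *_) (sym K≡) ⟩
  P * K                                          ∎
  where
  open ≤-Reasoning
  expand : ∀ W v K n c d → W * (W * (c * v + K * (d * n))) ≡ c * W * (W * v) + d * (W * W) * K * n
  expand = solve-∀
  collect : ∀ W P c → c * W * (2 * P) + P + P ≡ P * ((c + c) * W + 2)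
  collect = solve-∀

-- `W * j` is paid on the top levels and `X` by close pairs below them. Both are linear in
-- `W ≤ Q * R`, and division by `suc R` leaves a multiple of `Q`.
few-splits : ∀ R H W j Q X c → suc R * H ≤ W * j + X → X ≤ c * W + 2 → 1 ≤ W → W ≤ Q * R →
             H ≤ Q * (j + (c + 2))
few-splits R H W j Q X c H≤ X≤ 1≤W W≤ = *-cancelˡ-≤ (suc R) (begin
  suc R * H                      ≤⟨ H≤ ⟩
  W * j + X                      ≤⟨ +-monoʳ-≤ (W * j) X≤ ⟩
  W * j + (c * W + 2 * 1)        ≤⟨ +-monoʳ-≤ (W * j) (+-monoʳ-≤ (c * W) (*-monoʳ-≤ 2 1≤W)) ⟩
  W * j + (c * W + 2 * W)        ≡⟨ factor W j c ⟩
  W * (j + (c + 2))              ≤⟨ *-monoˡ-≤ (j + (c + 2)) (≤-trans W≤ (*-monoʳ-≤ Q (n≤1+n R))) ⟩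
  Q * suc R * (j + (c + 2))      ≡⟨ swap Q (suc R) (j + (c + 2)) ⟩
  suc R * (Q * (j + (c + 2)))    ∎)
  where
  open ≤-Reasoning
  factor : ∀ W j c → W * j + (c * W + 2 * W) ≡ W * (j + (c + 2))
  factor = solve-∀
  swap : ∀ a b c → a * b * c ≡ b * (a * c)
  swap = solve-∀

few-ops : ∀ H Q j c → H ≤ Q * (j + c) → 3 * H + Q + 2 * Q ≤ Q * (3 * j + (3 * c + 3))
few-ops H Q j c H≤ = ≤-trans (+-monoˡ-≤ (2 * Q) (+-monoˡ-≤ Q (*-monoʳ-≤ 3 H≤))) (≤-reflexive (factor Q j c))
  where
  factor : ∀ Q j c → 3 * (Q * (j + c)) + Q + 2 * Q ≡ Q * (3 * j + (3 * c + 3))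
  factor = solve-∀

module Spread {n R Q F P j h : ℕ} .{{_ : NonZero P}} (ps : List ℕ) where

  private
    W K e : ℕ
    W = length ps
    K = 16 * W + 2
    e = j + h

  module _
    (0<n : 0 < n) (1≤R : 1 ≤ R) (1≤Q : 1 ≤ Q) (1≤W : 1 ≤ W) (W≤ : W ≤ Q * R) (R≤ : R ≤ 2 ^ j)
    (F≤ : F ≤ 2 ^ e) (≤2F : 2 ^ e ≤ 2 * F) (top : ∀ i → i < e → 2 ^ i < F)
    (4WWK≤F : 4 * (W * W) * K ≤ F) (P≡ : P ≡ Q * F * n)
    (ps<n : ∀ {x} → x ∈ ps → x < n) (visits≤ : ∀ x → sumL ps (λ y → # (y ≟ x)) ≤ R) where

    open Hashing P n using (near; nears; penalty; penalties; good-multiplier)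
    open ≤-Reasoning
    V : ℕ → ℕ
    V = dyadic n

    QF>0 : 1 ≤ Q * F
    QF>0 = *-mono-≤ 1≤Q (≤-trans (*-mono-≤ {1} {4 * (W * W)} {1} {K}
             (*-mono-≤ {1} {4} (s≤s z≤n) (*-mono-≤ 1≤W 1≤W)) (≤-trans (s≤s z≤n) (m≤n+m 2 (16 * W)))) 4WWK≤F)

    n≤P : n ≤ P
    n≤P = subst (n ≤_) (sym P≡) (m≤n*m n (Q * F) {{>-nonZero QF>0}})

    -- Height `h` is `j` levels below the roots, so `Q * 2 ^ j ≥ W` cells of this width make up the
    -- row of root cells, which has length at most 2 P. At this width a visit has only O(1) close
    -- partners on average.
    WV≤2P : W * V h ≤ 2 * P
    WV≤2P = begin
      W * V h                ≡⟨ cong (W *_) (dyadic-^ n h) ⟩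
      W * (2 ^ h * n)        ≤⟨ *-monoˡ-≤ (2 ^ h * n) (≤-trans W≤ (*-monoʳ-≤ Q R≤)) ⟩
      Q * 2 ^ j * (2 ^ h * n) ≡⟨ assoc Q (2 ^ j) (2 ^ h) n ⟩
      Q * (2 ^ j * 2 ^ h) * n ≡⟨ cong (λ t → Q * t * n) (sym (^-distribˡ-+-* 2 j h)) ⟩
      Q * 2 ^ e * n          ≤⟨ *-monoˡ-≤ n (*-monoʳ-≤ Q ≤2F) ⟩
      Q * (2 * F) * n        ≡⟨ pull Q F n ⟩
      2 * (Q * F * n)        ≡⟨ cong (2 *_) (sym P≡) ⟩
      2 * P                  ∎
      where
      assoc : ∀ a b c d → a * b * (c * d) ≡ a * (b * c) * d
      assoc = solve-∀
      pull : ∀ a b c → a * (2 * b) * c ≡ 2 * (a * b * c)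
      pull = solve-∀

    few : W * (W * (8 * V h + K * (4 * n))) < P * K
    few = few-collisions W (V h) K n F P 8 4 WV≤2P 4WWK≤F Fn≤P (>-nonZero⁻¹ P) refl
      where
      Fn≤P : F * n ≤ P
      Fn≤P = ≤-trans (*-monoˡ-≤ n (m≤n*m F Q {{>-nonZero 1≤Q}})) (≤-reflexive (sym P≡))

    multiplier : ∃[ a ] (a < P × penalties ps K h a < K)
    multiplier = good-multiplier ps K h ps<n n≤P few

    module _ (a : ℕ) (cheap : penalties ps K h a < K) where

      z : ℕ → ℕ
      z x = (a * x) % P

      open Cells ps z
      open Splitting n R hiding (V)

      rivals : ℕ → ℕ → ℕ
      rivals v x = sumL ps (λ y → # (¬? (x ≟ y)) * near v a x y)

      -- The visits to `x` itself number at most `R`; every other visit in the interval is to a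
      -- vertex close to `x`.
      weight≤rivals : ∀ v pos x → pos ≤ z x × z x < pos + v → weight pos (pos + v) ≤ R + rivals v x
      weight≤rivals v pos x (l , u) =
        ≤-trans (sumL-mono ps (λ {y} _ → #≤ (inside? pos (pos + v) y) (pointwise y)))
          (≤-trans (≤-reflexive (sumL-+ ps (λ y → # (y ≟ x)) _)) (+-monoˡ-≤ (rivals v x) (visits≤ x)))
        where
        close : ∀ {a b} → a < pos + v → pos ≤ b → a < b + v
        close a< ≤b = <-≤-trans a< (+-monoˡ-≤ v ≤b)
        pointwise : ∀ y → pos ≤ z y × z y < pos + v → 1 ≤ # (y ≟ x) + # (¬? (x ≟ y)) * near v a x y
        pointwise y (l′ , u′) with x ≟ y
        ... | yes x≡y = ≤-trans (≤-reflexive (sym (#-yes (y ≟ x) (sym x≡y)))) (m≤m+n _ _)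
        ... | no  x≢y = ≤-trans (≤-reflexive (sym (cong₂ _*_ (#-yes (¬? (x ≟ y)) x≢y)
                          (#-yes ((z x <? z y + v) ×-dec (z y <? z x + v)) (close u l′ , close u′ l))))) (m≤n+m _ (# (y ≟ x)))

      heavy-rivals : ∀ v pos x → R < weight pos (pos + v) → pos ≤ z x × z x < pos + v → 1 ≤ rivals v x
      heavy-rivals v pos x w q = +-cancelˡ-≤ R 1 _
        (≤-trans (≤-reflexive (+-comm R 1)) (≤-trans w (weight≤rivals v pos x q)))

      -- An overweight interval of width `n` contains a pair of distinct vertices at distance below
      -- `n`, and its penalty alone reaches `K`.
      light : ∀ pos → weight pos (pos + n) ≤ R
      light pos = ≮⇒≥ λ w →
        let x , x∈ , ix = sumL-positive ps (inside pos (pos + n)) (≤-trans (s≤s z≤n) w)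
            q = inside-true x ix
            y , y∈ , iy = sumL-positive ps _ (heavy-rivals n pos x w q)
        in <⇒≱ cheap (subst (_≤ penalties ps K h a) (*-identityʳ K) (begin
          K * 1                                      ≤⟨ *-monoʳ-≤ K iy ⟩
          K * (# (¬? (x ≟ y)) * near n a x y)        ≤⟨ collect (# (¬? (x ≟ y))) (near n a x y) (nears h a x y) ⟩
          penalty ps K h a x y                       ≤⟨ sumL-∈ (penalty ps K h a x) y∈ ⟩
          sumL ps (penalty ps K h a x)               ≤⟨ sumL-∈ (λ x → sumL ps (penalty ps K h a x)) x∈ ⟩
          penalties ps K h a                         ∎))
        where
        inside-true : ∀ x → 0 < inside pos (pos + n) x → pos ≤ z x × z x < pos + n
        inside-true x i with #-cases (inside? pos (pos + n) x)
        ... | inj₁ (q , _) = q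
        ... | inj₂ (_ , e) = contradiction (subst (0 <_) e i) λ ()
        collect : ∀ d v w → K * (d * v) ≤ d * (w + K * v)
        collect d v w = ≤-trans (≤-reflexive (swap K d v)) (*-monoʳ-≤ d (m≤n+m (K * v) w))
          where
          swap : ∀ K d v → K * (d * v) ≡ d * (K * v)
          swap = solve-∀

      -- On the `j` levels above `h` closeness is too frequent to be useful, so each visit pays a
      -- flat 1 there; this is the source of the log R term.
      charge : ℕ → ℕ → ℕ
      charge i x with i ≤? h
      ... | yes _ = rivals (V i) x
      ... | no _  = 1

      heavy-charged : ∀ i pos → R < weight pos (pos + V (suc i)) →
                      ∀ {x} → x ∈ ps → pos ≤ z x × z x < pos + V (suc i) → 1 ≤ charge (suc i) x
      heavy-charged i pos w {x} _ q with suc i ≤? h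
      ... | yes _ = heavy-rivals (V (suc i)) pos x w q
      ... | no _  = ≤-refl

      charges≤nears : ∀ i x → i ≤ h → charges charge heavy-charged i x ≤ sumL ps (λ y → # (¬? (x ≟ y)) * nears i a x y)
      charges≤nears zero    x i≤ = z≤n
      charges≤nears (suc i) x i≤ with suc i ≤? h
      ... | no i≰ = contradiction i≤ i≰
      ... | yes _ = ≤-trans (+-monoʳ-≤ (rivals (V (suc i)) x) (charges≤nears i x (<⇒≤ i≤)))
        (≤-reflexive (trans (sym (sumL-+ ps _ _))
          (sumL-cong ps (λ y → sym (*-distribˡ-+ (# (¬? (x ≟ y))) (near (V (suc i)) a x y) (nears i a x y))))))

      charges-above : ∀ i x → charges charge heavy-charged (i + h) x ≤ i + charges charge heavy-charged h x
      charges-above zero x = ≤-refl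
      charges-above (suc i) x with suc (i + h) ≤? h
      ... | yes le = contradiction le (<⇒≱ (s≤s (m≤n+m h i)))
      ... | no _   = s≤s (charges-above i x)

      total-charge : sumL ps (charges charge heavy-charged e) ≤ W * j + penalties ps K h a
      total-charge =
        ≤-trans (sumL-mono ps {charges charge heavy-charged e} {λ x → j + close x}
                  (λ {x} _ → ≤-trans (charges-above j x) (+-monoʳ-≤ j (charges≤nears h x ≤-refl))))
          (≤-trans (≤-reflexive (sumL-+ ps (λ _ → j) close))
            (+-mono-≤ (≤-reflexive (sumL-const ps j))
              (sumL-mono ps {close} {λ x → sumL ps (penalty ps K h a x)}
                (λ {x} _ → sumL-mono ps {λ y → # (¬? (x ≟ y)) * nears h a x y} {penalty ps K h a x}
                  (λ {y} _ → *-monoʳ-≤ (# (¬? (x ≟ y))) (m≤m+n (nears h a x y) (K * near n a x y)))))))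
        where
        close : ℕ → ℕ
        close x = sumL ps (λ y → # (¬? (x ≟ y)) * nears h a x y)

      splits≤ : rowSplits e Q 0 ≤ Q * (j + 18)
      splits≤ = few-splits R (rowSplits e Q 0) W j Q (penalties ps K h a) 16
        (≤-trans (rowSplits≤charges charge heavy-charged e Q 0) total-charge) (<⇒≤ cheap) 1≤W W≤

      -- The number of splits is at most Q (j + 18), where 18 is 16 + 2 from the budget
      -- `K = 16 * W + 2`. Three moves per split, one further leaf for each of the `Q` trees and at
      -- most 2 Q cuts give 57 = 3 · 18 + 3.
      length≤ : e + (3 * rowSplits e Q 0 + Q + 2 * Q) ≤ e + Q * (3 * j + 57)
      length≤ = +-monoʳ-≤ e (few-ops (rowSplits e Q 0) Q j 18 splits≤)

      top′ : ∀ i → i < e → dyadic n i < P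
      top′ i i< = begin-strict
        dyadic n i   ≡⟨ dyadic-^ n i ⟩
        2 ^ i * n    <⟨ *-monoˡ-< n {{>-nonZero 0<n}} (top i i<) ⟩
        F * n        ≤⟨ *-monoˡ-≤ n (m≤n*m F Q {{>-nonZero 1≤Q}}) ⟩
        Q * F * n    ≡⟨ sym P≡ ⟩
        P            ∎

      QV≤ : Q * V e ≤ P + P
      QV≤ = begin
        Q * V e               ≡⟨ cong (Q *_) (dyadic-^ n e) ⟩
        Q * (2 ^ e * n)       ≤⟨ *-monoʳ-≤ Q (*-monoˡ-≤ n ≤2F) ⟩
        Q * (2 * F * n)       ≡⟨ pull Q F n ⟩
        Q * F * n + Q * F * n ≡⟨ cong₂ _+_ (sym P≡) (sym P≡) ⟩
        P + P                 ∎
        where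
        pull : ∀ a b c → a * (2 * b * c) ≡ a * b * c + a * b * c
        pull = solve-∀

      z< : ∀ x → z x < Q * V e
      z< x = begin-strict
        z x              <⟨ m%n<n (a * x) P ⟩
        P                ≡⟨ P≡ ⟩
        Q * F * n        ≤⟨ *-monoˡ-≤ n (*-monoʳ-≤ Q F≤) ⟩
        Q * 2 ^ e * n    ≡⟨ *-assoc Q (2 ^ e) n ⟩
        Q * (2 ^ e * n)  ≡⟨ cong (Q *_) (sym (dyadic-^ n e)) ⟩
        Q * V e          ∎

      small : 2 * W < suc (2 * Q) * suc R
      small = begin-strict
        2 * W                  ≤⟨ *-monoʳ-≤ 2 (≤-trans W≤ (*-monoʳ-≤ Q (n≤1+n R))) ⟩
        2 * (Q * suc R)        ≡⟨ sym (*-assoc 2 Q (suc R)) ⟩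
        2 * Q * suc R          <⟨ m<n+m _ (s≤s z≤n) ⟩
        suc (2 * Q) * suc R    ∎

      colouring-by : let open Ops P (suc R ^ suc (2 * Q)) R in
        ∃[ os ] ∃[ colour ]
          (length os ≤ e + Q * (3 * j + 57) ×
           (∀ x → offset (runOps ((a * x) % P) os (cursor 0 n 1)) ≡ suc R ^ colour x) ×
           (∀ x → colour x ≤ 2 * Q) ×
           (∀ c → sumL ps (λ x → # (colour x ≟ c)) ≤ R))
      colouring-by =
        let os , colour , len , rest = Building.colouring n R P (2 * Q) e 0<n 1≤R top′ light Q QV≤ small z<
        in os , colour , ≤-trans len length≤ , rest

    good-colouring : let open Ops P (suc R ^ suc (2 * Q)) R in
      ∃[ a ] ∃[ os ] ∃[ colour ]
        (a < P × length os ≤ e + Q * (3 * j + 57) ×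
         (∀ x → offset (runOps ((a * x) % P) os (cursor 0 n 1)) ≡ suc R ^ colour x) ×
         (∀ x → colour x ≤ 2 * Q) ×
         (∀ c → sumL ps (λ x → # (colour x ≟ c)) ≤ R))
    good-colouring =
      let a , a<P , cheap = multiplier
          os , colour , rest = colouring-by a cheap
      in a , os , colour , a<P , rest

-- Walks with prescribed colour counts

module Digits (R : ℕ) where

  b : ℕ
  b = suc R

  shift : ℕ → ℕ → ℕ
  shift zero    s = s
  shift (suc c) s = shift c (s / b)

  digit : ℕ → ℕ → ℕ
  digit c s = shift c s % b

  +b-/ : ∀ s t → (s + b * t) / b ≡ s / b + t
  +b-/ s t = trans (cong (λ u → (s + u) / b) (*-comm b t))
    (trans (+-distrib-/-∣ʳ s (divides-refl t)) (cong (s / b +_) (m*n/n≡m t b)))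

  +b-% : ∀ s t → (s + b * t) % b ≡ s % b
  +b-% s t = trans (cong (λ u → (s + u) % b) (*-comm b t)) ([m+kn]%n≡m%n s t b)

  suc-split : ∀ s → suc (s % b) + s / b * b ≡ s + 1
  suc-split s = trans (cong suc (sym (m≡m%n+[m/n]*n s b))) (+-comm 1 s)

  no-carry : ∀ s → s % b < R → (s + 1) % b ≡ suc (s % b) × (s + 1) / b ≡ s / b
  no-carry s lt =
    let p , q = division-unique {b} {q = s / b} {q′ = (s + 1) / b} (s≤s lt) (m%n<n (s + 1) b)
                  (trans (suc-split s) (m≡m%n+[m/n]*n (s + 1) b))
    in sym p , sym q

  carry : ∀ s → s % b ≡ R → (s + 1) % b ≡ 0
  carry s e = trans (cong (_% b) (sym (suc-split s)))
    (trans ([m+kn]%n≡m%n (suc (s % b)) (s / b) b) (trans (cong (λ r → suc r % b) e) (n%n≡0 b)))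

  shift-+ : ∀ c s → shift c (s + b ^ c) ≡ shift c s + 1
  shift-+ zero    s = refl
  shift-+ (suc c) s = trans (cong (shift c) (+b-/ s (b ^ c))) (shift-+ c (s / b))

  digit-+ : ∀ c s → digit c s < R → ∀ c′ → digit c′ (s + b ^ c) ≡ # (c ≟ c′) + digit c′ s
  digit-+ zero s lt zero     = proj₁ (no-carry s lt)
  digit-+ zero s lt (suc c′) = cong (digit c′) (proj₂ (no-carry s lt))
  digit-+ (suc c) s lt zero  = +b-% s (b ^ c)
  digit-+ (suc c) s lt (suc c′) =
    trans (cong (digit c′) (+b-/ s (b ^ c))) (digit-+ c (s / b) lt c′)

  shift-stable : ∀ c m s → digit c s < R → c < m → shift m (s + b ^ c) ≡ shift m s
  shift-stable zero (suc m) s lt c< = cong (shift m) (proj₂ (no-carry s lt))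
  shift-stable (suc c) (suc m) s lt (s≤s c<) =
    trans (cong (shift m) (+b-/ s (b ^ c))) (shift-stable c m (s / b) lt c<)

  shift-zero : ∀ m → shift m 0 ≡ 0
  shift-zero zero    = refl
  shift-zero (suc m) = trans (cong (shift m) (0/n≡0 b)) (shift-zero m)

  shift-positive : ∀ c s → 0 < shift c s → b ^ c ≤ s
  shift-positive zero    s pos = pos
  shift-positive (suc c) s pos = begin
    b * b ^ c    ≤⟨ *-monoʳ-≤ b (shift-positive c (s / b) pos) ⟩
    b * (s / b)  ≡⟨ *-comm b (s / b) ⟩
    s / b * b    ≤⟨ m/n*n≤m s b ⟩
    s            ∎ where open ≤-Reasoning

  shift-large : ∀ c s → b ^ c ≤ s → 0 < shift c s
  shift-large zero    s le = le
  shift-large (suc c) s le = shift-large c (s / b)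
    (subst (_≤ s / b) (trans (cong (_/ b) (*-comm b (b ^ c))) (m*n/n≡m (b ^ c) b)) (/-monoˡ-≤ b le))

  shift-small : ∀ c s → shift c s ≡ 0 → s < b ^ c
  shift-small c s e = ≰⇒> (λ le → <⇒≢ (shift-large c s le) (sym e))

  -- If the digit of the reduced number were `R`, adding `b ^ c` back would carry and leave the
  -- digit 0. So a nonzero digit means that subtraction does not borrow.
  digit-positive : ∀ c s → digit c s ≢ 0 → b ^ c ≤ s × digit c (s ∸ b ^ c) < R
  digit-positive c s nz = le , ≤∧≢⇒< (s≤s⁻¹ (m%n<n (shift c s′) b)) full
    where
    le : b ^ c ≤ s
    le = shift-positive c s (n≢0⇒n>0 (λ e → nz (trans (cong (_% b) e) refl)))
    s′ = s ∸ b ^ c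
    full : digit c s′ ≢ R
    full e = nz (trans (cong (digit c) (sym (m∸n+n≡m le)))
      (trans (cong (_% b) (shift-+ c s′)) (carry (shift c s′) e)))

  -- The machine stores `b ^ c` instead of `c`; two divisions, by the offset and by the base, read
  -- the digit without knowing its position.
  quotient-digit : ∀ c s → apply div s (b ^ c) ∸ apply div (apply div s (b ^ c)) b * b ≡ digit c s
  quotient-digit c s = trans (cong (λ q → q ∸ q / b * b) (quotient c s)) (sym (m%n≡m∸m/n*n (shift c s) b))
    where
    apply-/ : ∀ x y .{{_ : NonZero y}} → apply div x y ≡ x / y
    apply-/ x (suc y) = refl
    quotient : ∀ c s → apply div s (b ^ c) ≡ shift c s
    quotient zero    s = n/1≡n s
    quotient (suc c) s = begin
      apply div s (b * b ^ c)   ≡⟨ apply-/ s (b * b ^ c) {{m^n≢0 b (suc c)}} ⟩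
      (s / (b * b ^ c)) {{m^n≢0 b (suc c)}}
          ≡⟨ sym (m/n/o≡m/[n*o] s b (b ^ c) {{_}} {{m^n≢0 b c}} {{m^n≢0 b (suc c)}}) ⟩
      (s / b / (b ^ c)) {{m^n≢0 b c}} ≡⟨ sym (apply-/ (s / b) (b ^ c) {{m^n≢0 b c}}) ⟩
      apply div (s / b) (b ^ c) ≡⟨ quotient c (s / b) ⟩
      shift c (s / b)           ∎ where open ≡-Reasoning

-- Adjacency cells and lists of visited vertices

matrix-adj : ∀ {n} (G : Graph n) (u v : Fin n) →
             matrixCell G (toℕ u * n + toℕ v) ≡ (if adj G u v then 1 else 0)
matrix-adj {n} G u v with toℕ u * n + toℕ v <? n * n
... | yes lt = cong (λ (u , v) → if adj G u v then 1 else 0) (begin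
    remQuot n (fromℕ< lt)                 ≡⟨ cong (remQuot n) (toℕ-injective (trans (toℕ-fromℕ< lt) (index u v))) ⟩
    remQuot n (combine u v)               ≡⟨ remQuot-combine u v ⟩
    u , v                                 ∎)
  where
  open ≡-Reasoning
  index : ∀ (u v : Fin n) → toℕ u * n + toℕ v ≡ toℕ (combine u v)
  index u v = trans (cong (_+ toℕ v) (*-comm (toℕ u) n)) (sym (toℕ-combine u v))
... | no ≮ = contradiction (subst (_< n * n) (trans (toℕ-combine u v) (cong (_+ toℕ v) (*-comm n (toℕ u)))) (toℕ<n (combine u v))) ≮

digitAt : ℕ → ℕ → ℕ → ℕ
digitAt b s o = apply div s o ∸ apply div (apply div s o) b * b

-- Reach i s u: some walk of i edges from u has colour counts with code s, the code of a
-- multiset of vertices being the sum of their offsets.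
data Reach (n b : ℕ) (cell off : ℕ → ℕ) : ℕ → ℕ → ℕ → Set where
  here′ : ∀ {s u} → u < n → s ≡ off u → Reach n b cell off 0 s u
  along  : ∀ {i s u v} → u < n → v < n → cell (u * n + v) ≢ 0 → digitAt b s (off u) ≢ 0 →
          Reach n b cell off i (s ∸ off u) v → Reach n b cell off (suc i) s u

vertices : ∀ {n m} → Vec (Fin n) m → List ℕ
vertices []      = []
vertices (x ∷ p) = toℕ x ∷ vertices p

length-vertices : ∀ {n m} (p : Vec (Fin n) m) → length (vertices p) ≡ m
length-vertices []      = refl
length-vertices (x ∷ p) = cong suc (length-vertices p)

vertices<n : ∀ {n m} (p : Vec (Fin n) m) {x} → x ∈ vertices p → x < n
vertices<n (y ∷ p) (here refl) = toℕ<n y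
vertices<n (y ∷ p) (there x∈)  = vertices<n p x∈

visits-vertices : ∀ {n m} (v : Fin n) (p : Vec (Fin n) m) →
                  sumL (vertices p) (λ y → # (y ≟ toℕ v)) ≡ visits v p
visits-vertices v [] = refl
visits-vertices v (x ∷ p) with v Fin.≟ x
... | yes refl = cong₂ _+_ (#-yes (toℕ v ≟ toℕ v) refl) (visits-vertices v p)
... | no v≢x   = cong₂ _+_ (#-no (toℕ x ≟ toℕ v) (λ e → v≢x (toℕ-injective (sym e)))) (visits-vertices v p)

visits-bound : ∀ {n m r} (p : Vec (Fin n) m) → (∀ v → visits v p ≤ r) →
               ∀ x → sumL (vertices p) (λ y → # (y ≟ x)) ≤ r
visits-bound {n} {r = r} p le x with x <? n
... | yes x< = subst (λ x → sumL (vertices p) (λ y → # (y ≟ x)) ≤ r) (toℕ-fromℕ< x<)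
                 (≤-trans (≤-reflexive (visits-vertices (fromℕ< x<) p)) (le (fromℕ< x<)))
... | no x≮  = ≤-trans (sumL-mono (vertices p) (λ {y} y∈ →
                 ≤-reflexive (#-no (y ≟ x) (λ e → x≮ (subst (_< n) e (vertices<n p y∈))))))
                 (≤-trans (≤-reflexive (trans (sumL-const (vertices p) 0) (*-zeroʳ (length (vertices p))))) z≤n)

-- Class sizes of walks as digits of a code

module Coloured {n : ℕ} (G : Graph n) (R : ℕ) (off colour : ℕ → ℕ)
                (off≡ : ∀ x → x < n → off x ≡ suc R ^ colour x) where

  open Digits R

  classSize : ∀ {m} → ℕ → Vec (Fin n) m → ℕ
  classSize c p = sumL (vertices p) (λ x → # (colour x ≟ c))

  visits≤class : ∀ {m} v (p : Vec (Fin n) m) → visits v p ≤ classSize (colour (toℕ v)) p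
  visits≤class v p = ≤-trans (≤-reflexive (sym (visits-vertices v p)))
    (sumL-mono (vertices p) (λ {x} _ → #-mono (x ≟ toℕ v) (colour x ≟ colour (toℕ v)) (cong colour)))

  digitAt-off : ∀ s (u : Fin n) → digitAt b s (off (toℕ u)) ≡ digit (colour (toℕ u)) s
  digitAt-off s u = trans (cong (digitAt b s) (off≡ (toℕ u) (toℕ<n u))) (quotient-digit (colour (toℕ u)) s)

  if-nonzero : ∀ {c} → (if c then 1 else 0) ≢ 0 → c ≡ true
  if-nonzero {true}  _ = refl
  if-nonzero {false} p = contradiction refl p

  reach-sound : ∀ {i s u} → 1 ≤ R → Reach n b (matrixCell G) off i s u →
    ∃[ p ] (IsWalk G i p × toℕ (lookup p Fin.zero) ≡ u × (∀ c → classSize c p ≡ digit c s))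
  reach-sound {u = u} 1≤R (here′ u< refl) = v ∷ [] , (λ ()) , toℕ-fromℕ< u< , sizes
    where
    v = fromℕ< u<
    sizes : ∀ c → # (colour (toℕ v) ≟ c) + 0 ≡ digit c (off u)
    sizes c = trans (cong (# (colour (toℕ v) ≟ c) +_) (sym (digit-zero c)))
      (trans (sym (digit-+ (colour (toℕ v)) 0 (subst (_< R) (sym (digit-zero (colour (toℕ v)))) 1≤R) c))
        (cong (digit c) (trans (sym (off≡ (toℕ v) (toℕ<n v))) (cong off (toℕ-fromℕ< u<)))))
      where
      digit-zero : ∀ c → digit c 0 ≡ 0
      digit-zero c = trans (cong (_% b) (shift-zero c)) refl
  reach-sound {s = s} {u} 1≤R (along {i = i} {v = v} u< v< a d w) with reach-sound 1≤R w
  ... | y ∷ p , walk , y≡ , sizes = x ∷ y ∷ p , walk′ , toℕ-fromℕ< u< , sizes′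
    where
    x = fromℕ< u<
    c₀ = colour (toℕ x)
    off≡′ : off u ≡ b ^ c₀
    off≡′ = trans (cong off (sym (toℕ-fromℕ< u<))) (off≡ (toℕ x) (toℕ<n x))
    positive = digit-positive c₀ s (λ e → d (trans (trans (cong (λ u → digitAt b s (off u)) (sym (toℕ-fromℕ< u<))) (digitAt-off s x)) e))
    walk′ : IsWalk G (suc i) (x ∷ y ∷ p)
    walk′ Fin.zero    = if-nonzero (λ e → a (trans (cong₂ (λ u v → matrixCell G (u * n + v)) (sym (toℕ-fromℕ< u<)) (sym y≡)) (trans (matrix-adj G x y) e)))
    walk′ (Fin.suc j) = walk j
    sizes′ : ∀ c → # (c₀ ≟ c) + classSize c (y ∷ p) ≡ digit c s
    sizes′ c = trans (cong (# (c₀ ≟ c) +_) (trans (sizes c) (cong (λ o → digit c (s ∸ o)) off≡′)))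
      (trans (sym (digit-+ c₀ (s ∸ b ^ c₀) (proj₂ positive) c)) (cong (digit c) (m∸n+n≡m (proj₁ positive))))

  -- The digits of `s` are the class sizes of the walk, a digit in base `R + 1` is at most `R`, and
  -- the visits to a vertex are part of its class. No balance of the colouring enters.
  sound : ∀ {k r s u} → 1 ≤ R → R ≤ r → Reach n b (matrixCell G) off k s u → RSimpleKPath G r k
  sound {s = s} 1≤R R≤r w =
    let p , walk , _ , sizes = reach-sound 1≤R w
    in p , walk , λ v → ≤-trans (visits≤class v p)
         (≤-trans (≤-reflexive (sizes (colour (toℕ v)))) (≤-trans (s≤s⁻¹ (m%n<n (shift (colour (toℕ v)) s) b)) R≤r))

  code : ∀ {m} → Vec (Fin n) m → ℕ
  code []      = 0
  code (x ∷ p) = code p + off (toℕ x)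

  module _ (C : ℕ) (colour≤ : ∀ x → colour x ≤ C) where

    -- While no class exceeds `R`, each further vertex increments one digit without a carry. Nothing
    -- therefore spills past digit `C`, which keeps the code inside the table.
    code-digits : ∀ {m} (p : Vec (Fin n) m) → (∀ c → classSize c p ≤ R) →
                  (∀ c → digit c (code p) ≡ classSize c p) × shift (suc C) (code p) ≡ 0
    code-digits [] le = (λ c → trans (cong (_% b) (shift-zero c)) refl) , shift-zero (suc C)
    code-digits (x ∷ p) le =
      (λ c → trans (cong (λ o → digit c (code p + o)) o≡) (trans (digit-+ c₀ (code p) room c) (cong (# (c₀ ≟ c) +_) (proj₁ ih c)))) ,
      trans (cong (λ o → shift (suc C) (code p + o)) o≡) (trans (shift-stable c₀ (suc C) (code p) room (s≤s (colour≤ _))) (proj₂ ih))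
      where
      c₀ = colour (toℕ x)
      o≡ = off≡ (toℕ x) (toℕ<n x)
      ih = code-digits p (λ c → ≤-trans (m≤n+m _ (# (colour (toℕ x) ≟ c))) (le c))
      room : digit c₀ (code p) < R
      room = subst₂ _<_ (sym (proj₁ ih c₀)) refl
        (≤-trans (≤-reflexive (cong (_+ classSize c₀ p) (sym (#-yes (c₀ ≟ c₀) refl)))) (le c₀))

    complete : ∀ i (p : Vec (Fin n) (suc i)) → IsWalk G i p → (∀ c → classSize c p ≤ R) →
               Reach n b (matrixCell G) off i (code p) (toℕ (lookup p Fin.zero))
    complete zero (x ∷ []) walk le = here′ (toℕ<n x) refl
    complete (suc i) (x ∷ y ∷ p) walk le =
      along (toℕ<n x) (toℕ<n y)
        (λ e → contradiction (trans (sym (cong (λ c → if c then 1 else 0) (walk Fin.zero))) (trans (sym (matrix-adj G x y)) e)) λ ())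
        (λ e → contradiction (trans (sym (cong (_+ classSize (colour (toℕ x)) (y ∷ p)) (#-yes (colour (toℕ x) ≟ colour (toℕ x)) refl)))
                 (trans (sym (proj₁ (code-digits (x ∷ y ∷ p) le) (colour (toℕ x)))) (trans (sym (digitAt-off (code (x ∷ y ∷ p)) x)) e))) λ ())
        (subst (λ s → Reach n b (matrixCell G) off i s (toℕ y)) (sym (m+n∸n≡m (code (y ∷ p)) (off (toℕ x))))
          (complete i (y ∷ p) (λ j → walk (Fin.suc j))
            (λ c → ≤-trans (m≤n+m _ (# (colour (toℕ x) ≟ c))) (le c))))

    code< : ∀ {m} (p : Vec (Fin n) m) → (∀ c → classSize c p ≤ R) → code p < b ^ suc C
    code< p le = shift-small (suc C) (code p) (proj₂ (code-digits p le))

-- A structured language and its compilation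

-- Variable x is cell x of the machine, and the heap starts at a fixed cell heapBase, so that get and
-- put never touch a variable.
data Expr : Set where
  lit var : ℕ → Expr
  bin     : ArithOp → Expr → Expr → Expr
  get     : Expr → Expr

infixl 6 _⊕_ _⊖_
infixl 7 _⊗_ _⊘_
_⊕_ _⊖_ _⊗_ _⊘_ : Expr → Expr → Expr
_⊕_ = bin add
_⊖_ = bin sub
_⊗_ = bin mul
_⊘_ = bin div

infix  5 _:=_
infixr 4 _⨾_

data Stmt : Set where
  skip : Stmt
  _:=_ : ℕ → Expr → Stmt
  put  : Expr → Expr → Stmt
  _⨾_  : Stmt → Stmt → Stmt
  ifn  : Expr → Stmt → Stmt → Stmt
  loop : ℕ → Stmt → Stmt

record Store : Set where
  constructor ⟪_,_⟫
  field
    V H : ℕ → ℕ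

open Store public

upd-same : ∀ (M : Memory) a v → (M [ a ≔ v ]) a ≡ v
upd-same M a v with a ≡ᵇ a in eq
... | true  = refl
... | false = ⊥-elim (subst T eq (≡⇒≡ᵇ a a refl))

upd-other : ∀ (M : Memory) a v b → a ≢ b → (M [ a ≔ v ]) b ≡ M b
upd-other M a v b a≢b with a ≡ᵇ b in eq
... | false = refl
... | true  = ⊥-elim (a≢b (≡ᵇ⇒≡ a b (subst T (sym eq) tt)))

eval : Expr → Store → ℕ
eval (lit c)     σ = c
eval (var x)     σ = V σ x
eval (bin o a b) σ = apply o (eval a σ) (eval b σ)
eval (get a)     σ = H σ (eval a σ)

timeE : Expr → ℕ
timeE (lit c)     = 1
timeE (var x)     = 2
timeE (bin o a b) = timeE a + (timeE b + 1)
timeE (get a)     = timeE a + 3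

module Bounds (heapBase B : ℕ) where

  OpBound : ArithOp → ℕ → ℕ → Set
  OpBound add x y = x + y ≤ B
  OpBound sub x y = ⊤
  OpBound mul x y = x * y ≤ B
  OpBound div x y = ⊤

  -- Every value that the compiled code computes has to fit into a word, also intermediate ones; for
  -- `get` this includes the machine address. Subtraction and division cannot exceed their first
  -- operand.
  BoundE : Expr → Store → Set
  BoundE (lit c)     σ = c ≤ B
  BoundE (var x)     σ = ⊤
  BoundE (bin o a b) σ = BoundE a σ × BoundE b σ × OpBound o (eval a σ) (eval b σ)
  BoundE (get a)     σ = BoundE a σ × heapBase + eval a σ ≤ B

  apply-bound : ∀ o {x y} → x ≤ B → OpBound o x y → apply o x y ≤ B
  apply-bound add x≤ b = b
  apply-bound sub {x} {y} x≤ b = ≤-trans (m∸n≤m x y) x≤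
  apply-bound mul x≤ b = b
  apply-bound div {x} {zero} x≤ b = z≤n
  apply-bound div {x} {suc y} x≤ b = ≤-trans (m/n≤m x (suc y)) x≤

  -- The last index is the exact number of machine steps of the compiled statement. A loop lowers
  -- its counter before the body runs, so the body sees the values from N - 1 down to 0.
  data Exec : Stmt → Store → Store → ℕ → Set where
    skip   : ∀ {σ} → Exec skip σ σ 0
    assign : ∀ {x e σ} → BoundE e σ →
             Exec (x := e) σ ⟪ V σ [ x ≔ eval e σ ] , H σ ⟫ (timeE e + 2)
    put    : ∀ {a e σ} → BoundE a σ → BoundE e σ → heapBase + eval a σ ≤ B →
             Exec (put a e) σ ⟪ V σ , H σ [ eval a σ ≔ eval e σ ] ⟫
                  (timeE a + (2 + (timeE e + 1)))
    seq    : ∀ {s t σ σ′ σ″ c c′} → Exec s σ σ′ c → Exec t σ′ σ″ c′ →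
             Exec (s ⨾ t) σ σ″ (c + c′)
    ifT    : ∀ {e s t σ σ′ c} → BoundE e σ → eval e σ ≢ 0 → Exec s σ σ′ c →
             Exec (ifn e s t) σ σ′ (timeE e + suc (c + 2))
    ifF    : ∀ {e s t σ σ′ c} → BoundE e σ → eval e σ ≡ 0 → Exec t σ σ′ c →
             Exec (ifn e s t) σ σ′ (timeE e + suc c)
    done   : ∀ {x s σ} → V σ x ≡ 0 → Exec (loop x s) σ σ 1
    again  : ∀ {x s σ σ′ σ″ c c′ j} → V σ x ≡ suc j →
             Exec s ⟪ V σ [ x ≔ j ] , H σ ⟫ σ′ c → Exec (loop x s) σ′ σ″ c′ →
             Exec (loop x s) σ σ″ (3 + (c + (2 + c′)))

KeepsBelow : ℕ → Stmt → Set
KeepsBelow m skip        = ⊤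
KeepsBelow m (x := e)    = T (m ≤ᵇ x)
KeepsBelow m (put a e)   = ⊤
KeepsBelow m (s ⨾ t)     = KeepsBelow m s × KeepsBelow m t
KeepsBelow m (ifn e s t) = KeepsBelow m s × KeepsBelow m t
KeepsBelow m (loop x s)  = T (m ≤ᵇ x) × KeepsBelow m s

module _ {heapBase B : ℕ} where
  open Bounds heapBase B

  keepsBelow : ∀ {m s σ σ′ c} → Exec s σ σ′ c → KeepsBelow m s →
               ∀ {y} → y < m → V σ′ y ≡ V σ y
  keepsBelow skip k y<m = refl
  keepsBelow {m} (assign {x} {e} {σ} _) k {y} y<m =
    upd-other (V σ) x (eval e σ) y (λ x≡y → <⇒≢ (<-≤-trans y<m (≤ᵇ⇒≤ m x k)) (sym x≡y))
  keepsBelow (put _ _ _) k y<m = refl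
  keepsBelow (seq p q) (k , l) y<m = trans (keepsBelow q l y<m) (keepsBelow p k y<m)
  keepsBelow (ifT _ _ p) (k , l) y<m = keepsBelow p k y<m
  keepsBelow (ifF _ _ p) (k , l) y<m = keepsBelow p l y<m
  keepsBelow (done _) k y<m = refl
  keepsBelow {m} (again {x} {σ = σ} {j = j} _ p q) (k , l) {y} y<m =
    trans (keepsBelow q (k , l) y<m)
      (trans (keepsBelow p l y<m)
        (upd-other (V σ) x j y (λ x≡y → <⇒≢ (<-≤-trans y<m (≤ᵇ⇒≤ m x k)) (sym x≡y))))

-- Compilation to machine code

module Compiler (varCount heapBase : ℕ) where

  tmp = varCount

  WfE : Expr → ℕ → Set
  WfE (lit c)     d = T (d <ᵇ heapBase)
  WfE (var x)     d = T (x <ᵇ varCount) × T (d <ᵇ heapBase)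
  WfE (bin o a b) d = WfE a d × WfE b (suc d)
  WfE (get a)     d = WfE a d × T (suc d <ᵇ heapBase)

  WfS : Stmt → Set
  WfS skip        = ⊤
  WfS (x := e)    = T (x <ᵇ varCount) × WfE e tmp × T (suc tmp <ᵇ heapBase)
  WfS (put a e)   = WfE a tmp × WfE e (suc tmp) × T (suc tmp <ᵇ heapBase)
  WfS (s ⨾ t)     = WfS s × WfS t
  WfS (ifn e s t) = WfE e tmp × T (tmp <ᵇ heapBase) × WfS s × WfS t
  WfS (loop x s)  = T (x <ᵇ varCount) × T (tmp <ᵇ heapBase) × WfS s

  compE : Expr → ℕ → List Instr
  compE (lit c)     d = const d c ∷ []
  compE (var x)     d = const d 0 ∷ arith add d x d ∷ []
  compE (bin o a b) d = compE a d ++ compE b (suc d) ++ arith o d d (suc d) ∷ []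
  compE (get a)     d = compE a d ++ const (suc d) heapBase ∷ arith add d d (suc d) ∷ load d d ∷ []

  sizeS : Stmt → ℕ
  sizeS skip        = 0
  sizeS (x := e)    = timeE e + 2
  sizeS (put a e)   = timeE a + (2 + (timeE e + 1))
  sizeS (s ⨾ t)     = sizeS s + sizeS t
  sizeS (ifn e s t) = timeE e + suc (sizeS s + (2 + sizeS t))
  sizeS (loop x s)  = 3 + (sizeS s + 2)

  -- Jump targets are absolute, hence the start address as an argument. Clearing `tmp` before
  -- `jz tmp` serves as an unconditional jump, and adding a zero serves as a copy.
  compS : Stmt → ℕ → List Instr
  compS skip        i = []
  compS (x := e)    i = compE e tmp ++ const (suc tmp) 0 ∷ arith add x tmp (suc tmp) ∷ []
  compS (put a e)   i = compE a tmp ++ const (suc tmp) heapBase ∷ arith add tmp tmp (suc tmp)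
                        ∷ compE e (suc tmp) ++ store tmp (suc tmp) ∷ []
  compS (s ⨾ t)     i = compS s i ++ compS t (i + sizeS s)
  compS (ifn e s t) i =
    let i₁ = suc (i + timeE e)
        i₂ = 2 + (i₁ + sizeS s) in
    compE e tmp ++ jz tmp i₂ ∷ compS s i₁ ++ const tmp 0 ∷ jz tmp (i₂ + sizeS t) ∷ compS t i₂
  compS (loop x s)  i =
    jz x (2 + (3 + i + sizeS s)) ∷ const tmp 1 ∷ arith sub x x tmp
    ∷ compS s (3 + i) ++ const tmp 0 ∷ jz tmp i ∷ []

  Segment : Program → ℕ → ℕ → List Instr → Set
  Segment P i j []       = i ≡ j
  Segment P i j (I ∷ Is) = fetch P i ≡ just I × Segment P (suc i) j Is

  segment-++ : ∀ {P} Is {Js i j} → Segment P i j (Is ++ Js) →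
               ∃[ m ] (Segment P i m Is × Segment P m j Js)
  segment-++ []       s       = _ , refl , s
  segment-++ (I ∷ Is) (f , s) = let m , p , q = segment-++ Is s in m , (f , p) , q

  segment-length : ∀ {P} Is {i j} → Segment P i j Is → i + length Is ≡ j
  segment-length []       {i} refl = +-identityʳ i
  segment-length (I ∷ Is) {i} (f , s) = trans (+-suc i (length Is)) (segment-length Is s)

  segment-whole : ∀ pre Is post →
                  Segment (pre ++ Is ++ post) (length pre) (length pre + length Is) Is
  segment-whole pre [] post = sym (+-identityʳ _)
  segment-whole pre (I ∷ Is) post =
    fetch-at pre ,
    subst₂ (λ P j → Segment P (suc (length pre)) j Is)
      (snoc pre) (sym (+-suc (length pre) (length Is)))
      (subst (λ i → Segment ((pre ++ I ∷ []) ++ Is ++ post) i (i + length Is) Is)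
        (trans (length-++ pre) (+-comm (length pre) 1))
        (segment-whole (pre ++ I ∷ []) Is post))
    where
    fetch-at : ∀ (xs : List Instr) → head (drop (length xs) (xs ++ I ∷ Is ++ post)) ≡ just I
    fetch-at []       = refl
    fetch-at (_ ∷ xs) = fetch-at xs
    snoc : ∀ (xs : List Instr) → (xs ++ I ∷ []) ++ Is ++ post ≡ xs ++ I ∷ Is ++ post
    snoc []       = refl
    snoc (x ∷ xs) = cong (x ∷_) (snoc xs)

  length-compE : ∀ e d → length (compE e d) ≡ timeE e
  length-compE (lit c) d = refl
  length-compE (var x) d = refl
  length-compE (bin o a b) d
    rewrite length-++ (compE a d) {compE b (suc d) ++ arith o d d (suc d) ∷ []}
          | length-++ (compE b (suc d)) {arith o d d (suc d) ∷ []}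
          | length-compE a d | length-compE b (suc d) = refl
  length-compE (get a) d
    rewrite length-++ (compE a d) {const (suc d) heapBase ∷ arith add d d (suc d) ∷ load d d ∷ []}
          | length-compE a d = refl

  length-compS : ∀ s i → length (compS s i) ≡ sizeS s
  length-compS skip i = refl
  length-compS (x := e) i
    rewrite length-++ (compE e tmp) {const (suc tmp) 0 ∷ arith add x tmp (suc tmp) ∷ []}
          | length-compE e tmp = refl
  length-compS (put a e) i
    rewrite length-++ (compE a tmp) {const (suc tmp) heapBase ∷ arith add tmp tmp (suc tmp)
                        ∷ compE e (suc tmp) ++ store tmp (suc tmp) ∷ []}
          | length-++ (compE e (suc tmp)) {store tmp (suc tmp) ∷ []}
          | length-compE a tmp | length-compE e (suc tmp) = refl
  length-compS (s ⨾ t) i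
    rewrite length-++ (compS s i) {compS t (i + sizeS s)}
          | length-compS s i | length-compS t (i + sizeS s) = refl
  length-compS (ifn e s t) i =
    trans (length-++ (compE e tmp))
      (cong₂ (λ x y → x + suc y) (length-compE e tmp)
        (trans (length-++ (compS s _))
          (cong₂ (λ x y → x + (2 + y)) (length-compS s _) (length-compS t _))))
  length-compS (loop x s) i =
    cong (3 +_) (trans (length-++ (compS s (3 + i))) (cong (_+ 2) (length-compS s (3 + i))))

  -- Simulation of executions by the machine

  module Simulation (B : ℕ) (P : Program) where
    open Bounds heapBase B

    Fits : Memory → Set
    Fits M = ∀ a → M a ≤ B

    fits-upd : ∀ {M} a {v} → Fits M → v ≤ B → Fits (M [ a ≔ v ])
    fits-upd a f v≤ b with a ≡ᵇ b
    ... | true  = v≤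
    ... | false = f b

    data Steps : ℕ → State → State → Set where
      stop : ∀ {s} → Fits (mem s) → Steps 0 s s
      next : ∀ {t s s′ I} → Fits (mem s) → fetch P (pc s) ≡ just I →
             Steps t (exec I s) s′ → Steps (suc t) s s′

    _◅◅_ : ∀ {t u s s′ s″} → Steps t s s′ → Steps u s′ s″ → Steps (t + u) s s″
    stop _      ◅◅ q = q
    next f e p  ◅◅ q = next f e (p ◅◅ q)

    infixr 5 _◅◅_

    step-fetch : ∀ {I s} → fetch P (pc s) ≡ just I → step P s ≡ exec I s
    step-fetch {s = s} e with fetch P (pc s) | e
    ... | just _ | refl = refl

    steps-run : ∀ {t s s′} → Steps t s s′ → run P t s ≡ s′
    steps-run (stop _) = refl
    steps-run {suc t} (next {s = s} f e p) = trans (cong (run P t) (step-fetch {s = s} e)) (steps-run p)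

    steps-fit : ∀ {t s s′} → Steps t s s′ → ∀ u → u ≤ t → Fits (mem (run P u s))
    steps-fit (stop f)     zero    _ = f
    steps-fit (next f e p) zero    _ = f
    steps-fit (next {s = s} f e p) (suc u) (s≤s u≤) =
      subst (λ s → Fits (mem (run P u s))) (sym (step-fetch {s = s} e)) (steps-fit p u u≤)

    steps-end : ∀ {t s s′} → Steps t s s′ → Fits (mem s′)
    steps-end (stop f) = f
    steps-end (next _ _ p) = steps-end p

    -- The cells from `varCount` up to `heapBase` serve as the evaluation stack and stay
    -- unconstrained.
    record _≈_ (M : Memory) (σ : Store) : Set where
      field
        vars : ∀ {x} → x < varCount → M x ≡ V σ x
        heap : ∀ i → M (heapBase + i) ≡ H σ i
        fits : Fits M
    open _≈_ public

    ≈-upd-tmp : ∀ {M σ} d {v} → varCount ≤ d → d < heapBase → v ≤ B →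
                M ≈ σ → (M [ d ≔ v ]) ≈ σ
    vars (≈-upd-tmp {M} d {v} l u b s) {x} x< =
      trans (upd-other M d v x (λ e → <⇒≢ (<-≤-trans x< l) (sym e))) (vars s x<)
    heap (≈-upd-tmp {M} d {v} l u b s) i =
      trans (upd-other M d v (heapBase + i) (<⇒≢ (<-≤-trans u (m≤m+n heapBase i)))) (heap s i)
    fits (≈-upd-tmp d l u b s) = fits-upd d (fits s) b

    ≈-upd-var : ∀ {M σ} x {v} → varCount ≤ heapBase → x < varCount → v ≤ B →
                M ≈ σ → (M [ x ≔ v ]) ≈ ⟪ V σ [ x ≔ v ] , H σ ⟫
    vars (≈-upd-var x l u b s) {y} y< with x ≡ᵇ y
    ... | true  = refl
    ... | false = vars s y<
    heap (≈-upd-var {M} x {v} l u b s) i =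
      trans (upd-other M x v (heapBase + i) (<⇒≢ (<-≤-trans u (≤-trans l (m≤m+n heapBase i))))) (heap s i)
    fits (≈-upd-var x l u b s) = fits-upd x (fits s) b

    ≈-upd-heap : ∀ {M σ} a {v} → varCount ≤ heapBase → v ≤ B →
                 M ≈ σ → (M [ heapBase + a ≔ v ]) ≈ ⟪ V σ , H σ [ a ≔ v ] ⟫
    vars (≈-upd-heap {M} a {v} l b s) {y} y< =
      trans (upd-other M (heapBase + a) v y
              (λ e → <⇒≢ (<-≤-trans y< (≤-trans l (m≤m+n heapBase a))) (sym e))) (vars s y<)
    heap (≈-upd-heap {M} {σ} a {v} l b s) i with a ≟ i
    ... | yes refl = trans (upd-same M (heapBase + a) v) (sym (upd-same (H σ) a v))
    ... | no a≢i   = trans (upd-other M (heapBase + a) v (heapBase + i) (λ e → a≢i (+-cancelˡ-≡ heapBase a i e)))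
                       (trans (heap s i) (sym (upd-other (H σ) a v i a≢i)))
    fits (≈-upd-heap a l b s) = fits-upd (heapBase + a) (fits s) b

    lt : ∀ {m n} → T (m <ᵇ n) → m < n
    lt {m} {n} = <ᵇ⇒< m n

    -- Evaluation at depth `d` changes no cell below `d`. The last component of the result records
    -- this; it is what saves the left operand while the right one is evaluated one cell higher.
    compE-correct : ∀ e d {i j M σ} → Segment P i j (compE e d) → WfE e d → varCount ≤ d →
      M ≈ σ → BoundE e σ →
      ∃[ M′ ] (Steps (timeE e) ⟨ i , M ⟩ ⟨ j , M′ ⟩ × M′ ≈ σ × M′ d ≡ eval e σ
               × (∀ {a} → a < d → M′ a ≡ M a))
    compE-correct (lit c) d {M = M} (f , refl) w l s b =
      let s₁ = ≈-upd-tmp d l (lt w) b s in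
      _ , next (fits s) f (stop (fits s₁)) , s₁ , upd-same M d c ,
      λ a< → upd-other M d c _ (λ e → <⇒≢ a< (sym e))
    compE-correct (var x) d {M = M} {σ} (f , g , refl) (wx , w) l s b =
      let x<  = lt wx
          M₁  = M [ d ≔ 0 ]
          s₁  = ≈-upd-tmp {M} d {0} l (lt w) z≤n s
          val : M₁ x + M₁ d ≡ V σ x
          val = trans (cong₂ _+_ (vars s₁ x<) (upd-same M d 0)) (+-identityʳ _)
          s₂  = ≈-upd-tmp {M₁} d {M₁ x + M₁ d} l (lt w)
                  (subst (_≤ B) (trans (vars s x<) (sym val)) (fits s x)) s₁
      in _ , next (fits s) f (next (fits s₁) g (stop (fits s₂))) , s₂ ,
         trans (upd-same M₁ d _) val ,
         λ a< → trans (upd-other M₁ d _ _ (λ e → <⇒≢ a< (sym e)))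
                      (upd-other M d 0 _ (λ e → <⇒≢ a< (sym e)))
    compE-correct (bin o a b) d {M = M} {σ} sg (wa , wb) l s (ba , bb , bo)
      with segment-++ (compE a d) sg
    ... | _ , sga , sg′ with segment-++ (compE b (suc d)) sg′
    ... | _ , sgb , f , refl
      with compE-correct a d sga wa l s ba
    ... | M₁ , p₁ , s₁ , v₁ , k₁
      with compE-correct b (suc d) sgb wb (m≤n⇒m≤1+n l) s₁ bb
    ... | M₂ , p₂ , s₂ , v₂ , k₂ =
      let va  = trans (k₂ (n<1+n d)) v₁
          val = cong₂ (apply o) va v₂
          le  = subst (_≤ B) (sym val)
                  (apply-bound o (subst (_≤ B) va (fits s₂ d)) bo)
          s₃  = ≈-upd-tmp {M₂} d {apply o (M₂ d) (M₂ (suc d))} l (wf-d a wa) le s₂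
      in _ , p₁ ◅◅ p₂ ◅◅ next (fits s₂) f (stop (fits s₃)) , s₃ ,
         trans (upd-same M₂ d _) val ,
         λ a< → trans (upd-other M₂ d _ _ (λ e → <⇒≢ a< (sym e)))
                 (trans (k₂ (m<n⇒m<1+n a<)) (k₁ a<))
      where
      wf-d : ∀ e → WfE e d → d < heapBase
      wf-d (lit c) w = lt w
      wf-d (var x) w = lt (proj₂ w)
      wf-d (bin _ e _) w = wf-d e (proj₁ w)
      wf-d (get e) w = wf-d e (proj₁ w)
    compE-correct (get a) d {M = M} {σ} sg (wa , w) l s (ba , bo)
      with segment-++ (compE a d) sg
    ... | _ , sga , f , g , h , refl
      with compE-correct a d sga wa l s ba
    ... | M₁ , p₁ , s₁ , v₁ , k₁ =
      let hb≤ = ≤-trans (m≤m+n heapBase (eval a σ)) bo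
          d<  = <-trans (n<1+n d) (lt w)
          M₂  = M₁ [ suc d ≔ heapBase ]
          s₂  = ≈-upd-tmp {M₁} (suc d) {heapBase} (m≤n⇒m≤1+n l) (lt w) hb≤ s₁
          v₂ : M₂ d ≡ eval a σ
          v₂  = trans (upd-other M₁ (suc d) heapBase d 1+n≢n) v₁
          sm : M₂ d + M₂ (suc d) ≡ heapBase + eval a σ
          sm  = trans (cong₂ _+_ v₂ (upd-same M₁ (suc d) heapBase)) (+-comm (eval a σ) heapBase)
          M₃  = M₂ [ d ≔ M₂ d + M₂ (suc d) ]
          s₃  = ≈-upd-tmp {M₂} d {M₂ d + M₂ (suc d)} l d< (subst (_≤ B) (sym sm) bo) s₂
          v₃ : M₃ (M₃ d) ≡ H σ (eval a σ)
          v₃  = trans (cong M₃ (trans (upd-same M₂ d _) sm)) (heap s₃ _)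
          s₄  = ≈-upd-tmp {M₃} d {M₃ (M₃ d)} l d< (fits s₃ _) s₃
      in _ , p₁ ◅◅ next (fits s₁) f (next (fits s₂) g (next (fits s₃) h (stop (fits s₄)))) , s₄ ,
         trans (upd-same M₃ d _) v₃ ,
         λ a< → trans (upd-other M₃ d _ _ (λ e → <⇒≢ a< (sym e)))
                 (trans (upd-other M₂ d _ _ (λ e → <⇒≢ a< (sym e)))
                  (trans (upd-other M₁ (suc d) _ _ (λ e → <⇒≢ (m<n⇒m<1+n a<) (sym e))) (k₁ a<)))

    next-jz₀ : ∀ {t i M s′ a l} → Fits M → fetch P i ≡ just (jz a l) → M a ≡ 0 →
               Steps t ⟨ l , M ⟩ s′ → Steps (suc t) ⟨ i , M ⟩ s′
    next-jz₀ {t} {i} {M} {s′} {a} {l} f e z p = next f e (subst (λ s → Steps t s s′) (sym jump) p)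
      where
      jump : exec (jz a l) ⟨ i , M ⟩ ≡ ⟨ l , M ⟩
      jump rewrite z = refl

    next-jz₁ : ∀ {t i M s′ a l} → Fits M → fetch P i ≡ just (jz a l) → M a ≢ 0 →
               Steps t ⟨ suc i , M ⟩ s′ → Steps (suc t) ⟨ i , M ⟩ s′
    next-jz₁ {t} {i} {M} {s′} {a} {l} f e nz p = next f e (subst (λ s → Steps t s s′) (sym jump) p)
      where
      jump : exec (jz a l) ⟨ i , M ⟩ ≡ ⟨ suc i , M ⟩
      jump with M a
      ... | zero  = ⊥-elim (nz refl)
      ... | suc _ = refl

    next-jump : ∀ {t i j k l M M′ σ} → varCount < heapBase → M ≈ σ → k ≡ l →
                Segment P i j (const tmp 0 ∷ jz tmp k ∷ []) →
                (∀ {N} → N ≈ σ → ∃[ N′ ] (Steps t ⟨ l , N ⟩ ⟨ M′ , N′ ⟩ × N′ ≈ σ)) →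
                ∃[ N′ ] (Steps (2 + t) ⟨ i , M ⟩ ⟨ M′ , N′ ⟩ × N′ ≈ σ)
    next-jump {M = M} u s refl (f , g , refl) rest =
      let s₁ = ≈-upd-tmp {M} tmp {0} ≤-refl u z≤n s
          N′ , p , s₂ = rest s₁
      in N′ , next (fits s) f (next-jz₀ (fits s₁) g (upd-same M tmp 0) p) , s₂

    stop-≡ : ∀ {i M N} → M ≡ N → Fits N → Steps 0 ⟨ i , M ⟩ ⟨ i , N ⟩
    stop-≡ refl f = stop f

    compS-correct : ∀ {s σ σ′ c} → suc tmp < heapBase → Exec s σ σ′ c →
      ∀ {i j M} → Segment P i j (compS s i) → WfS s → M ≈ σ →
      ∃[ M′ ] (Steps c ⟨ i , M ⟩ ⟨ j , M′ ⟩ × M′ ≈ σ′)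
    compS-correct u skip refl w s = _ , stop (fits s) , s
    compS-correct u (assign {x} {e} {σ} b) sg (wx , we , w) s
      with segment-++ (compE e tmp) sg
    ... | _ , sge , f , g , refl
      with compE-correct e tmp sge we ≤-refl s b
    ... | M₁ , p₁ , s₁ , v₁ , _ =
      let s₂  = ≈-upd-tmp {M₁} (suc tmp) {0} (n≤1+n _) u z≤n s₁
          M₂  = M₁ [ suc tmp ≔ 0 ]
          val : M₂ tmp + M₂ (suc tmp) ≡ eval e σ
          val = trans (cong₂ _+_ (trans (upd-other M₁ (suc tmp) 0 tmp 1+n≢n) v₁)
                        (upd-same M₁ (suc tmp) 0)) (+-identityʳ _)
          s₃  = ≈-upd-var {M₂} x {eval e σ} (<⇒≤ (<-trans (n<1+n _) u)) (lt wx)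
                  (subst (_≤ B) v₁ (fits s₁ tmp)) s₂
      in _ , p₁ ◅◅ next (fits s₁) f (next (fits s₂) g
               (stop-≡ (cong (λ v → M₂ [ x ≔ v ]) val) (fits s₃)))
         , s₃
    compS-correct u (put {a} {e} {σ} ba be bo) sg (wa , we , w) s
      with segment-++ (compE a tmp) sg
    ... | _ , sga , f , g , sg′
      with segment-++ (compE e (suc tmp)) sg′
    ... | _ , sge , h , refl
      with compE-correct a tmp sga wa ≤-refl s ba
    ... | M₁ , p₁ , s₁ , v₁ , _ =
      let hb≤ = ≤-trans (m≤m+n heapBase (eval a σ)) bo
          s₂  = ≈-upd-tmp {M₁} (suc tmp) {heapBase} (n≤1+n _) u hb≤ s₁
          M₂  = M₁ [ suc tmp ≔ heapBase ]
          sm : M₂ tmp + M₂ (suc tmp) ≡ heapBase + eval a σ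
          sm  = trans (cong₂ _+_ (trans (upd-other M₁ (suc tmp) heapBase tmp 1+n≢n) v₁)
                        (upd-same M₁ (suc tmp) heapBase)) (+-comm (eval a σ) heapBase)
          M₃  = M₂ [ tmp ≔ M₂ tmp + M₂ (suc tmp) ]
          s₃  = ≈-upd-tmp {M₂} tmp {M₂ tmp + M₂ (suc tmp)} ≤-refl (<-trans (n<1+n _) u)
                  (subst (_≤ B) (sym sm) bo) s₂
          M₄ , p₄ , s₄ , v₄ , k₄ = compE-correct e (suc tmp) sge we (n≤1+n _) s₃ be
          ad : M₄ tmp ≡ heapBase + eval a σ
          ad  = trans (k₄ (n<1+n tmp)) (trans (upd-same M₂ tmp _) sm)
          s₅  = ≈-upd-heap {M₄} (eval a σ) {eval e σ} (<⇒≤ (<-trans (n<1+n _) u))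
                  (subst (_≤ B) v₄ (fits s₄ _)) s₄
      in _ , p₁ ◅◅ next (fits s₁) f (next (fits s₂) g
             (p₄ ◅◅ next (fits s₄) h
               (stop-≡ (cong₂ (λ b v → M₄ [ b ≔ v ]) ad v₄) (fits s₅))))
         , s₅
    compS-correct u (seq {s₁} {s₂} p q) {i} sg (w₁ , w₂) s
      with segment-++ (compS s₁ i) sg
    ... | m , sg₁ , sg₂
      -- Identifies the line at which the code of the first statement ends with the address that the
      -- compiler assigned to the second one.
      with trans (cong (i +_) (sym (length-compS s₁ i))) (segment-length (compS s₁ i) sg₁)
    ... | refl
      with compS-correct u p sg₁ w₁ s
    ... | M₁ , p₁ , t₁ with compS-correct u q sg₂ w₂ t₁
    ... | M₂ , p₂ , t₂ = M₂ , p₁ ◅◅ p₂ , t₂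
    compS-correct u (ifT {e} {s₁} {s₂} b nz p) {i} sg (we , w , w₁ , w₂) s
      with segment-++ (compE e tmp) sg
    ... | m , sge , f , sg′
      with trans (cong (i +_) (sym (length-compE e tmp))) (segment-length (compE e tmp) sge)
    ... | refl
      with segment-++ (compS s₁ (suc (i + timeE e))) sg′
    ... | m₁ , sg₁ , g , h , sg₂
      with trans (cong (suc (i + timeE e) +_) (sym (length-compS s₁ _)))
                 (segment-length (compS s₁ (suc (i + timeE e))) sg₁)
    ... | refl
      with trans (cong (λ l → 2 + (suc (i + timeE e) + sizeS s₁) + l) (sym (length-compS s₂ _)))
                 (segment-length (compS s₂ (2 + (suc (i + timeE e) + sizeS s₁))) sg₂)
    ... | refl
      with compE-correct e tmp sge we ≤-refl s b
    ... | M₁ , p₁ , t₁ , v₁ , _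
      with compS-correct u p sg₁ w₁ t₁
    ... | M₂ , p₂ , t₂
      with next-jump (<-trans (n<1+n _) u) t₂ refl (g , h , refl) (λ n → _ , stop (fits n) , n)
    ... | M₃ , p₃ , t₃ =
      M₃ , p₁ ◅◅ next-jz₁ (fits t₁) f (λ z → nz (trans (sym v₁) z)) (p₂ ◅◅ p₃) , t₃
    compS-correct u (ifF {e} {s₁} {s₂} b z p) {i} sg (we , w , w₁ , w₂) s
      with segment-++ (compE e tmp) sg
    ... | m , sge , f , sg′
      with trans (cong (i +_) (sym (length-compE e tmp))) (segment-length (compE e tmp) sge)
    ... | refl
      with segment-++ (compS s₁ (suc (i + timeE e))) sg′
    ... | m₁ , sg₁ , g , h , sg₂
      with trans (cong (suc (i + timeE e) +_) (sym (length-compS s₁ _)))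
                 (segment-length (compS s₁ (suc (i + timeE e))) sg₁)
    ... | refl
      with compE-correct e tmp sge we ≤-refl s b
    ... | M₁ , p₁ , t₁ , v₁ , _
      with compS-correct u p sg₂ w₂ t₁
    ... | M₂ , p₂ , t₂ = M₂ , p₁ ◅◅ next-jz₀ (fits t₁) f (trans v₁ z) p₂ , t₂
    compS-correct u (done {x} {s₁} z) {i} (f , _ , _ , sg) (wx , w , w₁) s
      with segment-++ (compS s₁ (3 + i)) sg
    ... | m , sg₁ , g , h , refl
      with trans (cong (3 + i +_) (sym (length-compS s₁ _)))
                 (segment-length (compS s₁ (3 + i)) sg₁)
    ... | refl = _ , next-jz₀ (fits s) f (trans (vars s (lt wx)) z) (stop (fits s)) , s
    compS-correct u (again {x} {s₁} {σ} {j = j} e p q) {i} {M = M} sg@(f , g , h , sg′) wf@(wx , w , w₁) s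
      with segment-++ (compS s₁ (3 + i)) sg′
    ... | m , sg₁ , g′ , h′ , refl =
      let x≡  = trans (vars s (lt wx)) e
          s₁  = ≈-upd-tmp {M} tmp {1} ≤-refl (lt w)
                  (≤-trans (s≤s z≤n) (subst (_≤ B) x≡ (fits s x))) s
          M₁  = M [ tmp ≔ 1 ]
          val : M₁ x ∸ M₁ tmp ≡ j
          val = cong₂ _∸_ (trans (vars s₁ (lt wx)) e) (upd-same M tmp 1)
          s₂  = ≈-upd-var {M₁} x {j} (<⇒≤ (<-trans (n<1+n _) u)) (lt wx)
                  (≤-trans (n≤1+n j) (subst (_≤ B) x≡ (fits s x))) s₁
          M₃ , p₃ , s₃ = compS-correct u p sg₁ w₁ s₂
          s₄  = ≈-upd-tmp {M₃} tmp {0} ≤-refl (lt w) z≤n s₃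
          M₅ , p₅ , s₅ = compS-correct u q sg wf s₄
      in M₅ , next-jz₁ (fits s) f (λ z → 1+n≢0 (trans (sym x≡) z))
                (next (fits s) g (next (fits s₁) h
                  (subst (λ v → Steps _ ⟨ 3 + i , M₁ [ x ≔ v ] ⟩ ⟨ _ , M₅ ⟩) (sym val)
                    (p₃ ◅◅ next (fits s₃) g′ (next-jz₀ (fits s₄) h′ (upd-same M₃ tmp 0) p₅))))) , s₅

-- The search program

heapBase varCount : ℕ
heapBase = 48
varCount = 36

by≤ : ∀ {a b} {_ : T (a ≤ᵇ b)} → a ≤ b
by≤ {a} {b} {t} = ≤ᵇ⇒≤ a b t

by< : ∀ {a b} {_ : T (a <ᵇ b)} → a < b
by< {a} {b} {t} = <ᵇ⇒< a b t

div-mul≤ : ∀ x y → apply div x y * y ≤ x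
div-mul≤ x zero    = z≤n
div-mul≤ x (suc y) = m/n*n≤m x (suc y)

-- Program logic for total correctness with time bounds

module Rules (B : ℕ) where
  open Bounds heapBase B public

  WP : Stmt → ℕ → (Store → Set) → Store → Set
  WP s c Q σ = ∃[ σ′ ] ∃[ c′ ] (Exec s σ σ′ c′ × c′ ≤ c × Q σ′)

  wp-seq : ∀ {s t c c′ Q Q′ σ} → WP s c Q σ → (∀ {σ′} → Q σ′ → WP t c′ Q′ σ′) → WP (s ⨾ t) (c + c′) Q′ σ
  wp-seq (σ₁ , c₁ , p , le , q) k =
    let σ₂ , c₂ , p₂ , le₂ , q₂ = k q in σ₂ , c₁ + c₂ , seq p p₂ , +-mono-≤ le le₂ , q₂

  wp-weaken : ∀ {s c c′ Q Q′ σ} → c ≤ c′ → (∀ {σ′} → Q σ′ → Q′ σ′) → WP s c Q σ → WP s c′ Q′ σ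
  wp-weaken le f (σ′ , d , p , d≤ , q) = σ′ , d , p , ≤-trans d≤ le , f q

  wp-assign : ∀ {x e σ} → BoundE e σ → WP (x := e) (timeE e + 2) (_≡ ⟪ V σ [ x ≔ eval e σ ] , H σ ⟫) σ
  wp-assign b = _ , _ , assign b , ≤-refl , refl

  -- A frame condition on the syntax. For a concrete statement and register it reduces to a product
  -- of unit types, so that `_` proves it. `KeepsBelow` and `HeapFree` are used in the same way.
  Untouched : ℕ → Stmt → Set
  Untouched y skip        = ⊤
  Untouched y (x := e)    = T (not (x ≡ᵇ y))
  Untouched y (put a e)   = ⊤
  Untouched y (s ⨾ t)     = Untouched y s × Untouched y t
  Untouched y (ifn e s t) = Untouched y s × Untouched y t
  Untouched y (loop x s)  = T (not (x ≡ᵇ y)) × Untouched y s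

  upd-untouched : ∀ (M : Memory) x v y → T (not (x ≡ᵇ y)) → (M [ x ≔ v ]) y ≡ M y
  upd-untouched M x v y t with x ≡ᵇ y
  ... | false = refl

  untouched : ∀ {s y σ σ′ c} → Exec s σ σ′ c → Untouched y s → V σ′ y ≡ V σ y
  untouched skip u = refl
  untouched {y = y} (assign {x} {e} {σ} _) u = upd-untouched (V σ) x (eval e σ) y u
  untouched (put _ _ _) u = refl
  untouched (seq p q) (u , v) = trans (untouched q v) (untouched p u)
  untouched (ifT _ _ p) (u , v) = untouched p u
  untouched (ifF _ _ p) (u , v) = untouched p v
  untouched (done _) u = refl
  untouched {y = y} (again {x} {σ = σ} {j = j} _ p q) (u , v) =
    trans (untouched q (u , v)) (trans (untouched p v) (upd-untouched (V σ) x j y u))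

  wp-untouched : ∀ {s c Q σ} y → Untouched y s → WP s c Q σ → WP s c (λ σ′ → Q σ′ × V σ′ y ≡ V σ y) σ
  wp-untouched y u (σ′ , c′ , p , le , q) = σ′ , c′ , p , le , q , untouched p u

  HeapFree : Stmt → Set
  HeapFree skip        = ⊤
  HeapFree (x := e)    = ⊤
  HeapFree (put a e)   = ⊥
  HeapFree (s ⨾ t)     = HeapFree s × HeapFree t
  HeapFree (ifn e s t) = HeapFree s × HeapFree t
  HeapFree (loop x s)  = HeapFree s

  heapFree : ∀ {s σ σ′ c} → Exec s σ σ′ c → HeapFree s → H σ′ ≡ H σ
  heapFree skip u = refl
  heapFree (assign _) u = refl
  heapFree (seq p q) (u , v) = trans (heapFree q v) (heapFree p u)
  heapFree (ifT _ _ p) (u , v) = heapFree p u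
  heapFree (ifF _ _ p) (u , v) = heapFree p v
  heapFree (done _) u = refl
  heapFree (again _ p q) u = trans (heapFree q u) (heapFree p u)

  wp-heapFree : ∀ {s c Q σ} → HeapFree s → WP s c Q σ → WP s c (λ σ′ → Q σ′ × H σ′ ≡ H σ) σ
  wp-heapFree u (σ′ , c′ , p , le , q) = σ′ , c′ , p , le , q , heapFree p u

  wp-below : ∀ {s c Q σ} m → KeepsBelow m s → WP s c Q σ →
             WP s c (λ σ′ → Q σ′ × (∀ y → y < m → V σ′ y ≡ V σ y)) σ
  wp-below m u (σ′ , c′ , p , le , q) = σ′ , c′ , p , le , q , λ y → keepsBelow p u

  -- The invariant is indexed by the number of rounds that are left. Each round adds five steps for
  -- the test, the decrement and the jump back; the last test adds one.
  wp-loop : ∀ {x s c} (I : ℕ → Store → Set) N → Untouched x s →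
    (∀ {j σ} → j < N → I (suc j) σ → WP s c (I j) ⟪ V σ [ x ≔ j ] , H σ ⟫) →
    ∀ {σ} → V σ x ≡ N → I N σ → WP (loop x s) (N * (c + 5) + 1) (I 0) σ
  wp-loop I zero u body e i = _ , _ , done e , ≤-refl , i
  wp-loop {x} {s} {c} I (suc N) u body {σ} e i =
    let σ₁ , c₁ , p₁ , le₁ , i₁ = body ≤-refl i
        σ₂ , c₂ , p₂ , le₂ , i₂ = wp-loop I N u (λ j< → body (m<n⇒m<1+n j<))
                                     (trans (untouched p₁ u) (upd-same (V σ) x N)) i₁
    in σ₂ , _ , again e p₁ p₂ ,
       ≤-trans (≤-reflexive (regroup c₁ c₂))
         (≤-trans (+-mono-≤ (+-monoˡ-≤ 5 le₁) le₂) (≤-reflexive (sym (+-assoc (c + 5) (N * (c + 5)) 1)))) , i₂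
    where
    regroup : ∀ a b → 3 + (a + (2 + b)) ≡ a + 5 + b
    regroup = solve-∀

v : ℕ → Expr
v = var

_mod_ : Expr → Expr → Expr
e mod m = e ⊖ e ⊘ m ⊗ m
infixl 7 _mod_

-- Registers: 0 n (finally the answer), 1 k, 2 r, 3 packed matrix cells, 4 R + 1, 5 Q,
-- 6 S = (R + 1)^(2 Q + 1), 7 number Γ of strings, 8 P, 9 length 2 F of the strings, heap addresses
-- 10 of the matrix, 11 of the colouring, 12 of the dynamic programming table, 13 size of that table,
-- 14 answer so far, 15 pair (a , string), 16 a, 17 string, 18 vertex, 19 hash value, 20 position,
-- 21 width and 22 offset of the cursor, 25 table index, split into 26 vertex, 27 count vector and
-- 28 layer; a layer x treats walks of k ∸ x edges.
emitS advanceS doubleS halveS decodeS colourS scanS transS startS cellS mainS : Stmt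
emitS    = ifn (v 20 ⊖ v 19) skip (ifn (v 6 ⊖ v 22) (22 := v 22 ⊗ v 4) skip)
advanceS = ifn (v 8 ⊕ v 8 ⊖ v 20) (20 := v 20 ⊕ v 21) skip
doubleS  = ifn (v 8 ⊖ v 21) (21 := v 21 ⊕ v 21) skip
halveS   = 21 := v 21 ⊘ lit 2
decodeS  = 24 := v 32 mod lit 4 ⨾ 32 := v 32 ⊘ lit 4 ⨾
           ifn (v 24) (ifn (v 24 ⊖ lit 1) (ifn (v 24 ⊖ lit 2) emitS advanceS) doubleS) halveS
colourS  = 19 := (v 16 ⊗ v 18) mod v 8 ⨾ 20 := lit 0 ⨾ 21 := v 0 ⨾ 22 := lit 1 ⨾
           32 := v 17 ⨾ 23 := v 9 ⨾ loop 23 decodeS ⨾ put (v 11 ⊕ v 18) (v 22)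
scanS    = ifn (get (v 10 ⊕ (v 26 ⊗ v 0 ⊕ v 31)))
             (ifn (get (v 12 ⊕ (((v 28 ⊕ lit 1) ⊗ v 6 ⊕ v 24) ⊗ v 0 ⊕ v 31))) (30 := lit 1) skip) skip
transS   = 24 := v 27 ⊘ v 29 ⨾
           ifn (v 24 mod v 4) (24 := v 27 ⊖ v 29 ⨾ 31 := v 0 ⨾ loop 31 scanS) skip
startS   = ifn ((v 27 ⊖ v 29) ⊕ (v 29 ⊖ v 27)) skip (30 := lit 1)
cellS    = 26 := v 25 mod v 0 ⨾ 28 := v 25 ⊘ v 0 ⊘ v 6 ⨾ 27 := v 25 ⊘ v 0 ⊖ v 28 ⊗ v 6 ⨾
           29 := get (v 11 ⊕ v 26) ⨾ 30 := lit 0 ⨾ ifn (v 1 ⊖ v 28) transS startS ⨾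
           put (v 12 ⊕ v 25) (v 30) ⨾ ifn (v 28) skip (ifn (v 30) (14 := lit 1) skip)
mainS    = 16 := v 15 ⊘ v 7 ⨾ 17 := v 15 ⊖ v 16 ⊗ v 7 ⨾ 18 := v 0 ⨾ loop 18 colourS ⨾
           25 := v 13 ⨾ loop 25 cellS

-- The double subtraction in powersS is min r (k + 1).
copyS powersS setupS programS : Stmt
copyS    = 10 := v 0 ⊗ v 0 ⨾ put (v 10) (lit 0) ⨾
           23 := lit 44 ⨾ loop 23 (put (v 10 ⊕ (v 23 ⊕ lit 1)) (v 3 mod lit 2) ⨾ 3 := v 3 ⊘ lit 2) ⨾
           23 := v 10 ⊖ lit 45 ⨾ loop 23 (put (v 10 ⊕ (v 23 ⊕ lit 45)) (get (v 23)))
powersS  = 4 := v 2 ⊖ (v 2 ⊖ (v 1 ⊕ lit 1)) ⊕ lit 1 ⨾ 5 := v 1 ⊘ v 2 ⊕ lit 1 ⨾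
           6 := lit 1 ⨾ 23 := v 5 ⊕ v 5 ⊕ lit 1 ⨾ loop 23 (6 := v 6 ⊗ v 4) ⨾
           9 := (v 1 ⊕ lit 1) ⊗ (v 1 ⊕ lit 1) ⊗ (v 1 ⊕ lit 1) ⊗ lit 128 ⨾
           7 := (v 9 ⊕ v 9) ⊗ (v 9 ⊕ v 9) ⨾ 23 := v 5 ⊗ lit 6 ⨾
           loop 23 (7 := v 7 ⊗ (v 4 ⊖ lit 1 ⊕ (v 4 ⊖ lit 1))) ⨾ 23 := v 5 ⊗ lit 19 ⨾
           loop 23 (7 := v 7 ⊗ lit 64)
setupS   = 8 := v 5 ⊗ v 9 ⊗ v 0 ⨾ 9 := v 9 ⊕ v 9 ⨾ 11 := v 10 ⊕ v 10 ⊕ lit 48 ⨾ 12 := v 11 ⊕ v 0 ⨾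
           13 := (v 1 ⊕ lit 1) ⊗ v 6 ⊗ v 0 ⨾ 14 := lit 0 ⨾ 15 := v 8 ⊗ v 7
programS = copyS ⨾ powersS ⨾ setupS ⨾ loop 15 mainS ⨾ 0 := v 14

-- Execution of the moves on the machine

toOp : ℕ → Op
toOp 0 = halve
toOp 1 = double
toOp 2 = advance
toOp _ = emit

decode : ℕ → ℕ → List Op
decode zero    g = []
decode (suc m) g = toOp (g % 4) ∷ decode m (g / 4)

module Machine (B n k r R Q S Γ P F₂ A O Tb tot : ℕ) where
  open Rules B
  open Ops P S R

  -- The registers that stay constant throughout the search. Register 3 is left out because
  -- unpacking the matrix consumes its value.
  ρ : ℕ → ℕ
  ρ 0  = n
  ρ 1  = k
  ρ 2  = r
  ρ 4  = suc R
  ρ 5  = Q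
  ρ 6  = S
  ρ 7  = Γ
  ρ 8  = P
  ρ 9  = F₂
  ρ 10 = A
  ρ 11 = O
  ρ 12 = Tb
  ρ 13 = tot
  ρ _  = 0

  Fixed : Store → Set
  Fixed σ = ∀ y → y < 14 → T (not (y ≡ᵇ 3)) → V σ y ≡ ρ y

  fixed-below : ∀ {σ σ′} → Fixed σ → (∀ y → y < 14 → V σ′ y ≡ V σ y) → Fixed σ′
  fixed-below f e y y< t = trans (e y y<) (f y y< t)

  at : ∀ {σ} → Fixed σ → ∀ y {_ : T (y <ᵇ 14)} {_ : T (not (y ≡ᵇ 3))} → V σ y ≡ ρ y
  at f y {t} {u} = f y (<ᵇ⇒< y 14 t) u

  fixed-upd : ∀ {σ} → Fixed σ → ∀ x w {_ : T (13 <ᵇ x)} → Fixed ⟪ V σ [ x ≔ w ] , H σ ⟫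
  fixed-upd {σ} f x w {t} y y< u =
    trans (upd-other (V σ) x w y (λ e → <⇒≱ y< (subst (14 ≤_) e (<ᵇ⇒< 13 x t)))) (f y y< u)

  cur : Store → Cursor
  cur σ = cursor (V σ 20) (V σ 21) (V σ 22)

  -- The consequence of the guards for arbitrary strings: a width below `P` may be doubled once
  -- more, a position below 2 P may advance by a width up to 2 P, and an offset below `S` may gain
  -- one more factor.
  record CursorBounds (σ : Store) : Set where
    field
      pos≤    : V σ 20 ≤ P * 4
      width≤  : V σ 21 ≤ P * 2
      offset≤ : V σ 22 ≤ S * suc R
      guess≤  : V σ 32 ≤ B
  open CursorBounds

  record Sizes : Set where
    field
      lits  : 524288 ≤ B
      P*4≤  : P * 4 ≤ B
      SR≤   : S * suc R * 2 ≤ B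
      P*n≤  : P * n ≤ B
      PΓ≤   : P * Γ ≤ B
      heap≤ : 48 + (Tb + tot) ≤ B
      n>0   : 0 < n
      P>0   : 0 < P
      S>0   : 0 < S
      Γ>0   : 0 < Γ
      n≤P   : n ≤ P

  module Correct (sz : Sizes) where
    open Sizes sz

    small : ∀ {a} {_ : T (a ≤ᵇ 524288)} → a ≤ B
    small {a} {t} = ≤-trans (≤ᵇ⇒≤ a 524288 t) lits

    double-P : P + P ≤ P * 2
    double-P = ≤-reflexive (trans (cong (P +_) (sym (+-identityʳ P))) (*-comm 2 P))

    decode-step : ∀ {σ} → Fixed σ → CursorBounds σ →
      WP decodeS 60 (λ σ′ → cur σ′ ≡ opStep (V σ 19) (toOp (V σ 32 % 4)) (cur σ) × V σ′ 32 ≡ V σ 32 / 4 × CursorBounds σ′) σ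
    decode-step {σ} f cb = body (V σ 32 % 4) refl
      where
      g = V σ 32
      d≡ : g ∸ g / 4 * 4 ≡ g % 4
      d≡ = sym (m%n≡m∸m/n*n g 4)
      σ₁ : Store
      σ₁ = ⟪ (V σ [ 24 ≔ g ∸ g / 4 * 4 ]) [ 32 ≔ g / 4 ] , H σ ⟫
      Post : Op → Store → Set
      Post o σ′ = cur σ′ ≡ opStep (V σ 19) o (cur σ) × V σ′ 32 ≡ g / 4 × CursorBounds σ′
      cb₁ : CursorBounds σ₁
      cb₁ = record { pos≤ = pos≤ cb ; width≤ = width≤ cb ; offset≤ = offset≤ cb
                   ; guess≤ = ≤-trans (m/n≤m g 4) (guess≤ cb) }
      prefix : ∀ {s c o} → WP s c (Post o) σ₁ →
               WP (24 := v 32 mod lit 4 ⨾ 32 := v 32 ⊘ lit 4 ⨾ s) (12 + (7 + c)) (Post o) σ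
      prefix w = wp-seq {c = 12} (wp-weaken by≤ (λ q → q) (wp-assign (_ , (((_ , small , _) , small , ≤-trans (div-mul≤ g 4) (guess≤ cb)) , _))))
        λ { refl → wp-seq {c = 7} (wp-weaken by≤ (λ q → q) (wp-assign (_ , small , _))) λ { refl → w } }
      body : ∀ d → g % 4 ≡ d →
        WP decodeS 60 (λ σ′ → cur σ′ ≡ opStep (V σ 19) (toOp d) (cur σ) × V σ′ 32 ≡ g / 4 × CursorBounds σ′) σ
      body zero e = wp-weaken by≤ (λ q → q) (prefix {c = 10} {o = halve}
        (_ , _ , ifF _ (trans d≡ e) (assign (_ , small , _)) , by≤ , refl , refl ,
          record { pos≤ = pos≤ cb₁ ; width≤ = ≤-trans (m/n≤m (V σ 21) 2) (width≤ cb₁) ; offset≤ = offset≤ cb₁ ; guess≤ = guess≤ cb₁ }))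
      body (suc zero) e with V σ 21 <? P
      ... | yes w< = wp-weaken by≤ (λ q → q) (prefix {c = 30} {o = double}
        (_ , _ , ifT _ (λ z → contradiction (trans (sym e) (trans (sym d≡) z)) λ ())
                  (ifF (_ , small , _) (cong (_∸ 1) (trans d≡ e))
                    (ifT _ (λ z → m>n⇒m∸n≢0 (<-≤-trans w< (≤-reflexive (sym (at {σ} f 8)))) z)
                      (assign (_ , _ , ≤-trans w+w≤ (≤-trans (*-monoʳ-≤ P by≤) P*4≤))))) , by≤ ,
          cong (λ w → cursor (V σ 20) w (V σ 22)) (sym (if-true (<⇒<ᵇ w<))) , refl ,
          record { pos≤ = pos≤ cb₁ ; width≤ = w+w≤ ; offset≤ = offset≤ cb₁ ; guess≤ = guess≤ cb₁ }))
        where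
        w+w≤ : V σ 21 + V σ 21 ≤ P * 2
        w+w≤ = ≤-trans (+-mono-≤ (<⇒≤ w<) (<⇒≤ w<)) double-P
      ... | no w≮ = wp-weaken by≤ (λ q → q) (prefix {c = 30} {o = double}
        (_ , _ , ifT _ (λ z → contradiction (trans (sym e) (trans (sym d≡) z)) λ ())
                  (ifF (_ , small , _) (cong (_∸ 1) (trans d≡ e))
                    (ifF _ (m≤n⇒m∸n≡0 (≤-trans (≤-reflexive (at {σ} f 8)) (≮⇒≥ w≮))) skip)) , by≤ ,
          cong (λ w → cursor (V σ 20) w (V σ 22)) (sym (if-false (λ t → w≮ (<ᵇ⇒< _ _ t)))) , refl , cb₁))
      body (suc (suc zero)) e with V σ 20 <? P + P
      ... | yes p< = wp-weaken by≤ (λ q → q) (prefix {c = 41} {o = advance}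
        (_ , _ , ifT _ (λ z → contradiction (trans (sym e) (trans (sym d≡) z)) λ ())
                  (ifT (_ , small , _) (λ z → contradiction (trans (sym (cong (_∸ 1) (trans d≡ e))) z) λ ())
                    (ifF (_ , small , _) (cong (_∸ 2) (trans d≡ e))
                      (ifT ((_ , _ , ≤-trans (≤-reflexive (cong₂ _+_ (at {σ} f 8) (at {σ} f 8))) (≤-trans double-P (≤-trans (*-monoʳ-≤ P by≤) P*4≤))) , _)
                        (λ z → m>n⇒m∸n≢0 (<-≤-trans p< (≤-reflexive (sym (cong₂ _+_ (at {σ} f 8) (at {σ} f 8))))) z)
                        (assign (_ , _ , ≤-trans p+w≤ P*4≤))))) , by≤ ,
          cong (λ p → cursor p (V σ 21) (V σ 22)) (sym (if-true (<⇒<ᵇ p<))) , refl ,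
          record { pos≤ = p+w≤ ; width≤ = width≤ cb₁ ; offset≤ = offset≤ cb₁ ; guess≤ = guess≤ cb₁ }))
        where
        p+w≤ : V σ 20 + V σ 21 ≤ P * 4
        p+w≤ = ≤-trans (+-mono-≤ (≤-trans (<⇒≤ p<) double-P) (width≤ cb)) (≤-reflexive (sym (*-distribˡ-+ P 2 2)))
      ... | no p≮ = wp-weaken by≤ (λ q → q) (prefix {c = 41} {o = advance}
        (_ , _ , ifT _ (λ z → contradiction (trans (sym e) (trans (sym d≡) z)) λ ())
                  (ifT (_ , small , _) (λ z → contradiction (trans (sym (cong (_∸ 1) (trans d≡ e))) z) λ ())
                    (ifF (_ , small , _) (cong (_∸ 2) (trans d≡ e))
                      (ifF ((_ , _ , ≤-trans (≤-reflexive (cong₂ _+_ (at {σ} f 8) (at {σ} f 8))) (≤-trans double-P (≤-trans (*-monoʳ-≤ P by≤) P*4≤))) , _)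
                        (m≤n⇒m∸n≡0 (≤-trans (≤-reflexive (cong₂ _+_ (at {σ} f 8) (at {σ} f 8))) (≮⇒≥ p≮))) skip))) , by≤ ,
          cong (λ p → cursor p (V σ 21) (V σ 22)) (sym (if-false (λ t → p≮ (<ᵇ⇒< _ _ t)))) , refl , cb₁))
      body (suc (suc (suc d))) e = wp-weaken by≤ (λ q → q) (prefix {c = 41} {o = emit} emits)
        where
        emitting : ∀ {c} → WP emitS c (Post emit) σ₁ →
          WP (ifn (v 24) (ifn (v 24 ⊖ lit 1) (ifn (v 24 ⊖ lit 2) emitS advanceS) doubleS) halveS) (2 + suc (4 + suc (4 + suc (c + 2) + 2) + 2)) (Post emit) σ₁
        emitting (σ′ , c′ , p , le , q) = σ′ , _ ,
          ifT _ (λ z → contradiction (trans (sym e) (trans (sym d≡) z)) λ ())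
            (ifT (_ , small , _) (λ z → contradiction (trans (sym (cong (_∸ 1) (trans d≡ e))) z) λ ())
              (ifT (_ , small , _) (λ z → contradiction (trans (sym (cong (_∸ 2) (trans d≡ e))) z) λ ()) p)) ,
          +-monoʳ-≤ 3 (+-monoˡ-≤ 2 (+-monoʳ-≤ 5 (+-monoˡ-≤ 2 (+-monoʳ-≤ 5 (+-monoˡ-≤ 2 le))))) , q
        emits : WP (ifn (v 24) (ifn (v 24 ⊖ lit 1) (ifn (v 24 ⊖ lit 2) emitS advanceS) doubleS) halveS) 41 (Post emit) σ₁
        emits with V σ 20 ≤? V σ 19
        ... | no p≰ = wp-weaken by≤ (λ q → q) (emitting {c = 8}
          (_ , _ , ifT _ (λ z → p≰ (m∸n≡0⇒m≤n z)) skip , by≤ ,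
            cong (cursor (V σ 20) (V σ 21)) (sym (if-false (λ t → p≰ (≤ᵇ⇒≤ _ _ t)))) , refl , cb₁))
        ... | yes p≤ with V σ 22 <? S
        ...   | no o≮ = wp-weaken by≤ (λ q → q) (emitting {c = 12}
          (_ , _ , ifF _ (m≤n⇒m∸n≡0 p≤) (ifF _ (m≤n⇒m∸n≡0 (≤-trans (≤-reflexive (at {σ} f 6)) (≮⇒≥ o≮))) skip) , by≤ ,
            cong (cursor (V σ 20) (V σ 21)) (sym (trans (if-true (≤⇒≤ᵇ p≤)) (if-false (λ t → o≮ (<ᵇ⇒< _ _ t))))) , refl , cb₁))
        ...   | yes o< = wp-weaken by≤ (λ q → q) (emitting {c = 22}
          (_ , _ , ifF _ (m≤n⇒m∸n≡0 p≤)
                    (ifT _ (λ z → m>n⇒m∸n≢0 (<-≤-trans o< (≤-reflexive (sym (at {σ} f 6)))) z)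
                      (assign (_ , _ , ≤-trans oR≤ (≤-trans (m≤m*n (S * suc R) 2) SR≤)))) , by≤ ,
            cong (cursor (V σ 20) (V σ 21)) (trans (cong (V σ 22 *_) (at {σ} f 4))
              (sym (trans (if-true (≤⇒≤ᵇ p≤)) (if-true (<⇒<ᵇ o<))))) , refl ,
            record { pos≤ = pos≤ cb₁ ; width≤ = width≤ cb₁ ; offset≤ = oR≤ ; guess≤ = guess≤ cb₁ }))
          where
          oR≤ : V σ 22 * V σ 4 ≤ S * suc R
          oR≤ = *-mono-≤ (<⇒≤ o<) (≤-reflexive (at {σ} f 4))

-- Computation of the colouring for one guess

module Colouring (B n k r R Q S Γ P F₂ A O Tb tot : ℕ)
                 (sz : Machine.Sizes B n k r R Q S Γ P F₂ A O Tb tot) where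
  open Machine B n k r R Q S Γ P F₂ A O Tb tot
  open Correct sz
  open Machine.Sizes sz
  open Rules B
  open Ops P S R

  hash : ℕ → ℕ → ℕ
  hash a x = a * x ∸ apply div (a * x) P * P

  offsets : ℕ → ℕ → ℕ → ℕ
  offsets a g x = offset (runOps (hash a x) (decode F₂ g) (cursor 0 n 1))

  decode-loop : ∀ {σ} N → V σ 23 ≡ N → Fixed σ → CursorBounds σ →
    WP (loop 23 decodeS) (N * 65 + 1)
       (λ σ′ → V σ′ 22 ≡ offset (runOps (V σ 19) (decode N (V σ 32)) (cur σ)) × CursorBounds σ′) σ
  decode-loop {σ₀} N e f cb =
    wp-weaken ≤-refl (λ (_ , cb , _ , eq) → cong offset eq , cb)
      (wp-loop I N _ (λ {j} {σ} → body) e (f , cb , refl , refl))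
    where
    z = V σ₀ 19
    I : ℕ → Store → Set
    I j σ = Fixed σ × CursorBounds σ × V σ 19 ≡ z ×
            runOps z (decode j (V σ 32)) (cur σ) ≡ runOps z (decode N (V σ₀ 32)) (cur σ₀)
    body : ∀ {j σ} → j < N → I (suc j) σ → WP decodeS 60 (I j) ⟪ V σ [ 23 ≔ j ] , H σ ⟫
    body {j} {σ} j< (f , cb , z≡ , eq) =
      wp-weaken ≤-refl
        (λ {σ′} (((c≡ , g≡ , cb′) , keep) , keep19) →
           fixed-below {⟪ V σ [ 23 ≔ j ] , H σ ⟫} {σ′} (fixed-upd {σ} f 23 j) keep , cb′ , trans keep19 z≡ ,
           trans (cong₂ (λ g c → runOps z (decode j g) c) g≡ (trans c≡ (cong (λ z → opStep z _ (cur σ)) z≡))) eq)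
        (wp-untouched 19 _ (wp-below 14 _
          (decode-step {⟪ V σ [ 23 ≔ j ] , H σ ⟫} (fixed-upd {σ} f 23 j)
             record { pos≤ = pos≤ cb ; width≤ = width≤ cb ; offset≤ = offset≤ cb ; guess≤ = guess≤ cb })))
      where open CursorBounds

  colourTime : ℕ
  colourTime = 19 + (3 + (4 + (3 + (4 + (4 + ((F₂ * 65 + 1) + 10))))))

  colour-correct : ∀ {σ a g x} → Fixed σ → V σ 16 ≡ a → V σ 17 ≡ g → V σ 18 ≡ x →
    a * x ≤ B → g ≤ B → 48 + (O + x) ≤ B →
    WP colourS colourTime (λ σ′ → H σ′ ≡ H σ [ O + x ≔ offsets a g x ]) σ
  colour-correct {σ} {a} {g} {x} f refl refl refl ax≤ g≤ Ox≤ =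
    wp-seq (wp-assign ((_ , _ , ax≤) , ((( _ , _ , ax≤) , _ , _) , _ , ≤-trans (div-mul≤ (a * x) (V σ 8)) ax≤) , _)) λ { refl →
    wp-seq (wp-assign small) λ { refl →
    wp-seq (wp-assign _) λ { refl →
    wp-seq (wp-assign small) λ { refl →
    wp-seq (wp-assign _) λ { refl →
    wp-seq (wp-assign _) λ { refl →
    wp-seq (wp-heapFree _ (wp-below 19 _ (decode-loop {τ} F₂ (at {σ} f 9) fτ cbτ))) λ {σ′} → λ (((o≡ , cb) , keep) , h≡) →
      let O≡ : V σ′ 11 + V σ′ 18 ≡ O + x
          O≡ = cong₂ _+_ (trans (keep 11 by<) (at {σ} f 11)) (keep 18 by<)
      in ⟪ V σ′ , H σ′ [ V σ′ 11 + V σ′ 18 ≔ V σ′ 22 ] ⟫ , 10 ,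
         put (_ , _ , ≤-trans (≤-reflexive O≡) (≤-trans (m≤n+m (O + x) 48) Ox≤)) _ (≤-trans (≤-reflexive (cong (48 +_) O≡)) Ox≤) ,
         ≤-refl ,
         trans (cong₂ (λ h o → h [ V σ′ 11 + V σ′ 18 ≔ o ]) h≡ o≡)
           (cong₂ (λ y o → H σ [ y ≔ o ]) O≡
             (cong₂ (λ z m → offset (runOps z (decode F₂ g) (cursor 0 m 1))) z≡ (at {σ} f 0))) }}}}}}
    where
    z₀ = a * x ∸ apply div (a * x) (V σ 8) * V σ 8
    V₁ = V σ [ 19 ≔ z₀ ]
    V₂ = V₁ [ 20 ≔ 0 ]
    V₃ = V₂ [ 21 ≔ V σ 0 ]
    V₄ = V₃ [ 22 ≔ 1 ]
    V₅ = V₄ [ 32 ≔ g ]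
    τ : Store
    τ = ⟪ V₅ [ 23 ≔ V σ 9 ] , H σ ⟫
    z≡ : z₀ ≡ hash a x
    z≡ = cong (λ p → a * x ∸ apply div (a * x) p * p) (at {σ} f 8)
    fτ : Fixed τ
    fτ = fixed-upd {⟪ V₅ , H σ ⟫} (fixed-upd {⟪ V₄ , H σ ⟫} (fixed-upd {⟪ V₃ , H σ ⟫} (fixed-upd {⟪ V₂ , H σ ⟫}
           (fixed-upd {⟪ V₁ , H σ ⟫} (fixed-upd {σ} f 19 z₀) 20 0) 21 (V σ 0)) 22 1) 32 g) 23 (V σ 9)
    cbτ : CursorBounds τ
    cbτ = record { pos≤ = z≤n
                 ; width≤ = ≤-trans (≤-reflexive (at {σ} f 0)) (≤-trans n≤P (m≤m*n P 2))
                 ; offset≤ = *-mono-≤ {1} {S} {1} S>0 (s≤s z≤n) ; guess≤ = g≤ }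

  record ColourPost (a g : ℕ) (σ σ′ : Store) : Set where
    field
      fixed : Fixed σ′
      keeps : ∀ y → y < 18 → V σ′ y ≡ V σ y
      lower : ∀ i → i < O → H σ′ i ≡ H σ i
      table : ∀ x → x < n → H σ′ (O + x) ≡ offsets a g x

  colour-loop : ∀ {σ a g} → Fixed σ → V σ 16 ≡ a → V σ 17 ≡ g → V σ 18 ≡ n →
    a * n ≤ B → g ≤ B → 48 + (O + n) ≤ B →
    WP (loop 18 colourS) (n * (colourTime + 5) + 1) (ColourPost a g σ) σ
  colour-loop {σ₀} {a} {g} f a≡ g≡ e an≤ g≤ On≤ =
    wp-weaken ≤-refl
      (λ (((f′ , low , tab) , _) , keep) → record { fixed = f′ ; keeps = keep ; lower = low ; table = λ x x< → tab x z≤n x< })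
      (wp-below 18 _ (wp-loop J n _ body e ((f , (λ _ _ → refl) , (λ x n≤ x< → contradiction x< (≤⇒≯ n≤))) , a≡ , g≡)))
    where
    I : ℕ → Store → Set
    I j σ = Fixed σ × (∀ i → i < O → H σ i ≡ H σ₀ i) × (∀ x → j ≤ x → x < n → H σ (O + x) ≡ offsets a g x)
    J : ℕ → Store → Set
    J j σ = I j σ × V σ 16 ≡ a × V σ 17 ≡ g
    body : ∀ {j σ} → j < n → J (suc j) σ → WP colourS colourTime (J j) ⟪ V σ [ 18 ≔ j ] , H σ ⟫
    body {j} {σ} j< ((f , low , tab) , a≡ , g≡) =
      wp-weaken ≤-refl (λ {σ′} (h≡ , keep) →
          (fixed-below {⟪ V σ [ 18 ≔ j ] , H σ ⟫} {σ′} (fixed-upd {σ} f 18 j) (λ y y< → keep y (≤-trans y< by≤)) ,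
           (λ i i< → trans (cong (λ h → h i) h≡)
             (trans (upd-other (H σ) (O + j) _ i (λ e → <⇒≱ i< (subst (O ≤_) e (m≤m+n O j)))) (low i i<))) ,
           (λ x j≤ x< → trans (cong (λ h → h (O + x)) h≡) (written σ x j≤ x< tab))) ,
          trans (keep 16 by<) a≡ , trans (keep 17 by<) g≡)
        (wp-below 19 _ (colour-correct {⟪ V σ [ 18 ≔ j ] , H σ ⟫} (fixed-upd {σ} f 18 j) a≡ g≡ refl
           (≤-trans (*-monoʳ-≤ a (<⇒≤ j<)) an≤) g≤ (≤-trans (+-monoʳ-≤ 48 (+-monoʳ-≤ O (<⇒≤ j<))) On≤)))
      where
      written : ∀ σ x → j ≤ x → x < n → (∀ x → suc j ≤ x → x < n → H σ (O + x) ≡ offsets a g x) →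
                (H σ [ O + j ≔ offsets a g j ]) (O + x) ≡ offsets a g x
      written σ x j≤ x< tab with j ≟ x
      ... | yes refl = upd-same (H σ) (O + j) _
      ... | no j≢x = trans (upd-other (H σ) (O + j) _ (O + x) (λ e → j≢x (+-cancelˡ-≡ O j x e))) (tab x (≤∧≢⇒< j≤ j≢x) x<)

-- The dynamic programming table

remainder : ℕ → ℕ → ℕ
remainder m d = m ∸ apply div m d * d

remainder-split : ∀ m d → remainder m d + apply div m d * d ≡ m
remainder-split m d = m∸n+n≡m (div-mul≤ m d)

remainder< : ∀ m {d} → 0 < d → remainder m d < d
remainder< m {suc d} _ = subst (_< suc d) (m%n≡m∸m/n*n m (suc d)) (m%n<n m (suc d))

division : ∀ q {u d} → u < d → apply div (q * d + u) d ≡ q × remainder (q * d + u) d ≡ u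
division q {u} {suc d} u< =
  let e , f = division-unique {suc d} {q = apply div m (suc d)} {q′ = q} (remainder< m (s≤s z≤n)) u<
                (trans (remainder-split m (suc d)) (+-comm (q * suc d) u))
  in f , e
  where m = q * suc d + u

apply-div< : ∀ m {d q} → 0 < d → m < q * d → apply div m d < q
apply-div< m {suc d} {q} _ m< = m<n*o⇒m/o<n {m} {q} {suc d} m<

module Table (B n k r R Q S Γ P F₂ A O Tb tot : ℕ)
             (sz : Machine.Sizes B n k r R Q S Γ P F₂ A O Tb tot)
             (A≡ : A ≡ n * n) (A+A≤O : A + A ≤ O) (Tb≡ : Tb ≡ O + n) (tot≡ : tot ≡ suc k * S * n)
             (cell off : ℕ → ℕ) (off≤ : ∀ x → off x ≤ S * suc R) where
  open Machine B n k r R Q S Γ P F₂ A O Tb tot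
  open Correct sz
  open Machine.Sizes sz
  open Rules B

  row layer code vertex : ℕ → ℕ
  row i    = apply div i n
  layer i  = apply div (row i) S
  code i   = remainder (row i) S
  vertex i = remainder i n

  index : ℕ → ℕ → ℕ → ℕ
  index x s u = (x * S + s) * n + u

  index-layer : ∀ x {s u} → s < S → u < n → layer (index x s u) ≡ x
  index-layer x {s} s< u< = trans (cong (λ i → apply div i S) (proj₁ (division (x * S + s) u<))) (proj₁ (division x s<))

  index-code : ∀ x {s u} → s < S → u < n → code (index x s u) ≡ s
  index-code x {s} s< u< = trans (cong (λ i → remainder i S) (proj₁ (division (x * S + s) u<))) (proj₂ (division x s<))

  index-vertex : ∀ x {s u} → u < n → vertex (index x s u) ≡ u
  index-vertex x {s} u< = proj₂ (division (x * S + s) u<)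

  index-split : ∀ i → index (layer i) (code i) (vertex i) ≡ i
  index-split i = trans (+-comm _ (vertex i))
    (trans (cong (λ w → vertex i + w * n) (trans (+-comm _ (code i)) (remainder-split (row i) S))) (remainder-split i n))

  vertex< : ∀ i → vertex i < n
  vertex< i = remainder< i n>0

  code< : ∀ i → code i < S
  code< i = remainder< (row i) S>0

  layer≤ : ∀ {i} → i < tot → layer i ≤ k
  layer≤ {i} i< = s≤s⁻¹ (apply-div< (row i) S>0 (apply-div< i n>0 (subst (i <_) tot≡ i<)))

  -- The layer is the leading part of the index and the table is filled from the top downwards, so
  -- every entry that a cell consults is already final.
  index-later : ∀ {i x s v} → layer i ≡ x → i < index (suc x) s v
  index-later {i} {x} {s} {v} refl = begin-strict
    i                                    ≡⟨ sym (index-split i) ⟩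
    (x * S + code i) * n + vertex i      <⟨ +-monoʳ-< ((x * S + code i) * n) (vertex< i) ⟩
    (x * S + code i) * n + n             ≡⟨ +-comm _ n ⟩
    suc (x * S + code i) * n             ≤⟨ *-monoˡ-≤ n (subst (_≤ suc x * S) (+-suc (x * S) (code i)) (subst (x * S + suc (code i) ≤_) (+-comm (x * S) S) (+-monoʳ-≤ (x * S) (code< i)))) ⟩
    suc x * S * n                        ≤⟨ *-monoˡ-≤ n (m≤m+n (suc x * S) s) ⟩
    (suc x * S + s) * n                  ≤⟨ m≤m+n _ v ⟩
    index (suc x) s v                    ∎
    where open ≤-Reasoning

  index< : ∀ {x s v} → x ≤ k → s < S → v < n → index x s v < tot
  index< {x} {s} {v} x≤ s< v< = begin-strict
    (x * S + s) * n + v    <⟨ +-monoʳ-< ((x * S + s) * n) v< ⟩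
    (x * S + s) * n + n    ≡⟨ +-comm _ n ⟩
    suc (x * S + s) * n    ≤⟨ *-monoˡ-≤ n (subst (_≤ suc x * S) (+-suc (x * S) s) (subst (x * S + suc s ≤_) (+-comm (x * S) S) (+-monoʳ-≤ (x * S) s<))) ⟩
    suc x * S * n          ≤⟨ *-monoˡ-≤ n (*-monoˡ-≤ S (s≤s x≤)) ⟩
    suc k * S * n          ≡⟨ sym tot≡ ⟩
    tot                    ∎
    where open ≤-Reasoning

  Walks : ℕ → ℕ → ℕ → Set
  Walks x s u = Reach n (suc R) cell off (k ∸ x) s u

  Entry : ℕ → ℕ → Set
  Entry i h = (h ≢ 0 → Walks (layer i) (code i) (vertex i)) × (Walks (layer i) (code i) (vertex i) → h ≢ 0)

  adjacent-cell : ∀ {u w} → u < n → w < n → u * n + w < A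
  adjacent-cell {u} {w} u< w< = begin-strict
    u * n + w    <⟨ +-monoʳ-< (u * n) w< ⟩
    u * n + n    ≡⟨ +-comm (u * n) n ⟩
    suc u * n    ≤⟨ *-monoˡ-≤ n u< ⟩
    n * n        ≡⟨ sym A≡ ⟩
    A            ∎
    where open ≤-Reasoning

  A≤Tb : A + A ≤ Tb
  A≤Tb = ≤-trans A+A≤O (≤-trans (m≤m+n O n) (≤-reflexive (sym Tb≡)))

  A+<Tb : ∀ {i} → i < A → A + i < Tb
  A+<Tb i< = <-≤-trans (+-monoʳ-< A i<) A≤Tb

  table≤ : ∀ {i} → i < tot → 48 + (Tb + i) ≤ B
  table≤ i< = ≤-trans (+-monoʳ-≤ 48 (+-monoʳ-≤ Tb (<⇒≤ i<))) heap≤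

  lower≤ : ∀ {i} → i < Tb → 48 + i ≤ B
  lower≤ i< = ≤-trans (+-monoʳ-≤ 48 (≤-trans (<⇒≤ i<) (m≤m+n Tb tot))) heap≤

  drop48 : ∀ {x} → 48 + x ≤ B → x ≤ B
  drop48 {x} le = ≤-trans (m≤n+m x 48) le

  module _ {σ₀ : Store} (f₀ : Fixed σ₀) {u s x : ℕ} (u< : u < n) (s< : s < S) (x< : x < k)
           (u≡ : V σ₀ 26 ≡ u) (s≡ : V σ₀ 24 ≡ s) (x≡ : V σ₀ 28 ≡ x) where

    Hit : ℕ → Set
    Hit w = H σ₀ (A + (u * n + w)) ≢ 0 × H σ₀ (Tb + index (suc x) s w) ≢ 0

    AddressBounds : (a b c d e j : ℕ) → Set
    AddressBounds a b c d e j =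
      b + 1 ≤ B × (b + 1) * c ≤ B × (b + 1) * c + d ≤ B × ((b + 1) * c + d) * e ≤ B ×
      ((b + 1) * c + d) * e + j ≤ B × a + (((b + 1) * c + d) * e + j) ≤ B

    -- As the factors `c` and `e` are positive, no partial result exceeds the final address; one
    -- bound on the address covers all of them.
    address-bounds : ∀ a b c d e j → 0 < c → 0 < e → 48 + (a + (((b + 1) * c + d) * e + j)) ≤ B →
                     AddressBounds a b c d e j
    address-bounds a b c d e j c>0 e>0 le =
      let l₆ = drop48 le
          l₅ = m+n≤o⇒n≤o a l₆
          l₄ = m+n≤o⇒m≤o (((b + 1) * c + d) * e) l₅
          l₃ = ≤-trans (m≤m*n ((b + 1) * c + d) e {{>-nonZero e>0}}) l₄
          l₂ = m+n≤o⇒m≤o ((b + 1) * c) l₃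
          l₁ = ≤-trans (m≤m*n (b + 1) c {{>-nonZero c>0}}) l₂
      in l₁ , l₂ , l₃ , l₄ , l₅ , l₆

    scan-step : ∀ {σ j} → j < n → (∀ y → y < 30 → V σ y ≡ V σ₀ y) → H σ ≡ H σ₀ →
      let σ′ = ⟪ V σ [ 31 ≔ j ] , H σ ⟫ in
      WP scanS 60 (λ τ → (V τ 30 ≢ 0 → V σ 30 ≢ 0 ⊎ Hit j) × (V σ 30 ≢ 0 ⊎ Hit j → V τ 30 ≢ 0)) σ′
    scan-step {σ} {j} j< keep h≡ with H σ₀ (A + (u * n + j)) ≟ 0 | H σ₀ (Tb + index (suc x) s j) ≟ 0
    ... | adjacent? | reached? = case-split adjacent? reached?
      where
      Post : Store → Set
      Post τ = (V τ 30 ≢ 0 → V σ 30 ≢ 0 ⊎ Hit j) × (V σ 30 ≢ 0 ⊎ Hit j → V τ 30 ≢ 0)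
      n≡ = trans (keep 0 by<) (at {σ₀} f₀ 0)
      S≡ = trans (keep 6 by<) (at {σ₀} f₀ 6)
      a₁≡ : V σ 10 + (V σ 26 * V σ 0 + j) ≡ A + (u * n + j)
      a₁≡ = cong₂ (λ a b → a + (b + j)) (trans (keep 10 by<) (at {σ₀} f₀ 10)) (cong₂ _*_ (trans (keep 26 by<) u≡) n≡)
      a₂≡ : V σ 12 + (((V σ 28 + 1) * V σ 6 + V σ 24) * V σ 0 + j) ≡ Tb + index (suc x) s j
      a₂≡ = cong₂ (λ a b → a + (b + j)) (trans (keep 12 by<) (at {σ₀} f₀ 12))
              (cong₂ _*_ (cong₂ _+_ (cong₂ _*_ (trans (cong (_+ 1) (trans (keep 28 by<) x≡)) (+-comm x 1)) S≡) (trans (keep 24 by<) s≡)) n≡)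
      l₁ : 48 + (V σ 10 + (V σ 26 * V σ 0 + j)) ≤ B
      l₁ = ≤-trans (≤-reflexive (cong (48 +_) a₁≡)) (lower≤ (A+<Tb (adjacent-cell u< j<)))
      b₁ = (_ , ((_ , _ , m+n≤o⇒m≤o (V σ 26 * V σ 0) (m+n≤o⇒n≤o (V σ 10) (drop48 l₁))) , _ , m+n≤o⇒n≤o (V σ 10) (drop48 l₁)) , drop48 l₁) , l₁
      l₂ : 48 + (V σ 12 + (((V σ 28 + 1) * V σ 6 + V σ 24) * V σ 0 + j)) ≤ B
      l₂ = ≤-trans (≤-reflexive (cong (48 +_) a₂≡)) (table≤ (index< x< s< j<))
      c₂ = address-bounds (V σ 12) (V σ 28) (V σ 6) (V σ 24) (V σ 0) j (subst (0 <_) (sym S≡) S>0) (subst (0 <_) (sym n≡) n>0) l₂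
      b₂ = let p , q , p′ , q′ , p″ , q″ = c₂ in
           (_ , (((((_ , small , p) , _ , q) , _ , p′) , _ , q′) , _ , p″) , q″) , l₂
      e₁ = cong₂ (λ h i → h i) h≡ a₁≡
      e₂ = cong₂ (λ h i → h i) h≡ a₂≡
      case-split : Dec (H σ₀ (A + (u * n + j)) ≡ 0) → Dec (H σ₀ (Tb + index (suc x) s j) ≡ 0) →
                   WP scanS 60 Post ⟪ V σ [ 31 ≔ j ] , H σ ⟫
      case-split (yes z) _ = _ , _ , ifF b₁ (trans e₁ z) skip , by≤ , inj₁ ,
        λ { (inj₁ p) → p ; (inj₂ (a , _)) → contradiction z a }
      case-split (no nz) (yes z) = _ , _ , ifT b₁ (λ e → nz (trans (sym e₁) e)) (ifF b₂ (trans e₂ z) skip) , by≤ , inj₁ ,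
        λ { (inj₁ p) → p ; (inj₂ (_ , a)) → contradiction z a }
      case-split (no nz) (no nz′) = _ , _ ,
        ifT b₁ (λ e → nz (trans (sym e₁) e)) (ifT b₂ (λ e → nz′ (trans (sym e₂) e)) (assign small)) , by≤ ,
        (λ _ → inj₂ (nz , nz′)) , λ _ ()

    scan : V σ₀ 31 ≡ n → V σ₀ 30 ≡ 0 →
      WP (loop 31 scanS) (n * 65 + 1)
         (λ τ → (V τ 30 ≢ 0 → ∃[ w ] (w < n × Hit w)) × (∀ w → w < n → Hit w → V τ 30 ≢ 0)) σ₀
    scan e z = wp-weaken ≤-refl (λ (_ , _ , p , q) → p , λ w w< → q w z≤n w<)
      (wp-loop I n _ body e ((λ _ _ → refl) , refl , (λ nz → contradiction z nz) , λ w n≤ w< → contradiction w< (≤⇒≯ n≤)))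
      where
      I : ℕ → Store → Set
      I j σ = (∀ y → y < 30 → V σ y ≡ V σ₀ y) × H σ ≡ H σ₀ ×
              (V σ 30 ≢ 0 → ∃[ w ] (w < n × Hit w)) × (∀ w → j ≤ w → w < n → Hit w → V σ 30 ≢ 0)
      body : ∀ {j σ} → j < n → I (suc j) σ → WP scanS 60 (I j) ⟪ V σ [ 31 ≔ j ] , H σ ⟫
      body {j} {σ} j< (keep , h≡ , p , q) =
        wp-weaken ≤-refl
          (λ (((p′ , q′) , keep′) , h≡′) →
            (λ y y< → trans (keep′ y y<) (trans (upd-other (V σ) 31 j y (λ e → <⇒≱ (<-trans y< by<) (≤-reflexive e))) (keep y y<))) ,
            trans h≡′ h≡ ,
            (λ nz → [ p , (λ h → j , j< , h) ]′ (p′ nz)) ,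
            λ w j≤ w< h → earlier w j≤ w< h q′)
          (wp-heapFree _ (wp-below 30 _ (scan-step {σ} {j} j< keep h≡)))
        where
        earlier : ∀ w → j ≤ w → w < n → Hit w → ∀ {z : Set} → (V σ 30 ≢ 0 ⊎ Hit j → z) → z
        earlier w j≤ w< h f with j ≟ w
        ... | yes refl = f (inj₂ h)
        ... | no j≢w   = f (inj₁ (q w (≤∧≢⇒< j≤ j≢w) w< h))
  record Ready (τ : Store) (x s u : ℕ) : Set where
    field
      fixed   : Fixed τ
      vertex≡ : V τ 26 ≡ u
      code≡   : V τ 27 ≡ s
      layer≡  : V τ 28 ≡ x
      offset≡ : V τ 29 ≡ off u
      zero≡   : V τ 30 ≡ 0
      u<      : u < n
      s<      : s < S
      x≤      : x ≤ k
      matrix  : ∀ i → i < A → H τ (A + i) ≡ cell i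
      above   : ∀ {s w} → x < k → s < S → w < n →
                let h = H τ (Tb + index (suc x) s w) in
                (h ≢ 0 → Walks (suc x) s w) × (Walks (suc x) s w → h ≢ 0)

  Decided : ℕ → ℕ → ℕ → Store → Set
  Decided x s u τ = (V τ 30 ≢ 0 → Walks x s u) × (Walks x s u → V τ 30 ≢ 0)

  ∸-suc-≡ : ∀ {x k} → x < k → k ∸ x ≡ suc (k ∸ suc x)
  ∸-suc-≡ {x} {suc k} (s≤s x≤) = +-∸-assoc 1 x≤

  unstep : ∀ {x s u} → x < k → Walks x s u →
           ∃[ w ] (w < n × cell (u * n + w) ≢ 0 × digitAt (suc R) s (off u) ≢ 0 × Walks (suc x) (s ∸ off u) w)
  unstep {x} {s} {u} x< walk = helper (subst (λ i → Reach n (suc R) cell off i s u) (∸-suc-≡ x<) walk)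
    where
    helper : ∀ {i} → Reach n (suc R) cell off (suc i) s u →
             ∃[ w ] (w < n × cell (u * n + w) ≢ 0 × digitAt (suc R) s (off u) ≢ 0 × Reach n (suc R) cell off i (s ∸ off u) w)
    helper (along _ w< a d r) = _ , w< , a , d , r

  restep : ∀ {x s u w} → x < k → u < n → w < n → cell (u * n + w) ≢ 0 → digitAt (suc R) s (off u) ≢ 0 →
           Walks (suc x) (s ∸ off u) w → Walks x s u
  restep {x} {s} {u} x< u< w< a d walk =
    subst (λ i → Reach n (suc R) cell off i s u) (sym (∸-suc-≡ x<)) (along u< w< a d walk)

  branchTime : ℕ
  branchTime = 7 + (11 + suc (7 + (4 + (n * 65 + 1)) + 2))

  trans-correct : ∀ {τ x s u} → x < k → Ready τ x s u → WP transS branchTime (Decided x s u) τ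
  trans-correct {τ} {x} {s} {u} x< rd =
    wp-seq (wp-assign _) λ { refl → check (digitAt (suc R) s (off u) ≟ 0) }
    where
    open Ready rd
    q = apply div (V τ 27) (V τ 29)
    τ₁ τ₂ τ₃ : Store
    τ₁ = ⟪ V τ [ 24 ≔ q ] , H τ ⟫
    τ₂ = ⟪ V τ₁ [ 24 ≔ V τ 27 ∸ V τ 29 ] , H τ ⟫
    τ₃ = ⟪ V τ₂ [ 31 ≔ V τ 0 ] , H τ ⟫
    f₃ : Fixed τ₃
    f₃ = fixed-upd {τ₂} (fixed-upd {τ₁} (fixed-upd {τ} fixed 24 q) 24 (V τ 27 ∸ V τ 29)) 31 (V τ 0)
    digit≡ : q ∸ apply div q (V τ 4) * V τ 4 ≡ digitAt (suc R) s (off u)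
    digit≡ = cong₂ (λ q b → q ∸ apply div q b * b) (cong₂ (apply div) code≡ offset≡) (at {τ} fixed 4)
    s′≡ : V τ 27 ∸ V τ 29 ≡ s ∸ off u
    s′≡ = cong₂ _∸_ code≡ offset≡
    s′< : s ∸ off u < S
    s′< = ≤-<-trans (m∸n≤m s (off u)) s<
    bounded : apply div q (V τ 4) * V τ 4 ≤ B
    bounded = ≤-trans (div-mul≤ q (V τ 4)) (≤-trans (apply-bound div {x = V τ 27} {V τ 29}
      (≤-trans (≤-reflexive code≡) (≤-trans (<⇒≤ s<) (≤-trans (m≤m*n S (suc R * 2)) (≤-trans (≤-reflexive (sym (*-assoc S (suc R) 2))) SR≤)))) _) ≤-refl)
    check : Dec (digitAt (suc R) s (off u) ≡ 0) →
      WP (ifn (v 24 mod v 4) (24 := v 27 ⊖ v 29 ⨾ 31 := v 0 ⨾ loop 31 scanS) skip)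
         (11 + suc (7 + (4 + (n * 65 + 1)) + 2)) (Decided x s u) τ₁
    check (yes z) = _ , _ , ifF (_ , (_ , _ , bounded) , _) (trans digit≡ z) skip ,
      +-monoʳ-≤ 11 (s≤s z≤n) , (λ nz → contradiction zero≡ nz) ,
      λ walk → let _ , _ , _ , d , _ = unstep x< walk in contradiction z d
    check (no nz) =
      let σ′ , c′ , p , le , post = scanning
      in σ′ , _ , ifT (_ , (_ , _ , bounded) , _) (λ e → nz (trans (sym digit≡) e)) p ,
         +-monoʳ-≤ 11 (s≤s (+-monoˡ-≤ 2 le)) , post
      where
      found : ∀ {z : Set} {w} → w < n → Hit {τ₃} f₃ u< s′< x< vertex≡ s′≡ layer≡ w → Walks x s u
      found {w = w} w< (a , t) = restep x< u< w< (λ e → a (trans (matrix _ (adjacent-cell u< w<)) e)) nz (proj₁ (above x< s′< w<) t)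
      scanning : WP (24 := v 27 ⊖ v 29 ⨾ 31 := v 0 ⨾ loop 31 scanS) (7 + (4 + (n * 65 + 1))) (Decided x s u) τ₁
      scanning = wp-seq (wp-assign _) λ { refl → wp-seq (wp-assign _) λ { refl →
        wp-weaken ≤-refl
          (λ (p , q) →
            (λ nz′ → let w , w< , h = p nz′ in found {⊤} w< h) ,
            λ walk → let w , w< , a , d , r = unstep x< walk in
              q w w< ((λ e → a (trans (sym (matrix _ (adjacent-cell u< w<))) e)) , proj₂ (above x< s′< w<) r))
          (scan {τ₃} f₃ u< s′< x< vertex≡ s′≡ layer≡ (at {τ} fixed 0) zero≡) } }

  -- Equality is tested by the sum of the two truncated differences, which vanishes only for equal
  -- numbers. In the last layer no edge is left, and a lone vertex has its own offset as code.
  start-correct : ∀ {τ x s u} → k ≤ x → Ready τ x s u → WP startS 30 (Decided x s u) τ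
  start-correct {τ} {x} {s} {u} k≤ rd = check (s ≟ off u)
    where
    open Ready rd
    gap≡ : (V τ 27 ∸ V τ 29) + (V τ 29 ∸ V τ 27) ≡ (s ∸ off u) + (off u ∸ s)
    gap≡ = cong₂ (λ a b → (a ∸ b) + (b ∸ a)) code≡ offset≡
    gap≤ : (V τ 27 ∸ V τ 29) + (V τ 29 ∸ V τ 27) ≤ B
    gap≤ = begin
      (V τ 27 ∸ V τ 29) + (V τ 29 ∸ V τ 27) ≡⟨ gap≡ ⟩
      (s ∸ off u) + (off u ∸ s)            ≤⟨ +-mono-≤ (≤-trans (m∸n≤m s (off u)) (≤-trans (<⇒≤ s<) (m≤m*n S (suc R)))) (≤-trans (m∸n≤m (off u) s) (off≤ u)) ⟩
      S * suc R + S * suc R                ≡⟨ cong (S * suc R +_) (sym (+-identityʳ _)) ⟩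
      2 * (S * suc R)                      ≡⟨ *-comm 2 (S * suc R) ⟩
      S * suc R * 2                        ≤⟨ SR≤ ⟩
      B                                    ∎ where open ≤-Reasoning
    length≡ : k ∸ x ≡ 0
    length≡ = m≤n⇒m∸n≡0 k≤
    check : Dec (s ≡ off u) → WP startS 30 (Decided x s u) τ
    check (yes e) = _ , _ , ifF (_ , _ , gap≤) (trans gap≡ (cong₂ _+_ (m≤n⇒m∸n≡0 (≤-reflexive e)) (m≤n⇒m∸n≡0 (≤-reflexive (sym e))))) (assign small) , by≤ ,
      (λ _ → subst (λ i → Reach n (suc R) cell off i s u) (sym length≡) (here′ u< e)) , λ _ ()
    check (no ne) = _ , _ , ifT (_ , _ , gap≤) (λ z → ne (no-gap (trans (sym gap≡) z))) skip , by≤ ,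
      (λ nz → contradiction zero≡ nz) , λ walk → contradiction (source (subst (λ i → Reach n (suc R) cell off i s u) length≡ walk)) ne
      where
      no-gap : (s ∸ off u) + (off u ∸ s) ≡ 0 → s ≡ off u
      no-gap z = ≤-antisym (m∸n≡0⇒m≤n (m+n≡0⇒m≡0 (s ∸ off u) z)) (m∸n≡0⇒m≤n (m+n≡0⇒n≡0 (s ∸ off u) z))
      source : Reach n (suc R) cell off 0 s u → s ≡ off u
      source (here′ _ e) = e

  branch-correct : ∀ {τ x s u} → Ready τ x s u →
    WP (ifn (v 1 ⊖ v 28) transS startS) (5 + suc (branchTime + 2)) (Decided x s u) τ
  branch-correct {τ} {x} rd with x <? k
  ... | yes x< = let σ′ , c′ , p , le , q = trans-correct x< rd in
    σ′ , _ , ifT _ (λ z → m>n⇒m∸n≢0 x< (trans (sym (cong₂ _∸_ (at {τ} (Ready.fixed rd) 1) (Ready.layer≡ rd))) z)) p ,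
    +-monoʳ-≤ 5 (s≤s (+-monoˡ-≤ 2 le)) , q
  ... | no x≮ = let σ′ , c′ , p , le , q = start-correct (≮⇒≥ x≮) rd in
    σ′ , _ , ifF _ (trans (cong₂ _∸_ (at {τ} (Ready.fixed rd) 1) (Ready.layer≡ rd)) (m≤n⇒m∸n≡0 (≮⇒≥ x≮))) p ,
    +-monoʳ-≤ 5 (s≤s (≤-trans le (≤-trans (≤-trans by≤ (m≤m+n 30 (n * 65 + 5))) (≤-reflexive (regroup (n * 65)))))) , q
    where
    regroup : ∀ m → 30 + (m + 5) ≡ 7 + (11 + suc (7 + (4 + (m + 1)) + 2)) + 2
    regroup = solve-∀

  module Fill (Goal Prev : Set) (goal : ∀ {s u} → s < S → u < n → Walks 0 s u → Goal) where

    -- `Goal` is what a set answer flag must imply and `Prev` is what rounds before the present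
    -- guess have established. Both are abstract, so the invariant of one table carries that of the
    -- outer search through.
    record Inv (j : ℕ) (σ : Store) : Set where
      field
        fixed   : Fixed σ
        matrix  : ∀ i → i < A → H σ (A + i) ≡ cell i
        offs    : ∀ x → x < n → H σ (O + x) ≡ off x
        entries : ∀ i → j ≤ i → i < tot → Entry i (H σ (Tb + i))
        sound   : V σ 14 ≢ 0 → Goal
        prev    : Prev → V σ 14 ≢ 0
        found   : ∀ i → j ≤ i → i < tot → layer i ≡ 0 → H σ (Tb + i) ≢ 0 → V σ 14 ≢ 0

    finalS : Stmt
    finalS = ifn (v 28) skip (ifn (v 30) (14 := lit 1) skip)

    cellTime : ℕ
    cellTime = 13 + (10 + (13 + (10 + (3 + (5 + suc (branchTime + 2) + (10 + 20))))))

    final-correct : ∀ {σ} → WP finalS 20 (λ τ → H τ ≡ H σ × (∀ y → y < 14 → V τ y ≡ V σ y) ×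
      (V τ 14 ≢ 0 → V σ 14 ≢ 0 ⊎ (V σ 28 ≡ 0 × V σ 30 ≢ 0)) × (V σ 14 ≢ 0 ⊎ (V σ 28 ≡ 0 × V σ 30 ≢ 0) → V τ 14 ≢ 0)) σ
    final-correct {σ} with V σ 28 ≟ 0 | V σ 30 ≟ 0
    ... | no nz | _     = _ , _ , ifT _ nz skip , by≤ , refl , (λ _ _ → refl) , inj₁ , λ { (inj₁ p) → p ; (inj₂ (z , _)) → contradiction z nz }
    ... | yes z | yes z′ = _ , _ , ifF _ z (ifF _ z′ skip) , by≤ , refl , (λ _ _ → refl) , inj₁ , λ { (inj₁ p) → p ; (inj₂ (_ , nz)) → contradiction z′ nz }
    ... | yes z | no nz = _ , _ , ifF _ z (ifT _ nz (assign small)) , by≤ , refl ,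
      (λ y y< → upd-other (V σ) 14 1 y (λ e → <⇒≢ y< (sym e))) , (λ _ → inj₂ (z , nz)) , λ _ ()

    cell-step : ∀ {j σ} → j < tot → Inv (suc j) σ → WP cellS cellTime (Inv j) ⟪ V σ [ 25 ≔ j ] , H σ ⟫
    cell-step {j} {σ} j< inv =
      wp-seq (wp-assign (_ , (_ , _ , ≤-trans (div-mul≤ j (V σ 0)) j≤B) , _)) λ { refl →
      wp-seq (wp-assign _) λ { refl →
      wp-seq (wp-assign (_ , (_ , _ , ≤-trans (div-mul≤ (apply div j (V σ 0)) (V σ 6)) (apply-bound div {x = j} {V σ 0} j≤B _)) , _)) λ { refl →
      wp-seq (wp-assign ((_ , _ , drop48 Ou≤) , Ou≤)) λ { refl →
      wp-seq (wp-assign small) λ { refl →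
      wp-seq (wp-heapFree _ (wp-untouched 28 _ (wp-untouched 25 _ (wp-below 24 _ (branch-correct {τ} ready))))) λ {τ′} →
        λ (((((val→ , →val) , keep) , keep25) , keep28) , h≡) →
      let Tj≡ : V τ′ 12 + V τ′ 25 ≡ Tb + j
          Tj≡ = cong₂ _+_ (trans (keep 12 by<) (at {σ} fixed 12)) keep25
          f′ : Fixed τ′
          f′ = fixed-below {τ} {τ′} fτ (λ y y< → keep y (≤-trans y< by≤))
      in wp-seq {c = 10} {Q = λ σ₁ → σ₁ ≡ ⟪ V τ′ , H σ [ Tb + j ≔ V τ′ 30 ] ⟫}
        (⟪ V τ′ , H τ′ [ V τ′ 12 + V τ′ 25 ≔ V τ′ 30 ] ⟫ , 10 ,
         put (_ , _ , ≤-trans (≤-reflexive Tj≡) (drop48 (table≤ j<))) _ (≤-trans (≤-reflexive (cong (48 +_) Tj≡)) (table≤ j<)) , ≤-refl ,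
         cong₂ (λ h i → ⟪ V τ′ , h [ i ≔ V τ′ 30 ] ⟫) h≡ Tj≡) λ { refl →
      wp-weaken ≤-refl (λ {ω} (hω , keepω , ans→ , →ans) → finish ω (V τ′ 30) hω
            (fixed-below {⟪ V τ′ , H σ ⟫} {ω} f′ keepω) val→ →val
            (λ nz → [ (λ a → inj₁ (subst (_≢ 0) (keep 14 by<) a)) , (λ (l , w) → inj₂ (trans (sym (trans keep28 layer₀)) l , w)) ]′ (ans→ nz))
            (λ e → →ans ([ (λ a → inj₁ (subst (_≢ 0) (sym (keep 14 by<)) a)) , (λ (l , w) → inj₂ (trans (trans keep28 layer₀) l , w)) ]′ e)))
        (final-correct {⟪ V τ′ , H σ [ Tb + j ≔ V τ′ 30 ] ⟫}) }}}}}}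
      where
      open Inv inv
      V₀ = V σ [ 25 ≔ j ]
      V₁ = V₀ [ 26 ≔ j ∸ apply div j (V σ 0) * V σ 0 ]
      V₂ = V₁ [ 28 ≔ apply div (apply div j (V σ 0)) (V σ 6) ]
      V₃ = V₂ [ 27 ≔ apply div j (V σ 0) ∸ apply div (apply div j (V σ 0)) (V σ 6) * V σ 6 ]
      V₄ = V₃ [ 29 ≔ H σ (V σ 11 + V₁ 26) ]
      τ : Store
      τ = ⟪ V₄ [ 30 ≔ 0 ] , H σ ⟫
      n≡ = at {σ} fixed 0
      S≡ = at {σ} fixed 6
      j≤ : j ≤ tot
      j≤ = <⇒≤ j<
      j≤B : j ≤ B
      j≤B = ≤-trans j≤ (m+n≤o⇒n≤o (48 + Tb) heap≤)
      vertex₀ : V₁ 26 ≡ vertex j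
      vertex₀ = cong (λ m → j ∸ apply div j m * m) n≡
      layer₀ : V τ 28 ≡ layer j
      layer₀ = cong₂ (λ m t → apply div (apply div j m) t) n≡ S≡
      code₀ : V τ 27 ≡ code j
      code₀ = cong₂ (λ m t → apply div j m ∸ apply div (apply div j m) t * t) n≡ S≡
      Ou≡ : V σ 11 + V₁ 26 ≡ O + vertex j
      Ou≡ = cong₂ _+_ (at {σ} fixed 11) vertex₀
      Ou≤ : 48 + (V σ 11 + V₁ 26) ≤ B
      Ou≤ = ≤-trans (≤-reflexive (cong (48 +_) Ou≡)) (lower≤ (<-≤-trans (+-monoʳ-< O (vertex< j)) (≤-reflexive (sym Tb≡))))
      fτ : Fixed τ
      fτ = fixed-upd {⟪ V₄ , H σ ⟫} (fixed-upd {⟪ V₃ , H σ ⟫} (fixed-upd {⟪ V₂ , H σ ⟫} (fixed-upd {⟪ V₁ , H σ ⟫}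
             (fixed-upd {⟪ V₀ , H σ ⟫} (fixed-upd {σ} fixed 25 j) 26 _) 28 _) 27 _) 29 _) 30 0
      ready : Ready τ (layer j) (code j) (vertex j)
      ready = record
        { fixed = fτ ; vertex≡ = vertex₀ ; code≡ = code₀ ; layer≡ = layer₀
        ; offset≡ = trans (cong (H σ) Ou≡) (offs (vertex j) (vertex< j)) ; zero≡ = refl
        ; u< = vertex< j ; s< = code< j ; x≤ = layer≤ j< ; matrix = matrix
        ; above = λ {s} {w} x< s< w< →
            let i = index (suc (layer j)) s w
                p , q = entries i (index-later refl) (index< x< s< w<)
                walks≡ = cong₂ (λ x (s , w) → Walks x s w) (index-layer (suc (layer j)) s< w<)
                           (cong₂ _,_ (index-code (suc (layer j)) s< w<) (index-vertex (suc (layer j)) {s} w<))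
            in (λ h → subst (λ A → A) walks≡ (p h)) , λ walk → q (subst (λ A → A) (sym walks≡) walk) }
      finish : ∀ ω val → H ω ≡ H σ [ Tb + j ≔ val ] → Fixed ω →
        (val ≢ 0 → Walks (layer j) (code j) (vertex j)) → (Walks (layer j) (code j) (vertex j) → val ≢ 0) →
        (V ω 14 ≢ 0 → V σ 14 ≢ 0 ⊎ (layer j ≡ 0 × val ≢ 0)) → (V σ 14 ≢ 0 ⊎ (layer j ≡ 0 × val ≢ 0) → V ω 14 ≢ 0) → Inv j ω
      finish ω val hω fω val→ →val ans→ →ans = record
        { fixed = fω
        ; matrix = λ i i< → trans (low (A + i) (A+<Tb i<)) (matrix i i<)
        ; offs = λ x x< → trans (low (O + x) (<-≤-trans (+-monoʳ-< O x<) (≤-reflexive (sym Tb≡)))) (offs x x<)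
        ; entries = λ i j≤ i< → entry i j≤ i< (j ≟ i)
        ; sound = λ nz → [ sound , (λ (l , w) → goal (code< j) (vertex< j) (subst (λ x → Walks x (code j) (vertex j)) l (val→ w))) ]′ (ans→ nz)
        ; prev = λ p → →ans (inj₁ (prev p))
        ; found = λ i j≤ i< l h → witness i j≤ i< l h (j ≟ i) }
        where
        low : ∀ i → i < Tb → H ω i ≡ H σ i
        low i i< = trans (cong (λ h → h i) hω) (upd-other (H σ) (Tb + j) val i (λ e → <⇒≱ i< (subst (Tb ≤_) e (m≤m+n Tb j))))
        same : H ω (Tb + j) ≡ val
        same = trans (cong (λ h → h (Tb + j)) hω) (upd-same (H σ) (Tb + j) val)
        other : ∀ i → j ≢ i → H ω (Tb + i) ≡ H σ (Tb + i)
        other i j≢i = trans (cong (λ h → h (Tb + i)) hω) (upd-other (H σ) (Tb + j) val (Tb + i) (λ e → j≢i (+-cancelˡ-≡ Tb j i e)))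
        entry : ∀ i → j ≤ i → i < tot → Dec (j ≡ i) → Entry i (H ω (Tb + i))
        entry i j≤ i< (yes refl) = subst (Entry i) (sym same) (val→ , →val)
        entry i j≤ i< (no j≢i)   = subst (Entry i) (sym (other i j≢i)) (entries i (≤∧≢⇒< j≤ j≢i) i<)
        witness : ∀ i → j ≤ i → i < tot → layer i ≡ 0 → H ω (Tb + i) ≢ 0 → Dec (j ≡ i) → V ω 14 ≢ 0
        witness i j≤ i< l h (yes refl) = →ans (inj₂ (l , subst (_≢ 0) same h))
        witness i j≤ i< l h (no j≢i)   = →ans (inj₁ (found i (≤∧≢⇒< j≤ j≢i) i< l (subst (_≢ 0) (other i j≢i) h)))

    fill : ∀ {σ} → V σ 25 ≡ tot → Inv tot σ → WP (loop 25 cellS) (tot * (cellTime + 5) + 1) (Inv 0) σ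
    fill e inv = wp-loop Inv tot _ (λ {j} {σ} j< i → cell-step {j} {σ} j< i) e inv

-- Strings of moves as numbers

opDigit : Op → ℕ
opDigit halve   = 0
opDigit double  = 1
opDigit advance = 2
opDigit emit    = 3

encode : List Op → ℕ
encode []       = 0
encode (o ∷ os) = opDigit o + encode os * 4

opDigit<4 : ∀ o → opDigit o < 4
opDigit<4 halve   = by<
opDigit<4 double  = by<
opDigit<4 advance = by<
opDigit<4 emit    = by<

encode< : ∀ os → encode os < 4 ^ length os
encode< []       = by<
encode< (o ∷ os) = begin-strict
  opDigit o + encode os * 4    <⟨ +-monoˡ-< (encode os * 4) (opDigit<4 o) ⟩
  4 + encode os * 4            ≤⟨ *-monoˡ-≤ 4 (encode< os) ⟩
  4 ^ length os * 4            ≡⟨ *-comm (4 ^ length os) 4 ⟩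
  4 * 4 ^ length os            ∎ where open ≤-Reasoning

toOp-digit : ∀ o → toOp (opDigit o) ≡ o
toOp-digit halve   = refl
toOp-digit double  = refl
toOp-digit advance = refl
toOp-digit emit    = refl

module _ {P S R : ℕ} where
  open Ops P S R

  offset-bound : ∀ z os s → offset s ≤ S * suc R → offset (runOps z os s) ≤ S * suc R
  offset-bound z []       s le = le
  offset-bound z (o ∷ os) s le = offset-bound z os (opStep z o s) (one o s le)
    where
    one : ∀ o s → offset s ≤ S * suc R → offset (opStep z o s) ≤ S * suc R
    one halve   s le = le
    one double  s le = le
    one advance s le = le
    one emit (cursor p w o) le with p ≤ᵇ z
    ... | false = le
    ... | true with o <ᵇ S in eq
    ...   | false = le
    ...   | true = *-monoˡ-≤ (suc R) (<⇒≤ (<ᵇ⇒< o S (subst T (sym eq) tt)))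

  -- Even a string that describes no tree only multiplies by `suc R`. Hence every guess is a genuine
  -- colouring, and soundness applies to all guesses alike.
  offset-power : ∀ z os s → ∃[ c ] offset s ≡ suc R ^ c → ∃[ c ] offset (runOps z os s) ≡ suc R ^ c
  offset-power z []       s e = e
  offset-power z (o ∷ os) s e = offset-power z os (opStep z o s) (one o s e)
    where
    one : ∀ o s → ∃[ c ] offset s ≡ suc R ^ c → ∃[ c ] offset (opStep z o s) ≡ suc R ^ c
    one halve   s e = e
    one double  s e = e
    one advance s e = e
    one emit (cursor p w o) (c , e) with p ≤ᵇ z
    ... | false = c , e
    ... | true with o <ᵇ S
    ...   | false = c , e
    ...   | true = suc c , trans (*-comm o (suc R)) (cong (suc R *_) e)

  -- Every guess is read with the same number of digits. A shorter string is padded with zeros,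
  -- which decode to `halve`, and this move leaves the offset alone.
  halves-harmless : ∀ z m s → offset (runOps z (decode m 0) s) ≡ offset s
  halves-harmless z zero    s = refl
  halves-harmless z (suc m) s = halves-harmless z m (opStep z halve s)

  decode-encode : ∀ z os m s → length os ≤ m → offset (runOps z (decode m (encode os)) s) ≡ offset (runOps z os s)
  decode-encode z []       m       s le = halves-harmless z m s
  decode-encode z (o ∷ os) (suc m) s (s≤s le) =
    trans (cong₂ (λ d g → offset (runOps z (decode m g) (opStep z (toOp d) s))) digit≡ rest≡)
      (trans (cong (λ p → offset (runOps z (decode m (encode os)) (opStep z p s))) (toOp-digit o))
        (decode-encode z os m (opStep z o s) le))
    where
    digit≡ : (opDigit o + encode os * 4) % 4 ≡ opDigit o
    digit≡ = trans ([m+kn]%n≡m%n (opDigit o) (encode os) 4) (m<n⇒m%n≡m (opDigit<4 o))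
    rest≡ : (opDigit o + encode os * 4) / 4 ≡ encode os
    rest≡ = trans (+-distrib-/-∣ʳ (opDigit o) (divides-refl (encode os)))
              (cong₂ _+_ (m<n⇒m/n≡0 (opDigit<4 o)) (m*n/n≡m (encode os) 4))

-- The search over all multipliers and strings

module Search (B n k r R Q S Γ P F₂ A O Tb tot : ℕ)
              (sz : Machine.Sizes B n k r R Q S Γ P F₂ A O Tb tot)
              (A≡ : A ≡ n * n) (A+A≤O : A + A ≤ O) (Tb≡ : Tb ≡ O + n) (tot≡ : tot ≡ suc k * S * n)
              (G : Graph n) (1≤R : 1 ≤ R) (R≤r : R ≤ r) where
  open Machine B n k r R Q S Γ P F₂ A O Tb tot
  open Correct sz
  open Machine.Sizes sz
  open Rules B
  open Ops P S R
  open Colouring B n k r R Q S Γ P F₂ A O Tb tot sz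

  guess : ℕ → ℕ → ℕ
  guess c = offsets (apply div c Γ) (remainder c Γ)

  guess≤ : ∀ c x → guess c x ≤ S * suc R
  guess≤ c x = offset-bound {P} (hash (apply div c Γ) x) (decode F₂ (remainder c Γ)) (cursor 0 n 1) (*-mono-≤ {1} {S} {1} S>0 (s≤s z≤n))

  guess-power : ∀ c x → ∃[ e ] guess c x ≡ suc R ^ e
  guess-power c x = offset-power {P} {S} (hash (apply div c Γ) x) (decode F₂ (remainder c Γ)) (cursor 0 n 1) (0 , refl)

  Accepts : ℕ → Set
  Accepts c = ∃[ s ] ∃[ u ] (s < S × u < n × Reach n (suc R) (matrixCell G) (guess c) k s u)

  accepts-sound : ∀ c {s u} → Reach n (suc R) (matrixCell G) (guess c) k s u → RSimpleKPath G r k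
  accepts-sound c = Coloured.sound G R (guess c) (λ x → proj₁ (guess-power c x)) (λ x _ → proj₂ (guess-power c x)) 1≤R R≤r

  record MainInv (j : ℕ) (σ : Store) : Set where
    field
      fixed    : Fixed σ
      matrix   : ∀ i → i < A → H σ (A + i) ≡ matrixCell G i
      sound    : V σ 14 ≢ 0 → RSimpleKPath G r k
      complete : ∀ c → j ≤ c → c < P * Γ → Accepts c → V σ 14 ≢ 0

  -- The value of `cellTime` written out, since that definition lives in a module that depends on
  -- the guess, whereas the time of a round must not.
  cellTime′ : ℕ
  cellTime′ = 13 + (10 + (13 + (10 + (3 + (5 + suc (7 + (11 + suc (7 + (4 + (n * 65 + 1)) + 2)) + 2) + (10 + 20))))))

  mainTime : ℕ
  mainTime = 7 + (10 + (4 + (n * (colourTime + 5) + 1 + (4 + (tot * (cellTime′ + 5) + 1)))))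

  main-step : ∀ {j σ} → j < P * Γ → MainInv (suc j) σ → WP mainS mainTime (MainInv j) ⟪ V σ [ 15 ≔ j ] , H σ ⟫
  main-step {j} {σ} j< inv =
    wp-seq (wp-assign _) λ { refl →
    wp-seq (wp-assign (_ , (_ , _ , ≤-trans (div-mul≤ j (V σ 7)) (≤-trans (<⇒≤ j<) PΓ≤)) , _)) λ { refl →
    wp-seq (wp-assign _) λ { refl →
    wp-seq (colour-loop {τ} fτ a≡ g≡ (at {σ} fixed 0) a*n≤ g≤ (lower≤ₒ)) λ {σ₁} post →
    wp-seq (wp-assign _) λ { refl →
    wp-weaken ≤-refl (λ {ω} inv′ → finish ω inv′)
      (Fi.fill {⟪ V σ₁ [ 25 ≔ V σ₁ 13 ] , H σ₁ ⟫} (at {σ₁} (ColourPost.fixed post) 13) (begin-fill σ₁ post)) }}}}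
    where
    open MainInv inv
    a = apply div j Γ
    g = remainder j Γ
    module Tab = Table B n k r R Q S Γ P F₂ A O Tb tot sz A≡ A+A≤O Tb≡ tot≡ (matrixCell G) (guess j) (guess≤ j)
    Later : Set
    Later = ∃[ c ] (suc j ≤ c × c < P * Γ × Accepts c)
    module Fi = Tab.Fill (RSimpleKPath G r k) Later (λ {s} {u} _ _ → accepts-sound j {s} {u})
    V₀ = V σ [ 15 ≔ j ]
    V₁ = V₀ [ 16 ≔ apply div j (V σ 7) ]
    V₂ = V₁ [ 17 ≔ j ∸ apply div j (V σ 7) * V σ 7 ]
    τ : Store
    τ = ⟪ V₂ [ 18 ≔ V σ 0 ] , H σ ⟫
    fτ : Fixed τ
    fτ = fixed-upd {⟪ V₂ , H σ ⟫} (fixed-upd {⟪ V₁ , H σ ⟫} (fixed-upd {⟪ V₀ , H σ ⟫} (fixed-upd {σ} fixed 15 j) 16 _) 17 _) 18 (V σ 0)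
    a≡ : V τ 16 ≡ a
    a≡ = cong (apply div j) (at {σ} fixed 7)
    g≡ : V τ 17 ≡ g
    g≡ = cong (remainder j) (at {σ} fixed 7)
    a*n≤ : a * n ≤ B
    a*n≤ = ≤-trans (*-monoˡ-≤ n (<⇒≤ (apply-div< j {Γ} {P} Γ>0 j<))) P*n≤
    g≤ : g ≤ B
    g≤ = ≤-trans (m∸n≤m j (a * Γ)) (≤-trans (<⇒≤ j<) PΓ≤)
    lower≤ₒ : 48 + (O + n) ≤ B
    lower≤ₒ = ≤-trans (+-monoʳ-≤ 48 (≤-trans (≤-reflexive (sym Tb≡)) (m≤m+n Tb tot))) heap≤
    begin-fill : ∀ σ₁ → ColourPost a g τ σ₁ → Fi.Inv tot ⟪ V σ₁ [ 25 ≔ V σ₁ 13 ] , H σ₁ ⟫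
    begin-fill σ₁ post = record
      { fixed = fixed-upd {σ₁} (ColourPost.fixed post) 25 (V σ₁ 13)
      ; matrix = λ i i< → trans (ColourPost.lower post (A + i) (<-≤-trans (+-monoʳ-< A i<) A+A≤O)) (matrix i i<)
      ; offs = ColourPost.table post
      ; entries = λ i tot≤ i< → contradiction i< (≤⇒≯ tot≤)
      ; sound = λ nz → sound (subst (_≢ 0) keep14 nz)
      ; prev = λ (c , j≤ , c< , acc) → subst (_≢ 0) (sym keep14) (complete c j≤ c< acc)
      ; found = λ i tot≤ i< → contradiction i< (≤⇒≯ tot≤) }
      where
      keep14 : V σ₁ 14 ≡ V σ 14
      keep14 = ColourPost.keeps post 14 by<
    finish : ∀ ω → Fi.Inv 0 ω → MainInv j ω
    finish ω inv′ = record
      { fixed = Fi.Inv.fixed inv′ ; matrix = Fi.Inv.matrix inv′ ; sound = Fi.Inv.sound inv′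
      ; complete = λ c j≤ c< acc → accepted c j≤ c< acc (j ≟ c) }
      where
      accepted : ∀ c → j ≤ c → c < P * Γ → Accepts c → Dec (j ≡ c) → V ω 14 ≢ 0
      accepted c j≤ c< acc (no j≢c) = Fi.Inv.prev inv′ (c , ≤∧≢⇒< j≤ j≢c , c< , acc)
      accepted c j≤ c< (s , u , s< , u< , walk) (yes refl) =
        Fi.Inv.found inv′ i z≤n (Tab.index< {0} z≤n s< u<) (Tab.index-layer 0 s< u<)
          (proj₂ (Fi.Inv.entries inv′ i z≤n (Tab.index< {0} z≤n s< u<))
            (subst (λ A → A) (sym (cong₂ (λ x (s , w) → Tab.Walks x s w) (Tab.index-layer 0 s< u<)
              (cong₂ _,_ (Tab.index-code 0 s< u<) (Tab.index-vertex 0 {s} u<)))) walk))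
        where
        i = Tab.index 0 s u

  search : ∀ {σ} → V σ 15 ≡ P * Γ → MainInv (P * Γ) σ → WP (loop 15 mainS) (P * Γ * (mainTime + 5) + 1) (MainInv 0) σ
  search e inv = wp-loop MainInv (P * Γ) _ (λ {j} {σ} j< i → main-step {j} {σ} j< i) e inv

  accepts-complete : .{{_ : NonZero P}} → ∀ C → S ≡ suc R ^ suc C → ∀ a os (colour : ℕ → ℕ) → a < P →
    encode os < Γ → length os ≤ F₂ →
    (∀ x → offset (runOps ((a * x) % P) os (cursor 0 n 1)) ≡ suc R ^ colour x) →
    (∀ x → colour x ≤ C) → ∀ {m} → m ≡ k → (p : Vec (Fin n) (suc m)) → IsWalk G m p →
    (∀ c → sumL (vertices p) (λ x → # (colour x ≟ c)) ≤ R) →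
    ∃[ c ] (c < P * Γ × Accepts c)
  accepts-complete C S≡ a os colour a< g< len offs col≤ refl p walk classes =
    c , c< , code p , toℕ (lookup p Fin.zero) , subst (code p <_) (sym S≡) (Co.code< C col≤ p classes) , toℕ<n _ ,
    Co.complete C col≤ k p walk classes
    where
    c = a * Γ + encode os
    c< : c < P * Γ
    c< = begin-strict
      a * Γ + encode os   <⟨ +-monoʳ-< (a * Γ) g< ⟩
      a * Γ + Γ           ≡⟨ +-comm (a * Γ) Γ ⟩
      suc a * Γ           ≤⟨ *-monoˡ-≤ Γ a< ⟩
      P * Γ               ∎ where open ≤-Reasoning
    a≡ : apply div c Γ ≡ a
    a≡ = proj₁ (division a g<)
    g≡ : remainder c Γ ≡ encode os
    g≡ = proj₂ (division a g<)
    hash≡ : ∀ {P} .{{_ : NonZero P}} a x → a * x ∸ apply div (a * x) P * P ≡ (a * x) % P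
    hash≡ {suc P} a x = sym (m%n≡m∸m/n*n (a * x) (suc P))
    off≡ : ∀ x → x < n → guess c x ≡ suc R ^ colour x
    off≡ x _ = trans (cong₂ (λ a g → offsets a g x) a≡ g≡)
      (trans (decode-encode (hash a x) os F₂ (cursor 0 n 1) len)
        (trans (cong (λ z → offset (runOps z os (cursor 0 n 1))) (hash≡ a x)) (offs x)))
    module Co = Coloured G R (guess c) colour off≡
    open Co using (code)

-- Copying the matrix and computing the parameters

module Loops (B : ℕ) where
  open Rules B

  module _ {σ₀ : Store} (x : ℕ) (e : Expr) (b N : ℕ) (x≢23 : T (not (x ≡ᵇ 23))) (23≢x : T (not (23 ≡ᵇ x))) (b>0 : 0 < b)
           (bounded : V σ₀ x * b ^ N ≤ B) where

    Same : Store → Set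
    Same σ = (∀ y → T (not (x ≡ᵇ y)) → T (not (23 ≡ᵇ y)) → V σ y ≡ V σ₀ y) × H σ ≡ H σ₀

    -- The current value times `b` to the number of remaining rounds is invariant. As `b` is
    -- positive, every intermediate value is therefore at most the final one.
    power-loop : (∀ {σ} → Same σ → BoundE e σ × eval e σ ≡ b) → V σ₀ 23 ≡ N →
      WP (loop 23 (x := v x ⊗ e)) (N * (2 + (timeE e + 1) + 2 + 5) + 1) (λ σ → V σ x ≡ V σ₀ x * b ^ N × Same σ) σ₀
    power-loop ev e≡ = wp-weaken ≤-refl (λ {σ} (p , s) → trans (sym (*-identityʳ (V σ x))) p , s)
      (wp-loop I N x≢23 body e≡ (refl , (λ _ _ _ → refl) , refl))
      where
      I : ℕ → Store → Set
      I j σ = V σ x * b ^ j ≡ V σ₀ x * b ^ N × Same σ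
      body : ∀ {j σ} → j < N → I (suc j) σ →
             WP (x := v x ⊗ e) (2 + (timeE e + 1) + 2) (I j) ⟪ V σ [ 23 ≔ j ] , H σ ⟫
      body {j} {σ} j< (p , (same , h≡)) =
        wp-weaken ≤-refl (λ { refl →
            trans (cong (_* b ^ j) (trans (upd-same (V τ) x _) val)) (trans (*-assoc (V σ x) b (b ^ j)) p) ,
            (λ y y≢x y≢23 → trans (upd-untouched (V τ) x _ y y≢x) (proj₁ sameτ y y≢x y≢23)) , h≡ })
          (wp-assign (_ , proj₁ (ev sameτ) , ≤-trans (≤-reflexive val) product≤))
        where
        τ : Store
        τ = ⟪ V σ [ 23 ≔ j ] , H σ ⟫
        sameτ : Same τ
        sameτ = (λ y y≢x y≢23 → trans (upd-untouched (V σ) 23 j y y≢23) (same y y≢x y≢23)) , h≡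
        keepx : V τ x ≡ V σ x
        keepx = upd-untouched (V σ) 23 j x 23≢x
        val : V τ x * eval e τ ≡ V σ x * b
        val = cong₂ _*_ keepx (proj₂ (ev sameτ))
        product≤ : V σ x * b ≤ B
        product≤ = ≤-trans (m≤m*n (V σ x * b) (b ^ j) {{>-nonZero (m^n>0 b {{>-nonZero b>0}} j)}})
          (≤-trans (≤-reflexive (trans (*-assoc (V σ x) b (b ^ j)) p)) bounded)

module Copying (B A : ℕ) (cell : ℕ → ℕ) where
  open Rules B

  -- Entry `j` is the lowest bit of `pack j`, so repeated halving recovers the entries from 44 down
  -- to 1. Entry 0 is known to be zero because the graph has no loops.
  pack : ℕ → ℕ
  pack zero    = cell 0
  pack (suc j) = pack j * 2 + cell (suc j)

  copyTime : ℕ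
  copyTime = 7 + (6 + (3 + (44 * 30 + 1 + (6 + ((A ∸ 45) * 20 + 1)))))

  module _ (lits : 524288 ≤ B) (pack≤ : ∀ j → j ≤ 44 → pack j ≤ B) (heap≤ : 48 + (A + A + 48) ≤ B)
           (cell<2 : ∀ i → cell i < 2) (cell₀ : cell 0 ≡ 0) where

    small : ∀ {a} {_ : T (a ≤ᵇ 524288)} → a ≤ B
    small {a} {t} = ≤-trans (≤ᵇ⇒≤ a 524288 t) lits

    address : ∀ {i} → i ≤ A + 48 → 48 + (A + i) ≤ B
    address i≤ = ≤-trans (+-monoʳ-≤ 48 (≤-trans (+-monoʳ-≤ A i≤) (≤-reflexive (sym (+-assoc A A 48))))) heap≤

    drop48 : ∀ {x} → 48 + x ≤ B → x ≤ B
    drop48 {x} le = ≤-trans (m≤n+m x 48) le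

    module _ {σ₀ : Store} (A≡ : V σ₀ 0 * V σ₀ 0 ≡ A) (pack≡ : V σ₀ 3 ≡ pack 44)
             (rest≡ : ∀ i → H σ₀ i ≡ cell (45 + i)) where

      Low : Store → Set
      Low σ = V σ 10 ≡ A × (∀ i → i < A → H σ i ≡ H σ₀ i)

      Bits : ℕ → Store → Set
      Bits j σ = Low σ × V σ 3 ≡ pack j × (∀ i → i ≡ 0 ⊎ j < i → i ≤ 44 → H σ (A + i) ≡ cell i)

      Rest : ℕ → Store → Set
      Rest j σ = Low σ × (∀ i → i ≤ 44 → H σ (A + i) ≡ cell i) ×
                 (∀ i → j ≤ i → i < A ∸ 45 → H σ (A + (i + 45)) ≡ cell (i + 45))

      low-put : ∀ {σ} a w → Low σ → V σ 10 ≡ A → ∀ i → i < A → (H σ [ A + a ≔ w ]) i ≡ H σ₀ i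
      low-put {σ} a w low _ i i< = trans (upd-other (H σ) (A + a) w i (λ e → <⇒≱ i< (subst (A ≤_) e (m≤m+n A a)))) (proj₂ low i i<)

      bits-step : ∀ {j σ} → j < 44 → Bits (suc j) σ →
        WP (put (v 10 ⊕ (v 23 ⊕ lit 1)) (v 3 mod lit 2) ⨾ 3 := v 3 ⊘ lit 2) 25 (Bits j) ⟪ V σ [ 23 ≔ j ] , H σ ⟫
      bits-step {j} {σ} j< ((a≡ , low) , p≡ , bits) =
        wp-seq {c = 19} {Q = λ σ₁ → σ₁ ≡ σ₁′} (σ₁″ , 19 , put (_ , (_ , small , drop-to) , drop48 at≤) (_ , ((_ , small , _) , small , ≤-trans (div-mul≤ (V σ 3) 2) p≤) , _) at≤ ,
            ≤-refl , cong₂ (λ i w → ⟪ V σ [ 23 ≔ j ] , H σ [ i ≔ w ] ⟫) place bit) λ { refl →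
        wp-weaken ≤-refl (λ { refl →
          (a≡ , low-put {σ} (suc j) (cell (suc j)) (a≡ , low) a≡) ,
          trans (cong (λ p → apply div p 2) p≡) (proj₁ (division (pack j) (cell<2 (suc j)))) ,
          λ i i? i≤ → set i i? i≤ (suc j ≟ i) }) (wp-assign {σ = σ₁′} (_ , small , _)) }
        where
        σ₁″ σ₁′ : Store
        σ₁″ = ⟪ V σ [ 23 ≔ j ] , H σ [ V σ 10 + (j + 1) ≔ V σ 3 ∸ apply div (V σ 3) 2 * 2 ] ⟫
        σ₁′ = ⟪ V σ [ 23 ≔ j ] , H σ [ A + suc j ≔ cell (suc j) ] ⟫
        place : V σ 10 + (j + 1) ≡ A + suc j
        place = cong₂ _+_ a≡ (+-comm j 1)
        p≤ : V σ 3 ≤ B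
        p≤ = ≤-trans (≤-reflexive p≡) (pack≤ (suc j) j<)
        at≤ : 48 + (V σ 10 + (j + 1)) ≤ B
        at≤ = ≤-trans (≤-reflexive (cong (48 +_) place)) (address (≤-trans j< (≤-trans by≤ (m≤n+m 48 A))))
        drop-to : j + 1 ≤ B
        drop-to = m+n≤o⇒n≤o (V σ 10) (drop48 at≤)
        bit : V σ 3 ∸ apply div (V σ 3) 2 * 2 ≡ cell (suc j)
        bit = trans (cong (λ p → remainder p 2) p≡) (proj₂ (division (pack j) (cell<2 (suc j))))
        set : ∀ i → i ≡ 0 ⊎ j < i → i ≤ 44 → Dec (suc j ≡ i) → (H σ [ A + suc j ≔ cell (suc j) ]) (A + i) ≡ cell i
        set i i? i≤ (yes refl) = upd-same (H σ) (A + suc j) _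
        set i i? i≤ (no ne) = trans (upd-other (H σ) (A + suc j) _ (A + i) (λ e → ne (+-cancelˡ-≡ A (suc j) i e)))
          (bits i ([ inj₁ , (λ lt → inj₂ (≤∧≢⇒< lt ne)) ]′ i?) i≤)

      -- The sources lie below `A` and the targets at `A + 45` or above, so nothing is overwritten
      -- before it is read.
      rest-step : ∀ {j σ} → j < A ∸ 45 → Rest (suc j) σ →
        WP (put (v 10 ⊕ (v 23 ⊕ lit 45)) (get (v 23))) 15 (Rest j) ⟪ V σ [ 23 ≔ j ] , H σ ⟫
      rest-step {j} {σ} j< ((a≡ , low) , bits , rest) =
        _ , 15 , put (_ , (_ , small , m+n≤o⇒n≤o (V σ 10) (drop48 at≤)) , drop48 at≤) (_ , ≤-trans (+-monoʳ-≤ 48 (≤-trans (<⇒≤ j<A) (m≤m+n A 0))) (address z≤n)) at≤ , ≤-refl ,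
        ((a≡ , λ i i< → trans (stored i) (low-put {σ} (j + 45) (H σ j) (a≡ , low) a≡ i i<)) ,
         (λ i i≤ → trans (stored (A + i)) (trans (upd-other (H σ) (A + (j + 45)) _ (A + i) (λ e → <⇒≱ (s≤s i≤) (≤-trans (m≤n+m 45 j) (≤-reflexive (+-cancelˡ-≡ A (j + 45) i e))))) (bits i i≤))) ,
         λ i j≤ i< → trans (stored (A + (i + 45))) (set i j≤ i< (j ≟ i)))
        where
        j+45≤ : j + 45 ≤ A
        j+45≤ = ≤-trans (+-monoˡ-≤ 45 (<⇒≤ j<)) (≤-reflexive (m∸n+n≡m 45≤A))
          where
          45≤A : 45 ≤ A
          45≤A with 45 ≤? A
          ... | yes le = le
          ... | no ≰ = contradiction (subst (j <_) (m≤n⇒m∸n≡0 (<⇒≤ (≰⇒> ≰))) j<) λ ()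
        j<A : j < A
        j<A = <-≤-trans (m<m+n j (s≤s z≤n)) j+45≤
        place : V σ 10 + (j + 45) ≡ A + (j + 45)
        place = cong (_+ (j + 45)) a≡
        at≤ : 48 + (V σ 10 + (j + 45)) ≤ B
        at≤ = ≤-trans (≤-reflexive (cong (48 +_) place)) (address (≤-trans j+45≤ (m≤m+n A 48)))
        stored : ∀ i → (H σ [ V σ 10 + (j + 45) ≔ H σ j ]) i ≡ (H σ [ A + (j + 45) ≔ H σ j ]) i
        stored i = cong (λ a → (H σ [ a ≔ H σ j ]) i) place
        set : ∀ i → j ≤ i → i < A ∸ 45 → Dec (j ≡ i) → (H σ [ A + (j + 45) ≔ H σ j ]) (A + (i + 45)) ≡ cell (i + 45)
        set i j≤ i< (yes refl) = trans (upd-same (H σ) (A + (j + 45)) _) (trans (low j j<A) (trans (rest≡ j) (cong cell (+-comm 45 j))))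
        set i j≤ i< (no ne) = trans (upd-other (H σ) (A + (j + 45)) _ (A + (i + 45)) (λ e → ne (+-cancelʳ-≡ 45 j i (+-cancelˡ-≡ A _ _ e))))
          (rest i (≤∧≢⇒< j≤ ne) i<)

      copy-correct : WP copyS copyTime (λ σ → V σ 10 ≡ A × (∀ i → i < A → H σ (A + i) ≡ cell i)) σ₀
      copy-correct =
        wp-seq (wp-assign (_ , _ , ≤-trans (≤-reflexive A≡) A≤B)) λ { refl →
        wp-seq {c = 6} {Q = λ σ → σ ≡ ⟪ V σ₀ [ 10 ≔ a ] , H σ₀ [ a ≔ 0 ] ⟫} (_ , 6 , put _ small (≤-trans (≤-reflexive (cong (48 +_) A≡)) 48A≤B) , ≤-refl , refl) λ { refl →
        wp-seq (wp-assign small) λ { refl →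
        wp-seq (wp-loop Bits 44 _ (λ {j} {σ} j< i → bits-step {j} {σ} j< i) refl start-bits) λ {σ₁} (low , _ , bits) →
        wp-seq (wp-assign (_ , small , _)) λ { refl →
        wp-weaken ≤-refl (λ {σ} → λ ((a≡ , _) , bits , rest) → a≡ , collect σ bits rest)
          (wp-loop Rest (A ∸ 45) _ (λ {j} {σ} j< i → rest-step {j} {σ} j< i) (cong (_∸ 45) (proj₁ low))
            (low , (λ i i≤ → bits i (positive i) i≤) , λ i le lt → contradiction lt (≤⇒≯ le))) }}}}
        where
        48A≤B : 48 + A ≤ B
        48A≤B = ≤-trans (+-monoʳ-≤ 48 (m≤m+n A 0)) (address z≤n)
        A≤B : A ≤ B
        A≤B = drop48 48A≤B
        positive : ∀ i → i ≡ 0 ⊎ 0 < i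
        positive zero    = inj₁ refl
        positive (suc i) = inj₂ (s≤s z≤n)
        a = V σ₀ 0 * V σ₀ 0
        start-bits : Bits 44 ⟪ (V σ₀ [ 10 ≔ a ]) [ 23 ≔ 44 ] , H σ₀ [ a ≔ 0 ] ⟫
        start-bits = (A≡ , λ i i< → upd-other (H σ₀) a 0 i (λ e → <⇒≢ i< (trans (sym e) A≡))) , pack≡ , first
          where
          first : ∀ i → i ≡ 0 ⊎ 44 < i → i ≤ 44 → (H σ₀ [ a ≔ 0 ]) (A + i) ≡ cell i
          first i (inj₁ refl) _ = trans (trans (cong (H σ₀ [ a ≔ 0 ]) (trans (+-identityʳ A) (sym A≡))) (upd-same (H σ₀) a 0)) (sym cell₀)
          first i (inj₂ lt) le = contradiction le (<⇒≱ lt)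
        collect : ∀ σ → (∀ i → i ≤ 44 → H σ (A + i) ≡ cell i) → (∀ i → 0 ≤ i → i < A ∸ 45 → H σ (A + (i + 45)) ≡ cell (i + 45)) →
                  ∀ i → i < A → H σ (A + i) ≡ cell i
        collect σ bits rest i i< with i ≤? 44
        ... | yes le = bits i le
        ... | no ≰ = subst (λ i → H σ (A + i) ≡ cell i) (m∸n+n≡m (≰⇒> ≰))
              (rest (i ∸ 45) z≤n (∸-monoˡ-< i< (≰⇒> ≰)))

module Setup (B n k r R Q S F Γ : ℕ) where
  open Rules B

  powersTime : ℕ
  powersTime = 14 + (9 + (3 + (9 + ((Q + Q + 1) * 12 + 1 + (18 + (13 + (6 + (Q * 6 * 19 + 1 + (6 + (Q * 19 * 11 + 1))))))))))

  record Powers (σ : Store) : Set where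
    field
      R≡ : V σ 4 ≡ suc R
      Q≡ : V σ 5 ≡ Q
      S≡ : V σ 6 ≡ S
      Γ≡ : V σ 7 ≡ Γ
      F≡ : V σ 9 ≡ F

  module _ (lits : 524288 ≤ B) (k≤ : k + 1 ≤ B) (Q≤ : Q * 19 ≤ B) (S≤ : S * suc R * 2 ≤ B) (Γ≤ : Γ ≤ B) (S>0 : 0 < S) (R>0 : 0 < R)
           (R≡ : R ≡ r ∸ (r ∸ (k + 1))) (Q≡ : Q ≡ apply div k r + 1) (S≡ : S ≡ suc R ^ (Q + Q + 1))
           (F≡ : F ≡ (k + 1) * (k + 1) * (k + 1) * 128)
           (Γ≡ : Γ ≡ (F + F) * (F + F) * (R + R) ^ (Q * 6) * 64 ^ (Q * 19)) where

    small : ∀ {a} {_ : T (a ≤ᵇ 524288)} → a ≤ B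
    small {a} {t} = ≤-trans (≤ᵇ⇒≤ a 524288 t) lits

    F²≤ : (F + F) * (F + F) * (R + R) ^ (Q * 6) ≤ B
    F²≤ = ≤-trans (m≤m*n _ (64 ^ (Q * 19)) {{m^n≢0 64 (Q * 19)}}) (≤-trans (≤-reflexive (sym Γ≡)) Γ≤)

    RR>0 : 0 < R + R
    RR>0 = ≤-trans R>0 (m≤m+n R R)

    FF≤ : (F + F) * (F + F) ≤ B
    FF≤ = ≤-trans (m≤m*n _ ((R + R) ^ (Q * 6)) {{m^n≢0 (R + R) (Q * 6) {{>-nonZero RR>0}}}}) F²≤

    K = k + 1
    instance
      K≢0 : NonZero K
      K≢0 = >-nonZero (m≤n+m 1 k)

    F>0 : 0 < F
    F>0 = subst (0 <_) (sym F≡) (*-mono-≤ {1} {K * K * K} {1} {128} (*-mono-≤ {1} {K * K} {1} {K} (*-mono-≤ {1} {K} {1} {K} (m≤n+m 1 k) (m≤n+m 1 k)) (m≤n+m 1 k)) (s≤s z≤n))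

    F≤ : F + F ≤ B
    F≤ = ≤-trans (m≤m*n (F + F) (F + F) {{>-nonZero (≤-trans F>0 (m≤m+n F F))}}) FF≤

    KKK≤ : K * K * K * 128 ≤ B
    KKK≤ = ≤-trans (≤-reflexive (sym F≡)) (≤-trans (m≤m+n F F) F≤)

    Q>0 : 0 < Q
    Q>0 = subst (0 <_) (sym Q≡) (m≤n+m 1 (apply div k r))

    QQ1≤ : Q + Q + 1 ≤ Q * 19
    QQ1≤ = ≤-trans (+-monoʳ-≤ (Q + Q) Q>0) (≤-trans (≤-reflexive (three Q)) (*-monoʳ-≤ Q by≤))
      where
      three : ∀ q → q + q + q ≡ q * 3
      three = solve-∀

    RR≤ : R + R ≤ B
    RR≤ = ≤-trans (+-mono-≤ (n≤1+n R) (n≤1+n R)) (≤-trans (≤-reflexive (twice (suc R)))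
      (≤-trans (*-monoˡ-≤ 2 (m≤n*m (suc R) S {{>-nonZero S>0}})) S≤))
      where
      twice : ∀ q → q + q ≡ q * 2
      twice = solve-∀

    powers-correct : ∀ {σ} → V σ 1 ≡ k → V σ 2 ≡ r → WP powersS powersTime Powers σ
    powers-correct {σ} k≡ r≡ =
      wp-seq (wp-assign ((_ , (_ , (_ , small , ≤-trans (≤-reflexive (cong (_+ 1) k≡)) k≤) , _) , _) , small , ≤-trans (≤-reflexive R₀) sR≤)) λ { refl →
      wp-seq (wp-assign (_ , small , ≤-trans (≤-reflexive Q₀) Q≤B)) λ { refl →
      wp-seq (wp-assign small) λ { refl →
      wp-seq (wp-assign ((_ , _ , ≤-trans (m≤m+n _ 1) Q₀Q≤) , small , Q₀Q≤)) λ { refl →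
      wp-seq (Loops.power-loop B {τ₁} 6 (v 4) (suc R) (Q + Q + 1) _ _ (s≤s z≤n) (≤-trans (≤-reflexive S₀) S≤B)
                (λ {σ′} (same , _) → _ , trans (same 4 _ _) R₀) Q₀Q) λ {σ₁} → λ (S₁ , same₁ , _) →
      let k₁ : V σ₁ 1 ≡ k
          k₁ = trans (same₁ 1 _ _) k≡
          K₁ = cong (_+ 1) k₁
          b₃ = ≤-trans (m≤m*n (K * K * K) 128) KKK≤
          b₂ = ≤-trans (m≤m*n (K * K) K) b₃
          b₁ = ≤-trans (m≤m*n K K) b₂
          le : ∀ {x y} → x ≡ y → y ≤ B → x ≤ B
          le = λ e → ≤-trans (≤-reflexive e)
          bK : BoundE (v 1 ⊕ lit 1) σ₁
          bK = _ , small , le K₁ b₁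
      in
      wp-seq (wp-assign (((bK , bK , le (cong₂ _*_ K₁ K₁) b₂) , bK , le (cong₂ _*_ (cong₂ _*_ K₁ K₁) K₁) b₃) , small , le (F₀ σ₁ k₁) (≤-trans (m≤m+n F F) F≤))) λ { refl →
      wp-seq (wp-assign ((_ , _ , le (cong (λ f → f + f) (F₀ σ₁ k₁)) F≤) , (_ , _ , le (cong (λ f → f + f) (F₀ σ₁ k₁)) F≤) , le (cong (λ f → (f + f) * (f + f)) (F₀ σ₁ k₁)) FF≤)) λ { refl →
      wp-seq (wp-assign (_ , small , le (cong (_* 6) (trans (same₁ 5 _ _) Q₀)) (≤-trans (*-monoʳ-≤ Q by≤) Q≤))) λ { refl →
      wp-seq (Loops.power-loop B {τ₂ σ₁} 7 (v 4 ⊖ lit 1 ⊕ (v 4 ⊖ lit 1)) (R + R) (Q * 6) _ _ RR>0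
                (le (cong (λ f → (f + f) * (f + f) * (R + R) ^ (Q * 6)) (F₀ σ₁ k₁)) F²≤)
                (λ {σ′} (same , _) →
                   let e₄ = cong (_∸ 1) (trans (same 4 _ _) (trans (same₁ 4 _ _) R₀))
                   in ((_ , small , _) , (_ , small , _) , le (cong₂ _+_ e₄ e₄) RR≤) , cong₂ _+_ e₄ e₄)
                (cong (_* 6) (trans (same₁ 5 _ _) Q₀))) λ {σ₂} → λ (Γ₂ , same₂ , _) →
      wp-seq (wp-assign (_ , small , le (cong (_* 19) (trans (same₂ 5 _ _) (trans (same₁ 5 _ _) Q₀))) Q≤)) λ { refl →
      wp-weaken ≤-refl (λ {σ₃} → λ (Γ₃ , same₃ , _) → record
          { R≡ = trans (same₃ 4 _ _) (trans (same₂ 4 _ _) (trans (same₁ 4 _ _) R₀))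
          ; Q≡ = trans (same₃ 5 _ _) (trans (same₂ 5 _ _) (trans (same₁ 5 _ _) Q₀))
          ; S≡ = trans (same₃ 6 _ _) (trans (same₂ 6 _ _) (trans S₁ S₀))
          ; Γ≡ = trans Γ₃ (Γ₀ σ₁ σ₂ k₁ Γ₂)
          ; F≡ = trans (same₃ 9 _ _) (trans (same₂ 9 _ _) (F₀ σ₁ k₁)) })
        (Loops.power-loop B {⟪ V σ₂ [ 23 ≔ V σ₂ 5 * 19 ] , H σ₂ ⟫} 7 (lit 64) 64 (Q * 19) _ _ (s≤s z≤n)
           (le (Γ₀ σ₁ σ₂ k₁ Γ₂) Γ≤) (λ _ → small , refl)
           (cong (_* 19) (trans (same₂ 5 _ _) (trans (same₁ 5 _ _) Q₀)))) } } } } } } } }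
      where
      open Loops B using (Same)
      V₁ = V σ [ 4 ≔ V σ 2 ∸ (V σ 2 ∸ (V σ 1 + 1)) + 1 ]
      V₂ = V₁ [ 5 ≔ apply div (V σ 1) (V σ 2) + 1 ]
      V₃ = V₂ [ 6 ≔ 1 ]
      τ₁ : Store
      τ₁ = ⟪ V₃ [ 23 ≔ V₂ 5 + V₂ 5 + 1 ] , H σ ⟫
      τ₂ : Store → Store
      τ₂ σ₁ = ⟪ ((V σ₁ [ 9 ≔ f ]) [ 7 ≔ (f + f) * (f + f) ]) [ 23 ≔ V σ₁ 5 * 6 ] , H σ₁ ⟫
        where f = (V σ₁ 1 + 1) * (V σ₁ 1 + 1) * (V σ₁ 1 + 1) * 128
      R₀ : V σ 2 ∸ (V σ 2 ∸ (V σ 1 + 1)) + 1 ≡ suc R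
      R₀ = trans (cong₂ (λ r k → r ∸ (r ∸ (k + 1)) + 1) r≡ k≡) (trans (+-comm _ 1) (cong suc (sym R≡)))
      Q₀ : apply div (V σ 1) (V σ 2) + 1 ≡ Q
      Q₀ = trans (cong₂ (λ k r → apply div k r + 1) k≡ r≡) (sym Q≡)
      sR≤ : suc R ≤ B
      sR≤ = ≤-trans (+-monoˡ-≤ R R>0) RR≤
      Q≤B : Q ≤ B
      Q≤B = ≤-trans (m≤m*n Q 19) Q≤
      Q₀Q : V₂ 5 + V₂ 5 + 1 ≡ Q + Q + 1
      Q₀Q = cong (λ q → q + q + 1) Q₀
      Q₀Q≤ : V₂ 5 + V₂ 5 + 1 ≤ B
      Q₀Q≤ = ≤-trans (≤-reflexive Q₀Q) (≤-trans QQ1≤ Q≤)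
      S₀ : 1 * suc R ^ (Q + Q + 1) ≡ S
      S₀ = trans (*-identityˡ _) (sym S≡)
      S≤B : S ≤ B
      S≤B = ≤-trans (≤-trans (m≤m*n S (suc R)) (m≤m*n (S * suc R) 2)) S≤
      F₀ : ∀ σ₁ → V σ₁ 1 ≡ k → (V σ₁ 1 + 1) * (V σ₁ 1 + 1) * (V σ₁ 1 + 1) * 128 ≡ F
      F₀ σ₁ k₁ = trans (cong (λ k → (k + 1) * (k + 1) * (k + 1) * 128) k₁) (sym F≡)
      Γ₀ : ∀ σ₁ σ₂ → V σ₁ 1 ≡ k → V σ₂ 7 ≡ V (τ₂ σ₁) 7 * (R + R) ^ (Q * 6) → V σ₂ 7 * 64 ^ (Q * 19) ≡ Γ
      Γ₀ σ₁ σ₂ k₁ e = trans (cong (_* 64 ^ (Q * 19)) (trans e (cong (λ f → (f + f) * (f + f) * (R + R) ^ (Q * 6)) (F₀ σ₁ k₁)))) (sym Γ≡)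

-- Correctness of the whole program

module Whole (B n k r R Q S F Γ P A O Tb tot : ℕ) (G : Graph n)
  (lits : 524288 ≤ B) (k≤ : k + 1 ≤ B) (Q≤ : Q * 19 ≤ B) (P*4≤ : P * 4 ≤ B) (SR≤ : S * suc R * 2 ≤ B)
  (P*n≤ : P * n ≤ B) (PΓ≤ : P * Γ ≤ B) (heap≤ : 48 + (Tb + tot) ≤ B)
  (pack≤ : ∀ j → j ≤ 44 → Copying.pack B (n * n) (matrixCell G) j ≤ B)
  (n>0 : 0 < n) (P>0 : 0 < P) (S>0 : 0 < S) (Γ>0 : 0 < Γ) (n≤P : n ≤ P) (R>0 : 0 < R) (R≤r : R ≤ r)
  (R≡ : R ≡ r ∸ (r ∸ (k + 1))) (Q≡ : Q ≡ apply div k r + 1) (S≡ : S ≡ suc R ^ (Q + Q + 1))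
  (F≡ : F ≡ (k + 1) * (k + 1) * (k + 1) * 128)
  (Γ≡ : Γ ≡ (F + F) * (F + F) * (R + R) ^ (Q * 6) * 64 ^ (Q * 19))
  (P≡ : P ≡ Q * F * n) (A≡ : A ≡ n * n) (O≡ : O ≡ A + A + 48) (Tb≡ : Tb ≡ O + n) (tot≡ : tot ≡ suc k * S * n)
  where
  open Rules B

  sz : Machine.Sizes B n k r R Q S Γ P (F + F) A O Tb tot
  sz = record { lits = lits ; P*4≤ = P*4≤ ; SR≤ = SR≤ ; P*n≤ = P*n≤ ; PΓ≤ = PΓ≤ ; heap≤ = heap≤
              ; n>0 = n>0 ; P>0 = P>0 ; S>0 = S>0 ; Γ>0 = Γ>0 ; n≤P = n≤P }

  open Machine B n k r R Q S Γ P (F + F) A O Tb tot using (Fixed; module Correct)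
  open Correct sz using (small)

  A+A≤O : A + A ≤ O
  A+A≤O = ≤-trans (m≤m+n (A + A) 48) (≤-reflexive (sym O≡))

  module Se = Search B n k r R Q S Γ P (F + F) A O Tb tot sz A≡ A+A≤O Tb≡ tot≡ G R>0 R≤r
  module Pw = Setup B n k r R Q S F Γ
  module Cp = Copying B A (matrixCell G)

  O≤B : 48 + O ≤ B
  O≤B = ≤-trans (+-monoʳ-≤ 48 (≤-trans (≤-trans (m≤m+n O n) (≤-reflexive (sym Tb≡))) (m≤m+n Tb tot))) heap≤

  drop48 : ∀ {x} → 48 + x ≤ B → x ≤ B
  drop48 {x} le = ≤-trans (m≤n+m x 48) le

  Γ≤B : Γ ≤ B
  Γ≤B = ≤-trans (m≤n*m Γ P {{>-nonZero P>0}}) PΓ≤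

  tot≤B : tot ≤ B
  tot≤B = m+n≤o⇒n≤o (48 + Tb) heap≤

  setupTime : ℕ
  setupTime = 10 + (7 + (9 + (7 + (12 + (3 + 7)))))

  setup-correct : ∀ {σ} → Pw.Powers σ → V σ 0 ≡ n → V σ 1 ≡ k → V σ 2 ≡ r → V σ 10 ≡ A →
    WP setupS setupTime (λ τ → Fixed τ × V τ 14 ≡ 0 × V τ 15 ≡ P * Γ) σ
  setup-correct {σ} pw n₀ k₀ r₀ A₀ =
    wp-seq (wp-assign ((_ , _ , le QF₀ QF≤) , _ , le P₀ (≤-trans (m≤m*n P 4) P*4≤))) λ { refl →
    wp-seq (wp-assign (_ , _ , le FF₀ FF≤)) λ { refl →
    wp-seq (wp-assign ((_ , _ , le (cong₂ _+_ A₀ A₀) (≤-trans A+A≤O (drop48 O≤B))) , small , le O₀ (drop48 O≤B))) λ { refl →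
    wp-seq (wp-assign (_ , _ , le Tb₀ (≤-trans (m≤m+n Tb tot) (drop48 heap≤)))) λ { refl →
    wp-seq (wp-assign (((_ , small , le (cong (_+ 1) k₀) k≤) , _ , le kS₀ kS≤) , _ , le tot₀ tot≤B)) λ { refl →
    wp-seq (wp-assign small) λ { refl →
    wp-weaken ≤-refl (λ { refl → fixed , refl , PΓ₀ }) (wp-assign (_ , _ , le PΓ₀ PΓ≤)) } } } } } }
    where
    open Pw.Powers pw renaming (R≡ to R₀; Q≡ to Q₀; S≡ to S₀; Γ≡ to Γ₀; F≡ to F₀)
    le : ∀ {x y} → x ≡ y → y ≤ B → x ≤ B
    le e = ≤-trans (≤-reflexive e)
    QF₀ = cong₂ _*_ Q₀ F₀
    P₀ : V σ 5 * V σ 9 * V σ 0 ≡ P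
    P₀ = trans (cong₂ _*_ QF₀ n₀) (sym P≡)
    QF≤ : Q * F ≤ B
    QF≤ = ≤-trans (m≤m*n (Q * F) n {{>-nonZero n>0}}) (≤-trans (≤-reflexive (sym P≡)) (≤-trans (m≤m*n P 4) P*4≤))
    FF₀ = cong₂ _+_ F₀ F₀
    FF≤ = Pw.F≤ lits k≤ Q≤ SR≤ Γ≤B S>0 R>0 R≡ Q≡ S≡ F≡ Γ≡
    O₀ : V σ 10 + V σ 10 + 48 ≡ O
    O₀ = trans (cong (λ a → a + a + 48) A₀) (sym O≡)
    Tb₀ : V σ 10 + V σ 10 + 48 + V σ 0 ≡ Tb
    Tb₀ = trans (cong₂ _+_ O₀ n₀) (sym Tb≡)
    kS₀ : (V σ 1 + 1) * V σ 6 ≡ suc k * S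
    kS₀ = cong₂ _*_ (trans (cong (_+ 1) k₀) (+-comm k 1)) S₀
    kS≤ : suc k * S ≤ B
    kS≤ = ≤-trans (m≤m*n (suc k * S) n {{>-nonZero n>0}}) (≤-trans (≤-reflexive (sym tot≡)) tot≤B)
    tot₀ : (V σ 1 + 1) * V σ 6 * V σ 0 ≡ tot
    tot₀ = trans (cong₂ _*_ kS₀ n₀) (sym tot≡)
    PΓ₀ : V σ 5 * V σ 9 * V σ 0 * V σ 7 ≡ P * Γ
    PΓ₀ = cong₂ _*_ P₀ Γ₀
    V₄ = (((V σ [ 8 ≔ V σ 5 * V σ 9 * V σ 0 ]) [ 9 ≔ V σ 9 + V σ 9 ]) [ 11 ≔ V σ 10 + V σ 10 + 48 ])
           [ 12 ≔ V σ 10 + V σ 10 + 48 + V σ 0 ]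
    fixed : Fixed ⟪ ((V₄ [ 13 ≔ (V σ 1 + 1) * V σ 6 * V σ 0 ]) [ 14 ≔ 0 ])
                      [ 15 ≔ V σ 5 * V σ 9 * V σ 0 * V σ 7 ] , H σ ⟫
    fixed 0 _ _ = n₀
    fixed 1 _ _ = k₀
    fixed 2 _ _ = r₀
    fixed 3 _ ()
    fixed 4 _ _ = R₀
    fixed 5 _ _ = Q₀
    fixed 6 _ _ = S₀
    fixed 7 _ _ = Γ₀
    fixed 8 _ _ = P₀
    fixed 9 _ _ = FF₀
    fixed 10 _ _ = A₀
    fixed 11 _ _ = O₀
    fixed 12 _ _ = Tb₀
    fixed 13 _ _ = tot₀
    fixed (suc (suc (suc (suc (suc (suc (suc (suc (suc (suc (suc (suc (suc (suc y)))))))))))))) (s≤s (s≤s (s≤s (s≤s (s≤s (s≤s (s≤s (s≤s (s≤s (s≤s (s≤s (s≤s (s≤s (s≤s ())))))))))))))) _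

  programTime : ℕ
  programTime = Cp.copyTime + (Pw.powersTime + (setupTime + (P * Γ * (Se.mainTime + 5) + 1 + 4)))

  program-correct : (RSimpleKPath G r k → ∃[ c ] (c < P * Γ × Se.Accepts c)) →
    (∀ i → matrixCell G i < 2) → matrixCell G 0 ≡ 0 →
    ∀ {σ} → V σ 0 ≡ n → V σ 1 ≡ k → V σ 2 ≡ r → V σ 3 ≡ Cp.pack 44 → (∀ i → H σ i ≡ matrixCell G (45 + i)) →
    WP programS programTime (λ τ → (V τ 0 ≢ 0 → RSimpleKPath G r k) × (RSimpleKPath G r k → V τ 0 ≢ 0)) σ
  program-correct accepted cell<2 cell₀ {σ} n₀ k₀ r₀ p₀ rest =
    wp-seq (wp-below 3 _ (Cp.copy-correct lits pack≤′ AA≤ cell<2 cell₀ {σ} (trans (cong₂ _*_ n₀ n₀) (sym A≡)) p₀ rest)) λ {σ₁} → λ ((A₁ , matrix₁) , keep₁) →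
    let n₁ = trans (keep₁ 0 by<) n₀
        k₁ = trans (keep₁ 1 by<) k₀
        r₁ = trans (keep₁ 2 by<) r₀ in
    wp-seq (wp-heapFree _ (wp-untouched 10 _ (wp-below 3 _
        (Pw.powers-correct lits k≤ Q≤ SR≤ Γ≤B S>0 R>0 R≡ Q≡ S≡ F≡ Γ≡ {σ₁} k₁ r₁)))) λ {σ₂} → λ (((pw , keep₂) , keep10) , h₂) →
    wp-seq (wp-heapFree _ (setup-correct {σ₂} pw (trans (keep₂ 0 by<) n₁) (trans (keep₂ 1 by<) k₁) (trans (keep₂ 2 by<) r₁) (trans keep10 A₁))) λ {σ₃} → λ ((f , z , e) , h₃) →
    wp-seq (Se.search {σ₃} e record
        { fixed = f ; matrix = λ i i< → trans (cong (λ h → h (A + i)) (trans h₃ h₂)) (matrix₁ i i<)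
        ; sound = λ nz → contradiction z nz ; complete = λ c le lt → contradiction lt (≤⇒≯ le) }) λ inv →
    wp-weaken ≤-refl (λ { refl → Se.MainInv.sound inv , λ path → let c , c< , acc = accepted path in Se.MainInv.complete inv c z≤n c< acc })
      (wp-assign _)
    where
    pack≤′ : ∀ j → j ≤ 44 → Cp.pack j ≤ B
    pack≤′ j j≤ = ≤-trans (≤-reflexive (same j)) (pack≤ j j≤)
      where
      same : ∀ j → Cp.pack j ≡ Copying.pack B (n * n) (matrixCell G) j
      same zero = refl
      same (suc j) = cong (λ p → p * 2 + matrixCell G (suc j)) (same j)
    AA≤ : 48 + (A + A + 48) ≤ B
    AA≤ = subst (λ o → 48 + o ≤ B) O≡ O≤B

-- Completeness of the search

n<2^n : ∀ n → n < 2 ^ n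
n<2^n zero    = s≤s z≤n
n<2^n (suc n) = ≤-trans (+-mono-≤ (m^n>0 2 n) (n<2^n n)) (≤-reflexive (cong (2 ^ n +_) (sym (+-identityʳ (2 ^ n)))))

least-power : ∀ m N → m ≤ 2 ^ N → ∃[ j ] (j ≤ N × m ≤ 2 ^ j × (∀ i → i < j → 2 ^ i < m))
least-power m zero    le = 0 , z≤n , le , λ i ()
least-power m (suc N) le with m ≤? 2 ^ N
... | yes le′ = let j , j≤ , p , q = least-power m N le′ in j , m≤n⇒m≤1+n j≤ , p , q
... | no ≰    = suc N , ≤-refl , le , λ i i< → ≤-<-trans (^-monoʳ-≤ 2 (s≤s⁻¹ i<)) (≰⇒> ≰)

power-between : ∀ m → 0 < m → ∃[ j ] (j ≤ m × m ≤ 2 ^ j × 2 ^ j ≤ 2 * m × (∀ i → i < j → 2 ^ i < m))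
power-between m m>0 with least-power m m (<⇒≤ (n<2^n m))
... | zero  , j≤ , p , q = 0 , j≤ , p , ≤-trans m>0 (m≤n*m m 2) , q
... | suc j , j≤ , p , q = suc j , j≤ , p , *-monoʳ-≤ 2 (<⇒≤ (q j ≤-refl)) , q

min≤ : ∀ {x} r k → x ≤ r → x ≤ k → x ≤ r ∸ (r ∸ k)
min≤ r k x≤r x≤k with k ≤? r
... | yes k≤ = ≤-trans x≤k (≤-reflexive (sym (m∸[m∸n]≡n k≤)))
... | no ≰   = ≤-trans x≤r (≤-reflexive (cong (r ∸_) (sym (m≤n⇒m∸n≡0 (<⇒≤ (≰⇒> ≰))))))

min≤ʳ : ∀ r k → r ∸ (r ∸ k) ≤ k
min≤ʳ r k = m≤n+o⇒m∸n≤o r (r ∸ k) (subst (r ≤_) (+-comm k (r ∸ k)) (m≤n+m∸n r k))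

-- The capacity condition: Q classes of size R hold all k + 1 visits. If R is capped at k + 1 one
-- class suffices; otherwise R = r and Q exceeds k / r.
quotient-covers : ∀ k r → 0 < r → k + 1 ≤ (apply div k r + 1) * (r ∸ (r ∸ (k + 1)))
quotient-covers k r@(suc r′) r>0 with k + 1 ≤? r
... | yes le = ≤-trans (≤-reflexive (sym (m∸[m∸n]≡n le))) (m≤n*m _ (k / r + 1) {{>-nonZero (m≤n+m 1 (k / r))}})
... | no ≰   = ≤-trans below (*-monoʳ-≤ (k / r + 1) (≤-reflexive (cong (r ∸_) (sym (m≤n⇒m∸n≡0 (<⇒≤ (≰⇒> ≰)))))))
  where
  below : k + 1 ≤ (k / r + 1) * r
  below = begin
    k + 1                    ≡⟨ cong (_+ 1) (m≡m%n+[m/n]*n k r) ⟩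
    k % r + k / r * r + 1    ≡⟨ +-comm (k % r + k / r * r) 1 ⟩
    suc (k % r) + k / r * r  ≤⟨ +-monoˡ-≤ (k / r * r) (m%n<n k r) ⟩
    r + k / r * r            ≡⟨ cong (_* r) (+-comm 1 (k / r)) ⟩
    (k / r + 1) * r          ∎ where open ≤-Reasoning

-- A move takes two bits, so 3 Q j moves become the 6 Q-th power of `2 ^ j ≤ R + R`, the 3 Q c
-- remaining ones the power of 64, and the `e` initial doublings two factors `F + F`.
string-count : ∀ e j Q c F R → 2 ^ e ≤ F + F → 2 ^ j ≤ R + R →
               4 ^ (e + Q * (3 * j + 3 * c)) ≤ (F + F) * (F + F) * (R + R) ^ (Q * 6) * 64 ^ (Q * c)
string-count e j Q c F R e≤ j≤ = begin
  4 ^ (e + Q * (3 * j + 3 * c))                   ≡⟨ ^-*-assoc 2 2 (e + Q * (3 * j + 3 * c)) ⟩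
  2 ^ (2 * (e + Q * (3 * j + 3 * c)))             ≡⟨ cong (2 ^_) (spread e j Q c) ⟩
  2 ^ (e + e + j * (Q * 6) + 6 * (Q * c))         ≡⟨ ^-distribˡ-+-* 2 (e + e + j * (Q * 6)) (6 * (Q * c)) ⟩
  2 ^ (e + e + j * (Q * 6)) * 2 ^ (6 * (Q * c))   ≡⟨ cong₂ _*_ (^-distribˡ-+-* 2 (e + e) (j * (Q * 6))) (sym (^-*-assoc 2 6 (Q * c))) ⟩
  2 ^ (e + e) * 2 ^ (j * (Q * 6)) * 64 ^ (Q * c)  ≡⟨ cong (_* 64 ^ (Q * c)) (cong₂ _*_ (^-distribˡ-+-* 2 e e) (sym (^-*-assoc 2 j (Q * 6)))) ⟩
  2 ^ e * 2 ^ e * (2 ^ j) ^ (Q * 6) * 64 ^ (Q * c)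
    ≤⟨ *-monoˡ-≤ (64 ^ (Q * c)) (*-mono-≤ (*-mono-≤ e≤ e≤) (^-monoˡ-≤ (Q * 6) j≤)) ⟩
  (F + F) * (F + F) * (R + R) ^ (Q * 6) * 64 ^ (Q * c) ∎
  where
  open ≤-Reasoning
  spread : ∀ e j Q c → 2 * (e + Q * (3 * j + 3 * c)) ≡ e + e + j * (Q * 6) + 6 * (Q * c)
  spread = solve-∀

-- With 16 W + 2 ≤ 18 W the left side is at most 72 W³. This requirement makes F cubic in k and asks
-- for a factor of at least 72.
penalty-bound : ∀ W → 1 ≤ W → 4 * (W * W) * (16 * W + 2) ≤ W * W * W * 128
penalty-bound W 1≤W = ≤-trans (*-monoʳ-≤ (4 * (W * W)) (≤-trans (+-monoʳ-≤ (16 * W) (*-monoʳ-≤ 2 1≤W)) (≤-reflexive (sym (*-distribʳ-+ W 16 2)))))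
  (≤-trans (≤-reflexive (regroup W 4 18)) (*-monoʳ-≤ (W * W * W) by≤))
  where
  regroup : ∀ W a b → a * (W * W) * (b * W) ≡ W * W * W * (a * b)
  regroup = solve-∀

-- The number 2 F doubles as the common length of all strings: it is easily computed and exceeds any
-- useful length.
string-length : ∀ W e Q j F → 1 ≤ W → Q ≤ W → j ≤ W → e ≤ F → F ≡ W * W * W * 128 → e + Q * (3 * j + 57) ≤ F + F
string-length W e Q j F 1≤W Q≤ j≤ e≤ refl = +-mono-≤ e≤ (begin
  Q * (3 * j + 57)     ≤⟨ *-mono-≤ Q≤ (+-mono-≤ (*-monoʳ-≤ 3 j≤) (*-monoʳ-≤ 57 1≤W)) ⟩
  W * (3 * W + 57 * W) ≡⟨ cong (W *_) (sym (*-distribʳ-+ W 3 57)) ⟩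
  W * (60 * W)         ≡⟨ regroup W 60 ⟩
  W * W * 60           ≤⟨ *-mono-≤ (m≤m*n (W * W) W {{>-nonZero 1≤W}}) by≤ ⟩
  W * W * W * 128      ∎)
  where
  open ≤-Reasoning
  regroup : ∀ W a → W * (a * W) ≡ W * W * a
  regroup = solve-∀

-- An accepting guess for every r-simple walk

module Acceptance (n k r R Q S F Γ P : ℕ) (G : Graph n)
  (n>0 : 0 < n) (r>0 : 0 < r) (P>0 : 0 < P) (R>0 : 0 < R)
  (R≡ : R ≡ r ∸ (r ∸ (k + 1))) (Q≡ : Q ≡ apply div k r + 1) (S≡ : S ≡ suc R ^ (Q + Q + 1))
  (F≡ : F ≡ (k + 1) * (k + 1) * (k + 1) * 128)
  (Γ≡ : Γ ≡ (F + F) * (F + F) * (R + R) ^ (Q * 6) * 64 ^ (Q * 19))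
  (P≡ : P ≡ Q * F * n) where

  instance
    P≢0 : NonZero P
    P≢0 = >-nonZero P>0

  W : ℕ
  W = k + 1

  W>0 : 0 < W
  W>0 = m≤n+m 1 k

  F>0 : 0 < F
  F>0 = subst (0 <_) (sym F≡) (*-mono-≤ {1} {W * W * W} {1} {128} (*-mono-≤ {1} {W * W} {1} {W} (*-mono-≤ {1} {W} {1} {W} W>0 W>0) W>0) (s≤s z≤n))

  W≤QR : W ≤ Q * R
  W≤QR = subst₂ (λ Q R → W ≤ Q * R) (sym Q≡) (sym R≡) (quotient-covers k r r>0)

  R≤W : R ≤ W
  R≤W = ≤-trans (≤-reflexive R≡) (min≤ʳ r W)

  Q≤W : Q ≤ W
  Q≤W = ≤-trans (≤-reflexive Q≡) (+-monoˡ-≤ 1 (quotient≤ r))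
    where
    quotient≤ : ∀ r → apply div k r ≤ k
    quotient≤ zero    = z≤n
    quotient≤ (suc r) = m/n≤m k (suc r)

  Q>0 : 0 < Q
  Q>0 = subst (0 <_) (sym Q≡) (m≤n+m 1 (apply div k r))

  R<F : R ≤ F
  R<F = ≤-trans R≤W (≤-trans (≤-trans (m≤m*n W W {{>-nonZero W>0}}) (m≤m*n (W * W) W {{>-nonZero W>0}}))
          (≤-trans (m≤m*n (W * W * W) 128) (≤-reflexive (sym F≡))))

  GoodGuess : Set
  GoodGuess = let open Ops P S R in
    ∃[ a ] ∃[ os ] Σ (ℕ → ℕ) λ colour → ∃[ p ]
      (a < P × encode os < Γ × length os ≤ F + F ×
       (∀ x → offset (runOps ((a * x) % P) os (cursor 0 n 1)) ≡ suc R ^ colour x) ×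
       (∀ x → colour x ≤ Q + Q) × IsWalk G k p × (∀ c → sumL (vertices p) (λ x → # (colour x ≟ c)) ≤ R))

  module _ (p : Vec (Fin n) (suc k)) (walk : IsWalk G k p) (visits≤r : ∀ w → visits w p ≤ r)
           (j e h : ℕ) (e≡ : j + h ≡ e) (j≤R : j ≤ R) (R≤2^j : R ≤ 2 ^ j) (2^j≤ : 2 ^ j ≤ R + R)
           (e≤F : e ≤ F) (F≤2^e : F ≤ 2 ^ e) (2^e≤ : 2 ^ e ≤ F + F) (least-e : ∀ i → i < e → 2 ^ i < F) where

    ps : List ℕ
    ps = vertices p

    W≡ : length ps ≡ W
    W≡ = trans (length-vertices p) (+-comm 1 k)

    twice : ∀ m → 2 * m ≡ m + m
    twice m = cong (m +_) (+-identityʳ m)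

    S′≡ : suc R ^ suc (2 * Q) ≡ S
    S′≡ = trans (cong (suc R ^_) (trans (cong suc (twice Q)) (+-comm 1 (Q + Q)))) (sym S≡)

    -- A walk with k edges makes only k + 1 visits in all, so capping r at k + 1 loses nothing.
    visits≤R : ∀ w → visits w p ≤ R
    visits≤R w = ≤-trans (min≤ r (k + 1) (visits≤r w) (≤-trans (count≤n (w Fin.≟_) p) (≤-reflexive (+-comm 1 k)))) (≤-reflexive (sym R≡))

    Spreading : ℕ → ℕ → Set
    Spreading S C = let open Ops P S R in
      ∃[ a ] ∃[ os ] Σ (ℕ → ℕ) λ colour →
        (a < P × length os ≤ j + h + Q * (3 * j + 57) ×
         (∀ x → offset (runOps ((a * x) % P) os (cursor 0 n 1)) ≡ suc R ^ colour x) ×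
         (∀ x → colour x ≤ C) × (∀ c → sumL ps (λ x → # (colour x ≟ c)) ≤ R))

    spreading : Spreading (suc R ^ suc (2 * Q)) (2 * Q)
    spreading = Spread.good-colouring {n} {R} {Q} {F} {P} {j} {h} ps n>0 R>0 Q>0
      (subst (1 ≤_) (sym W≡) W>0) (subst (_≤ Q * R) (sym W≡) W≤QR) R≤2^j
      (subst (λ e → F ≤ 2 ^ e) (sym e≡) F≤2^e) (subst₂ (λ e t → 2 ^ e ≤ t) (sym e≡) (sym (twice F)) 2^e≤)
      (subst (λ e → ∀ i → i < e → 2 ^ i < F) (sym e≡) least-e)
      (subst (λ w → 4 * (w * w) * (16 * w + 2) ≤ F) (sym W≡) (≤-trans (penalty-bound W W>0) (≤-reflexive (sym F≡))))
      P≡ (vertices<n p) (visits-bound p visits≤R)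

    encoded : Spreading S (Q + Q) → GoodGuess
    encoded (a , os , colour , a< , len , offs , col≤ , classes) =
      a , os , colour , p , a< ,
      ≤-trans (encode< os) (≤-trans (^-monoʳ-≤ 4 len′) (≤-trans
         (string-count e j Q 19 F R 2^e≤ 2^j≤) (≤-reflexive (sym Γ≡)))) ,
      ≤-trans len′ (string-length W e Q j F W>0 Q≤W (≤-trans j≤R R≤W) e≤F F≡) ,
      offs , col≤ , walk , classes
      where
      len′ : length os ≤ e + Q * (3 * j + 57)
      len′ = subst (λ e → length os ≤ e + Q * (3 * j + 57)) e≡ len

    good-guess-from : GoodGuess
    good-guess-from = encoded (subst₂ Spreading S′≡ (twice Q) spreading)

  good-guess : RSimpleKPath G r k → GoodGuess
  good-guess (p , walk , visits≤r) = choose (power-between R R>0) (power-between F F>0)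
    where
    Between : ℕ → Set
    Between m = ∃[ j ] (j ≤ m × m ≤ 2 ^ j × 2 ^ j ≤ 2 * m × (∀ i → i < j → 2 ^ i < m))
    twice′ : ∀ m → 2 * m ≡ m + m
    twice′ m = cong (m +_) (+-identityʳ m)
    choose : Between R → Between F → GoodGuess
    choose (j , j≤R , R≤2^j , 2^j≤ , least-j) (e , e≤F , F≤2^e , 2^e≤ , least-e) =
      good-guess-from p walk visits≤r j e (e ∸ j) (m+[n∸m]≡n j≤e) j≤R R≤2^j (≤-trans 2^j≤ (≤-reflexive (twice′ R)))
        e≤F F≤2^e (≤-trans 2^e≤ (≤-reflexive (twice′ F))) least-e
      where
      -- The tree does have `j` top levels: if `e < j`, minimality of `j` would give
      -- `2 ^ e < R ≤ F`, against `F ≤ 2 ^ e`.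
      j≤e : j ≤ e
      j≤e = ≮⇒≥ λ e<j → <⇒≱ (least-j e e<j) (≤-trans R<F F≤2^e)

-- Time and word length

*-^ : ∀ a b m → (a * b) ^ m ≡ a ^ m * b ^ m
*-^ a b zero    = refl
*-^ a b (suc m) = trans (cong (a * b *_) (*-^ a b m)) (swap a b (a ^ m) (b ^ m))
  where
  swap : ∀ a b c d → a * b * (c * d) ≡ a * c * (b * d)
  swap = solve-∀

-- Bounds by numerical multiples of one dominant quantity

module Linear (Y : ℕ) (Y>0 : 0 < Y) where

  con : ∀ a → a ≤ Y * a
  con a = m≤n*m a Y {{>-nonZero Y>0}}

  infixr 5 _⊹_
  _⊹_ : ∀ {x y a b} → x ≤ Y * a → y ≤ Y * b → x + y ≤ Y * (a + b)
  _⊹_ {a = a} {b} p q = ≤-trans (+-mono-≤ p q) (≤-reflexive (sym (*-distribˡ-+ Y a b)))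

  unit : ∀ {x} → x ≤ Y → x ≤ Y * 1
  unit p = ≤-trans p (≤-reflexive (sym (*-identityʳ Y)))

  scale : ∀ {x a} b → x ≤ Y * a → x * b ≤ Y * (a * b)
  scale {a = a} b p = ≤-trans (*-monoˡ-≤ b p) (≤-reflexive (*-assoc Y a b))

  lift : ∀ {x y a} z → x ≤ y * a → z * y ≤ Y → z * x ≤ Y * a
  lift {x} {y} {a} z p q = ≤-trans (*-monoʳ-≤ z p) (≤-trans (≤-reflexive (sym (*-assoc z y a))) (*-monoˡ-≤ a q))

module Time (n k R Q S F Γ P A tot : ℕ)
  (n>0 : 0 < n) (Q>0 : 0 < Q) (S>0 : 0 < S) (F>0 : 0 < F) (Γ>0 : 0 < Γ)
  (P≡ : P ≡ Q * F * n) (A≡ : A ≡ n * n) (tot≡ : tot ≡ suc k * S * n) (R≤ : R ≤ suc k) where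

  -- `Z` dominates the work for one guess, namely n F for decoding and S W n² for the table; `Y` is
  -- this times the number of guesses.
  W Z Y : ℕ
  W = suc k
  Z = S * W * F * n * n
  Y = P * Γ * Z

  private
    instance
      n≢0 : NonZero n
      n≢0 = >-nonZero n>0
      Q≢0 : NonZero Q
      Q≢0 = >-nonZero Q>0
      S≢0 : NonZero S
      S≢0 = >-nonZero S>0
      F≢0 : NonZero F
      F≢0 = >-nonZero F>0
      Γ≢0 : NonZero Γ
      Γ≢0 = >-nonZero Γ>0

  P>0 : 0 < P
  P>0 = subst (0 <_) (sym P≡) (*-mono-≤ {1} {Q * F} {1} {n} (*-mono-≤ {1} {Q} {1} {F} Q>0 F>0) n>0)

  Z>0 : 0 < Z
  Z>0 = *-mono-≤ {1} {S * W * F * n} (*-mono-≤ {1} {S * W * F} (*-mono-≤ {1} {S * W} (*-mono-≤ {1} {S} {1} {W} S>0 (s≤s z≤n)) F>0) n>0) n>0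

  PΓ≤Y : P * Γ ≤ Y
  PΓ≤Y = m≤m*n (P * Γ) Z {{>-nonZero Z>0}}

  P≤Y : P ≤ Y
  P≤Y = ≤-trans (m≤m*n P Γ) PΓ≤Y

  Z≤Y : Z ≤ Y
  Z≤Y = m≤n*m Z (P * Γ) {{>-nonZero (*-mono-≤ {1} {P} {1} {Γ} P>0 Γ>0)}}

  Y>0 : 0 < Y
  Y>0 = ≤-trans P>0 P≤Y

  open Linear Y Y>0

  Q≤Y : Q ≤ Y
  Q≤Y = ≤-trans (≤-trans (m≤m*n Q F) (m≤m*n (Q * F) n)) (≤-trans (≤-reflexive (sym P≡)) P≤Y)

  SWn≤Z : S * W * n ≤ Z
  SWn≤Z = ≤-trans (*-monoˡ-≤ n (m≤m*n (S * W) F)) (m≤m*n (S * W * F * n) n)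

  SW≤Z : S * W ≤ Z
  SW≤Z = ≤-trans (m≤m*n (S * W) n) SWn≤Z

  W≤Z : W ≤ Z
  W≤Z = ≤-trans (m≤n*m W S) SW≤Z

  Fn≤Z : n * F ≤ Z
  Fn≤Z = ≤-trans (≤-reflexive (*-comm n F)) (≤-trans (*-monoˡ-≤ n (m≤n*m F (S * W) {{m*n≢0 S W}})) (m≤m*n (S * W * F * n) n))

  nn≤Z : n * n ≤ Z
  nn≤Z = *-monoˡ-≤ n (m≤n*m n (S * W * F) {{m*n≢0 (S * W) F {{m*n≢0 S W}}}})

  tot≡′ : tot ≡ S * W * n
  tot≡′ = trans tot≡ (cong (_* n) (*-comm W S))

  tot≤Z : tot ≤ Z
  tot≤Z = ≤-trans (≤-reflexive tot≡′) SWn≤Z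

  totn≤Z : tot * n ≤ Z
  totn≤Z = ≤-trans (*-monoˡ-≤ n (≤-reflexive tot≡′)) (*-monoˡ-≤ n (*-monoˡ-≤ n (m≤m*n (S * W) F)))

  A≤Y : A ≤ Y
  A≤Y = ≤-trans (≤-reflexive A≡) (≤-trans nn≤Z Z≤Y)

  n≤Y : n ≤ Y
  n≤Y = ≤-trans (m≤m*n n n) (≤-trans nn≤Z Z≤Y)

  -- The factor adds up the parts of the program: 88 for packing the input, 1364 for copying, 440
  -- for the powers, 55 for the remaining set-up, 405 for the search and 5 for the end.
  bound : ℕ
  bound = Y * 2357

  within : ∀ {x a} {_ : T (a ≤ᵇ 2357)} → x ≤ Y * a → x ≤ bound
  within {x} {a} {t} p = ≤-trans p (*-monoʳ-≤ Y (≤ᵇ⇒≤ a 2357 t))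

  k+1≤ : k + 1 ≤ bound
  k+1≤ = within {a = 1} (unit (≤-trans (≤-reflexive (+-comm k 1)) (≤-trans W≤Z Z≤Y)))

  Q19≤ : Q * 19 ≤ bound
  Q19≤ = within {a = 19} (scale 19 (unit Q≤Y))

  P4≤ : P * 4 ≤ bound
  P4≤ = within {a = 4} (scale 4 (unit P≤Y))

  SR≤ : S * suc R * 2 ≤ bound
  SR≤ = within {a = 4} (scale {a = 2} 2 (lift {suc R} {W} {2} S (≤-trans (s≤s R≤) (≤-trans (+-monoˡ-≤ W {1} (s≤s z≤n)) (≤-reflexive (twice W)))) (≤-trans SW≤Z Z≤Y)))
    where
    twice : ∀ m → m + m ≡ m * 2
    twice = solve-∀

  Pn≤ : P * n ≤ bound
  Pn≤ = within {a = 1} (unit (≤-trans (*-mono-≤ (m≤m*n P Γ) (≤-trans (m≤m*n n n) nn≤Z)) ≤-refl))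

  PΓ≤ : P * Γ ≤ bound
  PΓ≤ = within {a = 1} (unit PΓ≤Y)

  heap≤ : 48 + (A + A + 48 + n + tot) ≤ bound
  heap≤ = within {a = 100} (con 48 ⊹ (((unit A≤Y ⊹ unit A≤Y) ⊹ con 48) ⊹ unit n≤Y) ⊹ unit (≤-trans tot≤Z Z≤Y))

  -- The left side is the program's time written out, so that it agrees with `88 + programTime` by
  -- computation. The proof follows its shape term by term.
  time≤ : 88 + (7 + (6 + (3 + (44 * 30 + 1 + (6 + ((A ∸ 45) * 20 + 1)))))
            + (14 + (9 + (3 + (9 + ((Q + Q + 1) * 12 + 1 + (18 + (13 + (6 + (Q * 6 * 19 + 1 + (6 + (Q * 19 * 11 + 1))))))))))
            + (10 + (7 + (9 + (7 + (12 + (3 + 7)))))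
            + (P * Γ * (7 + (10 + (4 + (n * (19 + (3 + (4 + (3 + (4 + (4 + (((F + F) * 65 + 1) + 10)))))) + 5) + 1
                 + (4 + (tot * (13 + (10 + (13 + (10 + (3 + (5 + suc (7 + (11 + suc (7 + (4 + (n * 65 + 1)) + 2)) + 2) + (10 + 20)))))) + 5) + 1))))) + 5)
              + 1 + 4)))) ≤ bound
  time≤ = con 88 ⊹ copy ⊹ powers ⊹ con 55 ⊹ (search ⊹ con 1) ⊹ con 4
    where
    copy : 7 + (6 + (3 + (44 * 30 + 1 + (6 + ((A ∸ 45) * 20 + 1))))) ≤ Y * 1364
    copy = con 7 ⊹ con 6 ⊹ con 3 ⊹ con 1321 ⊹ con 6 ⊹ (scale 20 (unit (≤-trans (m∸n≤m A 45) A≤Y)) ⊹ con 1)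
    powers : 14 + (9 + (3 + (9 + ((Q + Q + 1) * 12 + 1 + (18 + (13 + (6 + (Q * 6 * 19 + 1 + (6 + (Q * 19 * 11 + 1)))))))))) ≤ Y * 440
    powers = con 14 ⊹ con 9 ⊹ con 3 ⊹ con 9 ⊹ (scale 12 ((unit Q≤Y ⊹ unit Q≤Y) ⊹ con 1) ⊹ con 1) ⊹ con 18 ⊹ con 13 ⊹ con 6
      ⊹ (scale 19 (scale 6 (unit Q≤Y)) ⊹ con 1) ⊹ con 6 ⊹ (scale 11 (scale 19 (unit Q≤Y)) ⊹ con 1)
    module L = Linear Z Z>0
    module LF = Linear F F>0
    module Ln = Linear n n>0
    colour : 19 + (3 + (4 + (3 + (4 + (4 + (((F + F) * 65 + 1) + 10)))))) + 5 ≤ F * 183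
    colour = (LF.con 19 LF.⊹ LF.con 3 LF.⊹ LF.con 4 LF.⊹ LF.con 3 LF.⊹ LF.con 4 LF.⊹ LF.con 4 LF.⊹
      ((LF.scale 65 (LF.unit ≤-refl LF.⊹ LF.unit ≤-refl) LF.⊹ LF.con 1) LF.⊹ LF.con 10)) LF.⊹ LF.con 5
    cell : 13 + (10 + (13 + (10 + (3 + (5 + suc (7 + (11 + suc (7 + (4 + (n * 65 + 1)) + 2)) + 2) + (10 + 20)))))) + 5 ≤ n * 190
    cell = (Ln.con 13 Ln.⊹ Ln.con 10 Ln.⊹ Ln.con 13 Ln.⊹ Ln.con 10 Ln.⊹ Ln.con 3 Ln.⊹
      ((Ln.con 5 Ln.⊹ Ln.con 1 Ln.⊹ (Ln.con 7 Ln.⊹ Ln.con 11 Ln.⊹ Ln.con 1 Ln.⊹ ((Ln.con 7 Ln.⊹ Ln.con 4 Ln.⊹ (Ln.scale 65 (Ln.unit ≤-refl) Ln.⊹ Ln.con 1)) Ln.⊹ Ln.con 2)) Ln.⊹ Ln.con 2)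
        Ln.⊹ Ln.con 30)) Ln.⊹ Ln.con 5
    search : P * Γ * (7 + (10 + (4 + (n * (19 + (3 + (4 + (3 + (4 + (4 + (((F + F) * 65 + 1) + 10)))))) + 5) + 1
                 + (4 + (tot * (13 + (10 + (13 + (10 + (3 + (5 + suc (7 + (11 + suc (7 + (4 + (n * 65 + 1)) + 2)) + 2) + (10 + 20)))))) + 5) + 1))))) + 5) ≤ Y * 405
    search = lift {y = Z} (P * Γ)
      ((L.con 7 L.⊹ L.con 10 L.⊹ L.con 4 L.⊹ (L.lift n colour Fn≤Z L.⊹ L.con 1) L.⊹ L.con 4 L.⊹ L.lift tot cell totn≤Z L.⊹ L.con 1) L.⊹ L.con 5)
      ≤-refl

-- The polynomial and the exponential part of the running time

pow-mul : ∀ W {x y a b} i j → x ≤ W ^ i * a → y ≤ W ^ j * b → x * y ≤ W ^ (i + j) * (a * b)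
pow-mul W {a = a} {b} i j p q = ≤-trans (*-mono-≤ p q)
  (≤-reflexive (trans (swap (W ^ i) a (W ^ j) b) (cong (_* (a * b)) (sym (^-distribˡ-+-* W i j)))))
  where
  swap : ∀ a b c d → a * b * (c * d) ≡ a * c * (b * d)
  swap = solve-∀

-- r ^ (8 q) 2 ^ (122 q) for q = ⌊k / r⌋: the part of the running time that is exponential in k / r.
Exponential : ℕ → ℕ → ℕ
Exponential r q = r ^ (q * 8) * 2 ^ (q * 8) * 64 ^ (q * 19)

-- Clearing the r-th root turns every exponent that is a multiple of q into the same multiple of q
-- r, and q r is at most k. The constant is 122 = 8 + 6 · 19, as 64 is 2⁶.
exponential-bound : ∀ r q k → 0 < r → q * r ≤ k → Exponential r q ^ r ≤ r ^ (8 * k) * 2 ^ (122 * k)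
exponential-bound r q k r>0 qr≤ = begin
  (r ^ (q * 8) * 2 ^ (q * 8) * 64 ^ (q * 19)) ^ r
    ≡⟨ trans (*-^ (r ^ (q * 8) * 2 ^ (q * 8)) (64 ^ (q * 19)) r) (cong (_* (64 ^ (q * 19)) ^ r) (*-^ (r ^ (q * 8)) (2 ^ (q * 8)) r)) ⟩
  (r ^ (q * 8)) ^ r * (2 ^ (q * 8)) ^ r * (64 ^ (q * 19)) ^ r
    ≡⟨ cong₂ _*_ (cong₂ _*_ (^-*-assoc r (q * 8) r) (^-*-assoc 2 (q * 8) r)) (trans (^-*-assoc 64 (q * 19) r) (^-*-assoc 2 6 (q * 19 * r))) ⟩
  r ^ (q * 8 * r) * 2 ^ (q * 8 * r) * 2 ^ (6 * (q * 19 * r))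
    ≡⟨ cong₂ _*_ (cong₂ (λ x y → r ^ x * 2 ^ y) (swap q 8 r) (swap q 8 r)) (cong (2 ^_) (swap₆ q r 6 19)) ⟩
  r ^ (8 * (q * r)) * 2 ^ (8 * (q * r)) * 2 ^ (114 * (q * r))
    ≡⟨ trans (*-assoc (r ^ (8 * (q * r))) _ _) (cong (r ^ (8 * (q * r)) *_) (trans (sym (^-distribˡ-+-* 2 (8 * (q * r)) (114 * (q * r)))) (cong (2 ^_) (sym (*-distribʳ-+ (q * r) 8 114))))) ⟩
  r ^ (8 * (q * r)) * 2 ^ (122 * (q * r))
    ≤⟨ *-mono-≤ (^-monoʳ-≤ r {{>-nonZero r>0}} (*-monoʳ-≤ 8 qr≤)) (^-monoʳ-≤ 2 (*-monoʳ-≤ 122 qr≤)) ⟩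
  r ^ (8 * k) * 2 ^ (122 * k) ∎
  where
  open ≤-Reasoning
  swap : ∀ a b c → a * b * c ≡ b * (a * c)
  swap = solve-∀
  swap₆ : ∀ q r a b → a * (q * b * r) ≡ a * b * (q * r)
  swap₆ = solve-∀

-- With Q = q + 1 the exponents 6 Q of the strings and 2 Q + 1 of the count vectors add up to 8 q +
-- 9. The 8 q factors 2 R are exponential in k / r; the other nine are at most 2 W and go to the
-- polynomial part.
table-size : ∀ r q R Q S F Γ W → R ≤ r → 1 ≤ R → R ≤ W → Q ≡ q + 1 → S ≡ suc R ^ (Q + Q + 1) →
  Γ ≡ (F + F) * (F + F) * (R + R) ^ (Q * 6) * 64 ^ (Q * 19) →
  Γ * S ≤ (F + F) * (F + F) * ((W + W) ^ 9 * 64 ^ 19) * Exponential r q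
table-size r q R Q S F Γ W R≤r 1≤R R≤W refl refl refl = begin
  FF * X ^ (Q * 6) * 64 ^ (Q * 19) * suc R ^ (Q + Q + 1)
    ≤⟨ *-monoʳ-≤ (FF * X ^ (Q * 6) * 64 ^ (Q * 19)) (^-monoˡ-≤ (Q + Q + 1) (+-monoˡ-≤ R 1≤R)) ⟩
  FF * X ^ (Q * 6) * 64 ^ (Q * 19) * X ^ (Q + Q + 1)
    ≡⟨ swap₁ FF (X ^ (Q * 6)) (64 ^ (Q * 19)) (X ^ (Q + Q + 1)) ⟩
  FF * (X ^ (Q * 6) * X ^ (Q + Q + 1)) * 64 ^ (Q * 19)
    ≡⟨ cong₂ (λ x y → FF * x * y) (trans (sym (^-distribˡ-+-* X (Q * 6) (Q + Q + 1))) (trans (cong (X ^_) (count₁ q)) (^-distribˡ-+-* X (q * 8) 9)))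
         (trans (cong (64 ^_) (*-distribʳ-+ 19 q 1)) (^-distribˡ-+-* 64 (q * 19) 19)) ⟩
  FF * (X ^ (q * 8) * X ^ 9) * (64 ^ (q * 19) * 64 ^ 19)
    ≤⟨ *-monoˡ-≤ (64 ^ (q * 19) * 64 ^ 19) (*-monoʳ-≤ FF (*-mono-≤ X^≤ (^-monoˡ-≤ 9 (+-mono-≤ R≤W R≤W)))) ⟩
  FF * (r ^ (q * 8) * 2 ^ (q * 8) * (W + W) ^ 9) * (64 ^ (q * 19) * 64 ^ 19)
    ≡⟨ swap₂ FF (r ^ (q * 8) * 2 ^ (q * 8)) ((W + W) ^ 9) (64 ^ (q * 19)) (64 ^ 19) ⟩
  FF * ((W + W) ^ 9 * 64 ^ 19) * (r ^ (q * 8) * 2 ^ (q * 8) * 64 ^ (q * 19)) ∎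
  where
  open ≤-Reasoning
  FF = (F + F) * (F + F)
  X = R + R
  swap₁ : ∀ a b c d → a * b * c * d ≡ a * (b * d) * c
  swap₁ = solve-∀
  swap₂ : ∀ a b c d e → a * (b * c) * (d * e) ≡ a * (c * e) * (b * d)
  swap₂ = solve-∀
  count₁ : ∀ q → (q + 1) * 6 + (q + 1 + (q + 1) + 1) ≡ q * 8 + 9
  count₁ = solve-∀
  X^≤ : X ^ (q * 8) ≤ r ^ (q * 8) * 2 ^ (q * 8)
  X^≤ = ≤-trans (^-monoˡ-≤ (q * 8) (≤-trans (+-mono-≤ R≤r R≤r) (≤-reflexive (double-r r)))) (≤-reflexive (*-^ r 2 (q * 8)))
    where
    double-r : ∀ r → r + r ≡ r * 2
    double-r = solve-∀

-- Abstract, since conversion checking would otherwise unfold products by this numeral.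
abstract
  polynomialConstant : ℕ
  polynomialConstant = (1 * 128 * (1 * 128)) * ((128 + 128) * (128 + 128) * (2 ^ 9 * 64 ^ 19))

  polynomial-part : ∀ W F Q → Q ≤ W → F ≡ W * W * W * 128 →
    Q * F * (W * F) * ((F + F) * (F + F) * ((W + W) ^ 9 * 64 ^ 19)) ≤ W ^ 23 * polynomialConstant
  polynomial-part W F Q Q≤ F≡ =
    -- Degrees in `W`: 4 from Q F and 4 from W F, then 3 from each of the two factors 2 F and 9 from
    -- the ninth power of 2 W, in all 23.
    pow-mul W 8 15 (pow-mul W 4 4 (pow-mul W 1 3 (one Q≤) F₃) (pow-mul W 1 3 (one ≤-refl) F₃))
      (pow-mul W 6 9 (pow-mul W 3 3 FF₃ FF₃) (pow-mul W {b = 64 ^ 19} 9 0 W₉ (≤-reflexive (sym (*-identityˡ (64 ^ 19))))))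
    where
    one : ∀ {x} → x ≤ W → x ≤ W ^ 1 * 1
    one le = ≤-trans le (≤-reflexive (sym (trans (*-identityʳ (W * 1)) (*-identityʳ W))))
    cube : ∀ w → w * w * w ≡ w * (w * (w * 1))
    cube = solve-∀
    twice : ∀ w → w + w ≡ w * 2
    twice = solve-∀
    F₃ : F ≤ W ^ 3 * 128
    F₃ = ≤-reflexive (trans F≡ (cong (_* 128) (cube W)))
    FF₃ : F + F ≤ W ^ 3 * (128 + 128)
    FF₃ = ≤-trans (+-mono-≤ F₃ F₃) (≤-reflexive (sym (*-distribˡ-+ (W ^ 3) 128 128)))
    W₉ : (W + W) ^ 9 ≤ W ^ 9 * 2 ^ 9
    W₉ = ≤-reflexive (trans (cong (_^ 9) (twice W)) (*-^ W 2 9))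

-- The last factor pays for replacing (k + 1)²³ by k²³, which is possible because k ≥ 1.
constant : ℕ
constant = polynomialConstant * 2357 * 2 ^ 23

product-bound : ∀ a n Γ S b poly D c K t p → Γ * S ≤ poly * D → a * b * poly ≤ K * t * p →
  a * n * Γ * (S * b * n * n) * c ≤ p * c * t * K * (n * (n * (n * 1))) * D
product-bound a n Γ S b poly D c K t p ΓS≤ ab≤ = begin
  a * n * Γ * (S * b * n * n) * c                ≡⟨ cong (_* c) (regroup a n Γ S b) ⟩
  a * b * m * (Γ * S) * c                        ≤⟨ *-monoˡ-≤ c (*-monoʳ-≤ (a * b * m) ΓS≤) ⟩
  a * b * m * (poly * D) * c                     ≡⟨ pull (a * b) m poly D c ⟩
  a * b * poly * (m * D * c)                     ≤⟨ *-monoˡ-≤ (m * D * c) ab≤ ⟩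
  K * t * p * (m * D * c)                        ≡⟨ final K t p c m D ⟩
  p * c * t * K * m * D                          ∎
  where
  open ≤-Reasoning
  m = n * (n * (n * 1))
  regroup : ∀ a n Γ S b → a * n * Γ * (S * b * n * n) ≡ a * b * (n * (n * (n * 1))) * (Γ * S)
  regroup = solve-∀
  pull : ∀ a m b d c → a * m * (b * d) * c ≡ a * b * (m * d * c)
  pull = solve-∀
  final : ∀ k t p c m d → k * t * p * (m * d * c) ≡ p * c * t * k * m * d
  final = solve-∀

suc-power≤ : ∀ k m → 1 ≤ k → suc k ^ m ≤ k ^ m * 2 ^ m
suc-power≤ k m 1≤k = ≤-trans (^-monoˡ-≤ m (≤-trans (+-monoˡ-≤ k 1≤k) (≤-reflexive (twice k)))) (≤-reflexive (*-^ k 2 m))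
  where
  twice : ∀ w → w + w ≡ w * 2
  twice = solve-∀

running-time : ∀ n k r q R Q S F Γ P W → W ≡ suc k → 1 ≤ k → R ≤ r → 1 ≤ R → R ≤ W → Q ≡ q + 1 → Q ≤ W →
  S ≡ suc R ^ (Q + Q + 1) → F ≡ W * W * W * 128 →
  Γ ≡ (F + F) * (F + F) * (R + R) ^ (Q * 6) * 64 ^ (Q * 19) → P ≡ Q * F * n →
  P * Γ * (S * W * F * n * n) * 2357 ≤ constant * k ^ 23 * n ^ 3 * Exponential r q
running-time n k r q R Q S F Γ P W W≡ 1≤k R≤r 1≤R R≤ Q≡ Q≤ S≡ F≡ Γ≡ P≡ =
  subst₂ (λ s P → P * Γ * (s * n * n) * 2357 ≤ constant * k ^ 23 * n ^ 3 * Exponential r q)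
    (sym (*-assoc S W F)) (sym P≡)
    (product-bound (Q * F) n Γ S (W * F) ((F + F) * (F + F) * ((W + W) ^ 9 * 64 ^ 19)) (Exponential r q)
      2357 (k ^ 23) (2 ^ 23) polynomialConstant
      (table-size r q R Q S F Γ W R≤r 1≤R R≤ Q≡ S≡ Γ≡)
      (≤-trans (polynomial-part W F Q Q≤ F≡) (*-monoˡ-≤ polynomialConstant (≤-trans (≤-reflexive (cong (_^ 23) W≡)) (suc-power≤ k 23 1≤k)))))

time-shape : ∀ n k r q t L → 0 < r → q * r ≤ k → 1 ≤ L → t ≤ constant * k ^ 23 * n ^ 3 * Exponential r q →
             t ≤ constant * k ^ 23 * n ^ 3 * L · r ^ (8 * k + 0) * 2 ^ (122 * k) ^[1/ r ]
time-shape n k r q t L r>0 qr≤ 1≤L t≤ = begin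
  t ^ r                                 ≤⟨ ^-monoˡ-≤ r t≤ ⟩
  (A * Exponential r q) ^ r             ≡⟨ *-^ A (Exponential r q) r ⟩
  A ^ r * Exponential r q ^ r           ≤⟨ *-mono-≤ (^-monoˡ-≤ r (m≤m*n A L {{>-nonZero 1≤L}})) (exponential-bound r q k r>0 qr≤) ⟩
  (A * L) ^ r * (r ^ (8 * k) * 2 ^ (122 * k)) ≡⟨ cong (λ e → (A * L) ^ r * (r ^ e * 2 ^ (122 * k))) (sym (+-identityʳ (8 * k))) ⟩
  (A * L) ^ r * (r ^ (8 * k + 0) * 2 ^ (122 * k)) ∎
  where
  open ≤-Reasoning
  A = constant * k ^ 23 * n ^ 3

-- The machine program and its input

module Compiled = Compiler varCount heapBase

-- Cells 3 to 47 of the input are packed into cell 3, which frees the others for registers.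
packCode : ℕ → List Instr
packCode zero    = []
packCode (suc j) = packCode j ++ arith add 3 3 3 ∷ arith add 3 3 (4 + j) ∷ []

length-packCode : ∀ j → length (packCode j) ≡ j * 2
length-packCode zero    = refl
length-packCode (suc j) = trans (length-++ (packCode j)) (trans (+-comm _ 2) (cong (2 +_) (length-packCode j)))

programOf : ℕ → Stmt → Program
programOf j s = packCode j ++ Compiled.compS s (j * 2)

program : Program
program = programOf 44 programS

matrixCell<2 : ∀ {n} (G : Graph n) a → matrixCell G a < 2
matrixCell<2 {n} G a with a <? n * n
... | no _  = s≤s z≤n
... | yes p with uncurry (adj G) (Fin.remQuot n (Fin.fromℕ< p))
...   | true  = s≤s (s≤s z≤n)
...   | false = s≤s z≤n

matrixCell-0 : ∀ {n} → 0 < n → (G : Graph n) → matrixCell G 0 ≡ 0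
matrixCell-0 {suc n} _ G = trans (matrix-adj G Fin.zero Fin.zero) (cong (if_then 1 else 0) (no-loop G Fin.zero))

run-+ : ∀ P a {b} s → run P (a + b) s ≡ run P b (run P a s)
run-+ P zero    s = refl
run-+ P (suc a) s = run-+ P a (step P s)

run-halted : ∀ P d {s} → Halted P s → run P d s ≡ s
run-halted P zero    h = refl
run-halted P (suc d) {s} h = trans (cong (run P d) (step-halted h)) (run-halted P d h)
  where
  step-halted : ∀ {s} → Halted P s → step P s ≡ s
  step-halted {s} h with fetch P (pc s) | h
  ... | nothing | refl = refl

fetch-end : ∀ (P : Program) → fetch P (length P) ≡ nothing
fetch-end []      = refl
fetch-end (_ ∷ P) = fetch-end P

n<2^[1+log] : ∀ n → n < 2 ^ (1 + ⌊log₂ n ⌋)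
n<2^[1+log] n = ≰⇒> λ le → <⇒≱ (n<1+n ⌊log₂ n ⌋)
  (≤-trans (≤-reflexive (sym (⌊log₂[2^n]⌋≡n (1 + ⌊log₂ n ⌋)))) (⌊log₂⌋-mono-≤ le))

module Packing {n : ℕ} (G : Graph n) (r k B A N : ℕ) (body : Stmt) where
  open Compiled.Simulation B (programOf N body)
  open Copying B A (matrixCell G) using (pack)

  pack<2^ : ∀ j → pack j < 2 ^ suc j
  pack<2^ zero    = matrixCell<2 G 0
  pack<2^ (suc j) = begin-strict
    pack j * 2 + matrixCell G (suc j)  <⟨ +-monoʳ-< (pack j * 2) (matrixCell<2 G (suc j)) ⟩
    pack j * 2 + 2                     ≡⟨ +-comm (pack j * 2) 2 ⟩
    suc (pack j) * 2                   ≤⟨ *-monoˡ-≤ 2 (pack<2^ j) ⟩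
    2 ^ suc j * 2                      ≡⟨ *-comm (2 ^ suc j) 2 ⟩
    2 ^ suc (suc j)                    ∎ where open ≤-Reasoning

  pack-steps : ∀ j {m} → j ≤ N → (∀ i → i ≤ N → pack i ≤ B) → Fits (input G r k) →
    Compiled.Segment (programOf N body) 0 m (packCode j) →
    ∃[ M ] (Steps (j * 2) (start G r k) ⟨ m , M ⟩ × M 3 ≡ pack j × (∀ a → 3 ≢ a → M a ≡ input G r k a))
  pack-steps zero j≤ pack≤ f refl = input G r k , stop f , refl , λ _ _ → refl
  pack-steps (suc j) j≤ pack≤ f sg with Compiled.segment-++ (packCode j) sg
  ... | m , sg₁ , e₁ , e₂ , refl with pack-steps j (<⇒≤ j≤) pack≤ f sg₁
  ... | M , st , p , same =
    M₂ , subst (λ t → Steps t (start G r k) ⟨ 2 + m , M₂ ⟩) (+-comm (j * 2) 2) (st ◅◅ next (steps-end st) e₁ (next f₁ e₂ (stop f₂))) ,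
    val₂ , λ a 3≢a → trans (upd-other M₁ 3 _ a 3≢a) (trans (upd-other M 3 _ a 3≢a) (same a 3≢a))
    where
    M₁ M₂ : Memory
    M₁ = M [ 3 ≔ M 3 + M 3 ]
    M₂ = M₁ [ 3 ≔ M₁ 3 + M₁ (4 + j) ]
    double-pack : M 3 + M 3 ≡ pack j * 2
    double-pack = trans (cong₂ _+_ p p) (twice (pack j))
      where
      twice : ∀ m → m + m ≡ m * 2
      twice = solve-∀
    val₂ : M₁ 3 + M₁ (4 + j) ≡ pack (suc j)
    val₂ = cong₂ _+_ double-pack (same (4 + j) λ ())
    f₁ : Fits M₁
    f₁ = fits-upd 3 (steps-end st) (≤-trans (≤-reflexive double-pack) (m+n≤o⇒m≤o (pack j * 2) (pack≤ (suc j) j≤)))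
    f₂ : Fits M₂
    f₂ = fits-upd {M₁} 3 f₁ (≤-trans (≤-reflexive val₂) (pack≤ (suc j) j≤))

  run-program : ∀ {c} (Q : Store → Set) → Compiled.WfS body → (∀ i → i ≤ N → pack i ≤ B) → Fits (input G r k) →
    (∀ {σ} → V σ 0 ≡ n → V σ 1 ≡ k → V σ 2 ≡ r → V σ 3 ≡ pack N → (∀ i → H σ i ≡ matrixCell G (45 + i)) → Rules.WP B body c Q σ) →
    ∃[ t ] ∃[ M ] ∃[ σ ] (Steps t (start G r k) ⟨ length (programOf N body) , M ⟩ × t ≤ N * 2 + c × M ≈ σ × Q σ)
  run-program {c} Q wf pack≤ f wp = continue (pack-steps N ≤-refl pack≤ f packSegment)
    where
    code : List Instr
    code = Compiled.compS body (N * 2)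
    packSegment : Compiled.Segment (programOf N body) 0 (N * 2) (packCode N)
    packSegment = subst (λ e → Compiled.Segment (programOf N body) 0 e (packCode N)) (length-packCode N)
      (Compiled.segment-whole [] (packCode N) code)
    bodySegment : Compiled.Segment (programOf N body) (N * 2) (length (programOf N body)) code
    bodySegment = subst₂ (λ i P → Compiled.Segment P i (length (programOf N body)) code)
      (length-packCode N) (cong (packCode N ++_) (++-identityʳ code))
      (subst (λ e → Compiled.Segment (packCode N ++ code ++ []) (length (packCode N)) e code)
        (sym (length-++ (packCode N))) (Compiled.segment-whole (packCode N) code []))
    continue : ∃[ M ] (Steps (N * 2) (start G r k) ⟨ N * 2 , M ⟩ × M 3 ≡ pack N × (∀ a → 3 ≢ a → M a ≡ input G r k a)) →
      ∃[ t ] ∃[ M ] ∃[ σ ] (Steps t (start G r k) ⟨ length (programOf N body) , M ⟩ × t ≤ N * 2 + c × M ≈ σ × Q σ)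
    continue (M , st , p , same) = finish (wp {σ} (same 0 λ ()) (same 1 λ ()) (same 2 λ ()) p (λ i → same (48 + i) λ ()))
      where
      σ : Store
      σ = ⟪ M , (λ i → M (48 + i)) ⟫
      finish : Rules.WP B body c Q σ → ∃[ t ] ∃[ M ] ∃[ σ ] (Steps t (start G r k) ⟨ length (programOf N body) , M ⟩ × t ≤ N * 2 + c × M ≈ σ × Q σ)
      finish (σ′ , c′ , ex , c≤ , q) =
        let M′ , st′ , sim = compS-correct (<ᵇ⇒< 37 48 _) ex bodySegment wf record { vars = λ _ → refl ; heap = λ _ → refl ; fits = steps-end st }
        in N * 2 + c′ , M′ , σ′ , st ◅◅ st′ , +-monoʳ-≤ (N * 2) c≤ , sim , q

-- Word length and the decision procedure

module Decision {n : ℕ} (G : Graph n) (k r R Q S F Γ P : ℕ) (n>0 : 0 < n) (k>0 : 0 < k) (r>0 : 0 < r)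
  (R≡ : R ≡ r ∸ (r ∸ (k + 1))) (Q≡ : Q ≡ apply div k r + 1) (S≡ : S ≡ suc R ^ (Q + Q + 1))
  (F≡ : F ≡ (k + 1) * (k + 1) * (k + 1) * 128)
  (Γ≡ : Γ ≡ (F + F) * (F + F) * (R + R) ^ (Q * 6) * 64 ^ (Q * 19)) (P≡ : P ≡ Q * F * n) where

  R>0 : 0 < R
  R>0 = subst (0 <_) (sym R≡) (min≤ r (k + 1) r>0 (m≤n+m 1 k))

  R≤r : R ≤ r
  R≤r = ≤-trans (≤-reflexive R≡) (m∸n≤m r (r ∸ (k + 1)))

  R≤1+k : R ≤ suc k
  R≤1+k = ≤-trans (≤-reflexive R≡) (≤-trans (min≤ʳ r (k + 1)) (≤-reflexive (+-comm k 1)))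

  Q>0 : 0 < Q
  Q>0 = subst (0 <_) (sym Q≡) (m≤n+m 1 (apply div k r))

  S>0 : 0 < S
  S>0 = subst (0 <_) (sym S≡) (m^n>0 (suc R) (Q + Q + 1))

  F>0 : 0 < F
  F>0 = subst (0 <_) (sym F≡) (*-mono-≤ {1} {(k + 1) * (k + 1) * (k + 1)} {1} {128}
          (*-mono-≤ {1} {(k + 1) * (k + 1)} {1} {k + 1} (*-mono-≤ {1} {k + 1} {1} {k + 1} (m≤n+m 1 k) (m≤n+m 1 k)) (m≤n+m 1 k)) (s≤s z≤n))

  FF>0 : 0 < F + F
  FF>0 = ≤-trans F>0 (m≤m+n F F)

  Γ>0 : 0 < Γ
  Γ>0 = subst (0 <_) (sym Γ≡) (*-mono-≤ {1} {(F + F) * (F + F) * (R + R) ^ (Q * 6)} {1} {64 ^ (Q * 19)}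
          (*-mono-≤ {1} {(F + F) * (F + F)} {1} {(R + R) ^ (Q * 6)} (*-mono-≤ {1} {F + F} {1} {F + F} FF>0 FF>0)
            (m^n>0 (R + R) {{>-nonZero (≤-trans R>0 (m≤m+n R R))}} (Q * 6))) (m^n>0 64 (Q * 19)))

  module Ti = Time n k R Q S F Γ P (n * n) (suc k * S * n) n>0 Q>0 S>0 F>0 Γ>0 P≡ refl refl R≤1+k

  n≤P : n ≤ P
  n≤P = ≤-trans (m≤n*m n (Q * F) {{>-nonZero (*-mono-≤ {1} {Q} {1} {F} Q>0 F>0)}}) (≤-reflexive (sym P≡))

  module Ac = Acceptance n k r R Q S F Γ P G n>0 r>0 Ti.P>0 R>0 R≡ Q≡ S≡ F≡ Γ≡ P≡

  -- The word length depends on `t`, so `t` is the closed time bound and not the actual number of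
  -- steps; the machine idles in its halted state for the difference. The factor 64 makes a word
  -- hold both `U` and the constants below 2⁶⁴, such as the 45 packed matrix bits.
  t U w : ℕ
  t = Ti.bound
  U = n + k + r + t
  w = 64 * (1 + ⌊log₂ U ⌋)

  B : ℕ
  B = pred (2 ^ w)

  word-power : 2 ^ w ≡ (2 ^ (1 + ⌊log₂ U ⌋)) ^ 64
  word-power = trans (cong (2 ^_) (*-comm 64 (1 + ⌊log₂ U ⌋))) (sym (^-*-assoc 2 (1 + ⌊log₂ U ⌋) 64))

  p≥2 : 2 ≤ 2 ^ (1 + ⌊log₂ U ⌋)
  p≥2 = ^-monoʳ-≤ 2 {1} {1 + ⌊log₂ U ⌋} (s≤s z≤n)

  U≤B : U ≤ B
  U≤B = pred-mono-≤ (≤-trans (n<2^[1+log] U) (≤-trans (≤-trans (≤-reflexive (sym (*-identityʳ _)))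
          (^-monoʳ-≤ (2 ^ (1 + ⌊log₂ U ⌋)) {{>-nonZero (≤-trans (s≤s z≤n) p≥2)}} {1} {64} (s≤s z≤n))) (≤-reflexive (sym word-power))))

  const≤B : ∀ {x} → x < 2 ^ 64 → x ≤ B
  const≤B x< = pred-mono-≤ (≤-trans x< (≤-trans (^-monoˡ-≤ 64 p≥2) (≤-reflexive (sym word-power))))

  t≤B : t ≤ B
  t≤B = ≤-trans (m≤n+m t (n + k + r)) U≤B

  fits-word : ∀ {x} → x ≤ B → x < 2 ^ w
  fits-word {x} x≤ = ≤-trans (s≤s x≤) (≤-reflexive (suc-pred (2 ^ w) {{m^n≢0 2 w}}))

  A O Tb tot : ℕ
  A = n * n
  O = A + A + 48
  Tb = O + n
  tot = suc k * S * n

  open Packing G r k B A 44 programS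

  pack≤ : ∀ i → i ≤ 44 → Copying.pack B A (matrixCell G) i ≤ B
  pack≤ i i≤ = const≤B (<-≤-trans (pack<2^ i) (^-monoʳ-≤ 2 {suc i} {64} (≤-trans (s≤s i≤) (≤ᵇ⇒≤ 45 64 _))))

  input≤ : ∀ a → input G r k a ≤ B
  input≤ 0 = ≤-trans (≤-trans (m≤m+n n k) (≤-trans (m≤m+n (n + k) r) (m≤m+n (n + k + r) t))) U≤B
  input≤ 1 = ≤-trans (≤-trans (m≤n+m k n) (≤-trans (m≤m+n (n + k) r) (m≤m+n (n + k + r) t))) U≤B
  input≤ 2 = ≤-trans (≤-trans (m≤n+m r (n + k)) (m≤m+n (n + k + r) t)) U≤B
  input≤ (suc (suc (suc a))) = const≤B (<-≤-trans (matrixCell<2 G a) (^-monoʳ-≤ 2 {1} {64} (s≤s z≤n)))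

  module Wh = Whole B n k r R Q S F Γ P A O Tb tot G
    (const≤B (^-monoʳ-< 2 (s≤s (s≤s z≤n)) {19} {64} (<ᵇ⇒< 19 64 _)))
    (≤-trans Ti.k+1≤ t≤B) (≤-trans Ti.Q19≤ t≤B) (≤-trans Ti.P4≤ t≤B) (≤-trans Ti.SR≤ t≤B)
    (≤-trans Ti.Pn≤ t≤B) (≤-trans Ti.PΓ≤ t≤B) (≤-trans Ti.heap≤ t≤B) pack≤
    n>0 Ti.P>0 S>0 Γ>0 n≤P R>0 R≤r R≡ Q≡ S≡ F≡ Γ≡ P≡ refl refl refl refl

  accepted : RSimpleKPath G r k → ∃[ c ] (c < P * Γ × Wh.Se.Accepts c)
  accepted path = use (Ac.good-guess path)
    where
    use : Ac.GoodGuess → ∃[ c ] (c < P * Γ × Wh.Se.Accepts c)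
    use (a , os , colour , p , a< , g< , len , offs , col≤ , walk , classes) =
      Wh.Se.accepts-complete {{>-nonZero Ti.P>0}} (Q + Q) (trans S≡ (cong (suc R ^_) (+-comm (Q + Q) 1)))
        a os colour a< g< len offs col≤ refl p walk classes

  Answer : Store → Set
  Answer σ = (V σ 0 ≢ 0 → RSimpleKPath G r k) × (RSimpleKPath G r k → V σ 0 ≢ 0)

  outcome : ∃[ t₀ ] ∃[ M ] ∃[ σ ] (Compiled.Simulation.Steps B program t₀ (start G r k) ⟨ length program , M ⟩ ×
              t₀ ≤ 88 + Wh.programTime × Compiled.Simulation._≈_ B program M σ × Answer σ)
  outcome = run-program Answer _ pack≤ input≤ (Wh.program-correct accepted (matrixCell<2 G) (matrixCell-0 n>0 G))

  decides : DecidesWithin t w program G r k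
  decides = extend outcome
    where
    open Compiled.Simulation B program
    extend : ∃[ t₀ ] ∃[ M ] ∃[ σ ] (Steps t₀ (start G r k) ⟨ length program , M ⟩ × t₀ ≤ 88 + Wh.programTime × M ≈ σ × Answer σ) →
             DecidesWithin t w program G r k
    extend (t₀ , M , σ , st , t₀≤ , sim , sound , complete) = record
      { halts   = subst (Halted program) (sym final) (fetch-end program)
      ; correct = mk⇔ (λ nz → sound (subst (_≢ 0) (trans (cong (λ s → mem s 0) final) (vars sim (s≤s z≤n))) nz))
                      (λ path → subst (_≢ 0) (sym (trans (cong (λ s → mem s 0) final) (vars sim (s≤s z≤n)))) (complete path))
      ; fits    = λ s _ a → fits-word (bounded s a) }
      where
      t₀≤t : t₀ ≤ t
      t₀≤t = ≤-trans t₀≤ Ti.time≤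
      after : ∀ s → t₀ ≤ s → run program s (start G r k) ≡ ⟨ length program , M ⟩
      after s le = trans (cong (λ s → run program s (start G r k)) (sym (m+[n∸m]≡n le)))
        (trans (run-+ program t₀ (start G r k)) (trans (cong (run program (s ∸ t₀)) (steps-run st)) (run-halted program (s ∸ t₀) (fetch-end program))))
      final : run program t (start G r k) ≡ ⟨ length program , M ⟩
      final = after t t₀≤t
      bounded : ∀ s a → mem (run program s (start G r k)) a ≤ B
      bounded s a with s ≤? t₀
      ... | yes le = steps-fit st s le a
      ... | no ≰   = subst (λ s → mem s a ≤ B) (sym (after s (<⇒≤ (≰⇒> ≰)))) (steps-end st a)

  time-bound : t ≤ constant * k ^ 23 * n ^ 3 * (1 + ⌊log₂ n ⌋) · r ^ (8 * k + 0) * 2 ^ (122 * k) ^[1/ r ]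
  time-bound = time-shape n k r (apply div k r) t (1 + ⌊log₂ n ⌋) r>0 (div-mul≤ k r) (s≤s z≤n)
    (running-time n k r (apply div k r) R Q S F Γ P (suc k) refl k>0 R≤r R>0 R≤1+k Q≡ (≤-trans Ac.Q≤W (≤-reflexive (+-comm k 1)))
      S≡ (trans F≡ (cong (λ w → w * w * w * 128) {k + 1} {suc k} (+-comm k 1))) Γ≡ P≡)

  decision : ∃[ t ]
    (DecidesWithin t (64 * (1 + ⌊log₂ (n + k + r + t) ⌋)) program G r k ×
     t ≤ constant * k ^ 23 * n ^ 3 * (1 + ⌊log₂ n ⌋) · r ^ (8 * k + 0) * 2 ^ (122 * k) ^[1/ r ])
  decision = t , decides , time-bound

theorem2 : ∃[ P ] ∃[ C ] ∃[ c ] ∃[ d ] ∃[ f ] ∃[ w ]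
    (LittleO f ×
    (∀ (n r k : ℕ) .{{_ : NonZero n}} .{{_ : NonZero r}} .{{_ : NonZero k}}
    (G : Graph n) →
    ∃[ t ]
    (DecidesWithin t (w * (1 + ⌊log₂ (n + k + r + t) ⌋)) P G r k ×
    t ≤ C * k ^ d * n ^ 3 * (1 + ⌊log₂ n ⌋)
    · r ^ (8 * k + f k) * 2 ^ (c * k) ^[1/ r ])))
theorem2 = program , constant , 122 , 23 , (λ _ → 0) , 64 ,
  (λ m → 0 , λ k _ → ≤-trans (≤-reflexive (*-zeroʳ m)) z≤n) ,
  -- Up to this point the parameters are variables with defining equations, which keeps their large
  -- powers opaque; `refl` now supplies the values.
  λ n r k G → Decision.decision G k r _ _ _ _ _ _ (>-nonZero⁻¹ n) (>-nonZero⁻¹ k) (>-nonZero⁻¹ r)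
    refl refl refl refl refl refl
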